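{- For all integers $n \geq 0$: \begin{enumerate} \item $a_7(2n+2) \geq 2a_7(n)$; \item $a_7(4n+6) \geq 10a_7(n)$; \item $a_{7,0}(n) \geq 9a_{7,2}(n)$; \item $a_{7,1}(n) \geq 2a_{7,-1}(n)$; \item $a_7(28n+4r) = 5a_7(14n+2r-1)$ for $r = 1, 2, 6$; \item $a_7(28n+4r+2) + 4a_7(7n+r-1) = 5a_7(14n+2r)$ for $r = 2, 4, 5$. \end{enumerate}
   Context: A partition $\pi=(\lambda_1,\dots,\lambda_r)$ of $n$ is a nonincreasing sequence of positive integers summing to $n$. A partition is a $t$-core if it has no hook (rim hook) of length $t$. $a_7(n)$ denotes the number of 7-core partitions of $n$ (so $\sum_{n\ge0}a_7(n)q^n=\prod_{j\ge1}(1-q^{7j})^7/(1-q^j)$). The BG-rank of $\pi=(\lambda_1,\dots,\lambda_r)$ is $\sum_{j=1}^r(-1)^{j+1}\mathrm{par}(\lambda_j)$, where $\mathrm{par}(\lambda)=1$ if $\lambda$ is odd and $0$ if $\lambda$ is even. $a_{7,j}(n)$ denotes the number of 7-core partitions of $n$ with BG-rank equal to $j$. -}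

module Defs where

open import Data.Bool using (Bool; true; false; _∧_; not; T)
open import Data.Nat using (ℕ; zero; suc; _+_; _∸_; _≡ᵇ_; _<ᵇ_; _≤ᵇ_)
open import Data.Integer using (ℤ; +_; _-_)
open import Data.List using (List; []; _∷_; [_]; map; concatMap; filter; length; upTo; zip)
open import Data.Nat.ListAction using (sum)
open import Data.Bool.ListAction using (any)
open import Data.Product using (_,_)
open import Relation.Nullary.Decidable.Core using (T?)

-- Partitions are represented as lists λ₁ ∷ λ₂ ∷ … ∷ λᵣ ∷ [] of positive
-- naturals, nonincreasing, summing to n.

listsOf : ℕ → ℕ → List (List ℕ)
listsOf zero    b = [ [] ]
listsOf (suc k) b = concatMap (λ x → map (x ∷_) (listsOf k b)) (map suc (upTo b))

nonincreasing : List ℕ → Bool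
nonincreasing []           = true
nonincreasing (x ∷ [])     = true
nonincreasing (x ∷ y ∷ xs) = (y ≤ᵇ x) ∧ nonincreasing (y ∷ xs)

isPartitionOf : ℕ → List ℕ → Bool
isPartitionOf n l = nonincreasing l ∧ (sum l ≡ᵇ n)

-- every partition of n has at most n parts, each in {1,…,n};
-- so this is the (duplicate-free) list of all partitions of n
partitions : ℕ → List (List ℕ)
partitions n =
  filter (λ l → T? (isPartitionOf n l)) (concatMap (λ k → listsOf k n) (upTo (suc n)))

-- conjugate part λ'_{j+1} = #{ i : λᵢ > j }  (0-indexed column j)
conjPart : List ℕ → ℕ → ℕ
conjPart l j = length (filter (λ x → T? (j <ᵇ x)) l)

-- hook lengths of all cells (i, j) (0-indexed row i, column j < λ_{i+1}):
-- h(i,j) = (λ_{i+1} - j - 1) + (λ'_{j+1} - i - 1) + 1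
hookLengths : List ℕ → List ℕ
hookLengths l =
  concatMap (λ { (i , li) → map (λ j → (li ∸ suc j) + (conjPart l j ∸ suc i) + 1) (upTo li) })
            (zip (upTo (length l)) l)

isCore : ℕ → List ℕ → Bool
isCore t l = not (any (λ h → h ≡ᵇ t) (hookLengths l))

a7 : ℕ → ℕ
a7 n = length (filter (λ l → T? (isCore 7 l)) (partitions n))

par : ℕ → ℤ
par zero          = + 0
par (suc zero)    = + 1
par (suc (suc k)) = par k

-- BG-rank: Σ_j (-1)^{j+1} par(λ_j) = par λ₁ - (par λ₂ - (par λ₃ - …))
bgRank : List ℕ → ℤ
bgRank []       = + 0
bgRank (x ∷ xs) = par x - bgRank xs

a7bg : ℤ → ℕ → ℕ
a7bg j n = length (filter (λ l → T? (isCore 7 l ∧ ⌊ bgRank l ≟ℤ j ⌋)) (partitions n))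
  where
    open import Data.Integer using () renaming (_≟_ to _≟ℤ_)
    open import Relation.Nullary.Decidable.Core using (⌊_⌋)

{-# OPTIONS --safe #-}

-- Reading a 7-core off its 7-abacus turns the 7-cores of n into the vectors x ∈ ℤ⁷ with vanishing sum, square length
-- 14 (n + 2), entries congruent to c, c + 1, …, c + 6 modulo 7, and minimal first entry; the BG-rank is a function of
-- the number of odd entries. These vectors form a coset in an ideal of ℤ[ζ₇], which over 𝒪 = ℤ[(1 + √-7)/2] is the
-- unimodular Klein lattice ℒ of rank 3. Rotating the entries, and averaging over the signed permutations of 𝒪³, which
-- also act on ℒ, reduces 7-cores to the numbers 𝐍 m of vectors of norm m in ℒ that are primitive at √-7.
-- The lattices ℒ and 𝒪³ are neighbours at the prime α above 2, which gives the Hecke relations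
--   𝐍(2m) + 2 𝐍(m) + 4 𝐍(m/2) = 7 𝐫(m)   and   𝐫(2m) + 2 𝐫(m) + 4 𝐫(m/2) = 6 𝐫(m) + 𝐍(m),
-- where 𝐫 counts the primitive vectors of 𝒪³. If m is a non-residue modulo 7 then 𝐫(m) = 𝐍(m), because both lattices
-- contain the same kernel of the slope form, and the two equalities follow. In general diagonalising the relations
-- gives the first two inequalities. The cores of BG-rank 2 are the vectors 2 x, hence correspond to the 7-cores of
-- (n - 6)/4; those of BG-rank -1 have six odd entries, and symmetry shows that they make up at most a third.
module Submission where

open import Defs
open import Data.Nat using (ℕ; _+_; _*_; _∸_; _≥_)
open import Data.Integer using (+_; -[1+_])
open import Data.Product using (_×_)
open import Data.Sum using (_⊎_)
open import Relation.Binary.PropositionalEquality using (_≡_)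

import Data.Nat as ℕ
import Data.Nat.Properties as ℕₚ
import Data.Nat.Divisibility as ℕ∣
import Data.Integer as ℤ
import Data.Integer.Properties as ℤₚ
import Data.Fin.Properties as Finₚ
import Data.List as List
import Data.List.Properties as Listₚ
import Data.List.Relation.Binary.Permutation.Propositional.Properties as ↭ₚ
import Data.List.Relation.Binary.Permutation.Setoid.Properties as ↭ₛₚ
import Data.List.Relation.Unary.All.Properties as Allₚ
import Data.List.Relation.Unary.AllPairs.Properties as AllPairsₚ
import Data.List.Relation.Unary.Any.Properties as Anyₚ
import Data.List.Relation.Unary.Unique.Propositional.Properties as Uniqueₚ
import Data.Vec.Properties as Vecₚ
open import Algebra.Properties.CommutativeSemigroup ℕₚ.+-commutativeSemigroup
  using () renaming (interchange to +-interchange)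
open import Data.Bool using (Bool; true; false; _∧_; _∨_; not; T; if_then_else_)
open import Data.Bool.ListAction using (all; any)
open import Data.Bool.Properties using (T-∧; ∧-assoc; ∧-comm)
open import Data.Empty using (⊥)
open import Data.Fin using (Fin; zero; suc; toℕ; fromℕ<)
open import Data.Fin.Patterns using (0F; 1F; 2F; 3F; 4F; 5F)
open import Data.Integer using (ℤ)
open import Data.Integer.DivMod using (_%ℕ_; _/ℕ_; a≡a%ℕn+[a/ℕn]*n; n%ℕd<d)
open import Data.Integer.Tactic.RingSolver using (solve-∀)
open import Data.List using (List; []; _∷_; _++_; length)
open import Data.List.Membership.Propositional using (_∈_; _∉_; find)
open import Data.List.Membership.Propositional.Properties
  using (∈-map⁺; ∈-map⁻; ∈-filter⁺; ∈-filter⁻; ∈-∃++; ∈-applyUpTo⁻; ∈-upTo⁺; ∈-downFrom⁺; ∈-downFrom⁻;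
         ∈-concat⁺′; ∈-concat⁻′; ∈-cartesianProductWith⁺; ∈-cartesianProductWith⁻)
open import Data.List.Membership.DecPropositional ℕ._≟_ using (_∈?_)
open import Data.List.Relation.Binary.Permutation.Propositional using (_↭_; ↭-sym; ↭⇒↭ₛ)
open import Data.List.Relation.Unary.All as All using (All; []; _∷_)
open import Data.List.Relation.Unary.AllPairs as AllPairs using (AllPairs; []; _∷_)
open import Data.List.Relation.Unary.Any using (Any; here; there)
open import Data.List.Relation.Unary.Unique.DecPropositional ℤ._≟_ using (unique?)
open import Data.List.Relation.Unary.Unique.Propositional using (Unique)
open import Data.Nat using (zero; suc; _≤_; _<_; _≡ᵇ_; _<ᵇ_; _≤ᵇ_)
open import Data.Nat.DivMod
  using (_%_; _/_; m≡m%n+[m/n]*n; m%n<n; [m+kn]%n≡m%n; %-distribˡ-+; %-distribˡ-*; m%n%n≡m%n; m<n⇒m%n≡m)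
open import Data.Nat.Induction using (<-wellFounded)
open import Data.Nat.ListAction using (sum)
open import Data.Nat.ListAction.Properties using (sum-↭)
open import Data.Nat.Tactic.RingSolver using () renaming (solve-∀ to solveℕ)
open import Data.Product using (_,_; ∃; ∃₂; proj₁; proj₂)
open import Data.Sum using (inj₁; inj₂)
open import Data.Unit using (⊤; tt)
open import Data.Vec using (Vec; []; _∷_; head; tail; map; zipWith; toList; tabulate; lookup; replicate)
open import Data.Vec.Relation.Unary.All as Vecᴬ using ([]; _∷_)
open import Function.Base using (_∘_)
open import Function.Bundles using (Equivalence)
open import Induction.WellFounded using (Acc; acc)
open import Relation.Nullary using (Dec; yes; no; contradiction; ¬_)
open import Relation.Nullary.Decidable.Core using (T?; ⌊_⌋; isYes)
open import Relation.Binary.PropositionalEquality hiding (_≡_)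

-- Cores are vectors of slope 1, but the similarities behind the Hecke relations do not respect
-- slopes: being 𝒪-linear, they only respect primitivity at `√-7`. The two counts are bridged by the
-- conic of isotropic vectors in 𝔽₇³. It has 8 points, hence 48 nonzero vectors, and these are
-- exactly the images of (1, 2, 3) under the 48 signed permutations. Averaging therefore replaces
-- the slope by the number `κ` of isotropic forms with value 1 at a nonzero residue vector, which
-- depends only on its norm. As 2 is a square modulo 7, `κ` is the same for m and 2m, so
-- inequalities for `𝐍` pass to cores. The geometry becomes finite: identities between closed
-- integer matrices, and tests over the 64 classes of ℤ⁶ modulo 2 and the 343 classes of ℤ³ modulo
-- 7. The Hecke relations have eigenvalues 5 and -3. The recursion for 5 has roots 1 and 4; the one
-- for -3 = α² + ᾱ² has the roots α² and ᾱ², of absolute value 2. The first part dominates, and only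
-- small powers of 2 need separate treatment.

−1 −2 −3 −4 −5 : ℤ
−1 = -[1+ 0 ]
−2 = -[1+ 1 ]
−3 = -[1+ 2 ]
−4 = -[1+ 3 ]
−5 = -[1+ 4 ]

-- Integer vectors, matrices and quadratic forms.

ℤ^ : ℕ → Set
ℤ^ n = Vec ℤ n

Mat : ℕ → ℕ → Set
Mat m n = Vec (ℤ^ n) m

infixl 6 _⊕_ _⊞_
infix 8 _ᵀ
infixr 7 _⊙_ _⊛_
infixl 7 _⊠_

_⊕_ : ∀ {n} → ℤ^ n → ℤ^ n → ℤ^ n
_⊕_ = zipWith ℤ._+_

_⊙_ : ∀ {n} → ℤ → ℤ^ n → ℤ^ n
k ⊙ x = map (k ℤ.*_) x

dot : ∀ {n} → ℤ^ n → ℤ^ n → ℤ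
dot []      []      = + 0
dot (a ∷ x) (b ∷ y) = a ℤ.* b ℤ.+ dot x y

_⊛_ : ∀ {m n} → Mat m n → ℤ^ n → ℤ^ m
M ⊛ x = map (λ r → dot r x) M

comb : ∀ {m n} → ℤ^ m → Mat m n → ℤ^ n
comb []      []      = replicate _ (+ 0)
comb (a ∷ x) (r ∷ M) = a ⊙ r ⊕ comb x M

_⊠_ : ∀ {k m n} → Mat k m → Mat m n → Mat k n
A ⊠ M = map (λ r → comb r M) A

_ᵀ : ∀ {m n} → Mat m n → Mat n m
[] ᵀ      = replicate _ []
(r ∷ M) ᵀ = zipWith _∷_ r (M ᵀ)

_⊞_ : ∀ {m n} → Mat m n → Mat m n → Mat m n
_⊞_ = zipWith _⊕_

dot-comm : ∀ {n} (x y : ℤ^ n) → dot x y ≡ dot y x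
dot-comm []      []      = refl
dot-comm (a ∷ x) (b ∷ y) = cong₂ ℤ._+_ (ℤₚ.*-comm a b) (dot-comm x y)

dot-zeroˡ : ∀ {n} (x : ℤ^ n) → dot (replicate n (+ 0)) x ≡ + 0
dot-zeroˡ []      = refl
dot-zeroˡ (a ∷ x) = trans (ℤₚ.+-identityˡ _) (dot-zeroˡ x)

dot-⊕ˡ : ∀ {n} (x y v : ℤ^ n) → dot (x ⊕ y) v ≡ dot x v ℤ.+ dot y v
dot-⊕ˡ []      []      []      = refl
dot-⊕ˡ (a ∷ x) (b ∷ y) (c ∷ v) rewrite dot-⊕ˡ x y v = lem a b c (dot x v) (dot y v)
  where
  lem : ∀ a b c p q → (a ℤ.+ b) ℤ.* c ℤ.+ (p ℤ.+ q) ≡ (a ℤ.* c ℤ.+ p) ℤ.+ (b ℤ.* c ℤ.+ q)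
  lem = solve-∀

dot-⊙ˡ : ∀ {n} k (x v : ℤ^ n) → dot (k ⊙ x) v ≡ k ℤ.* dot x v
dot-⊙ˡ k []      []      = sym (ℤₚ.*-zeroʳ k)
dot-⊙ˡ k (a ∷ x) (c ∷ v) rewrite dot-⊙ˡ k x v = lem k a c (dot x v)
  where
  lem : ∀ k a c p → (k ℤ.* a) ℤ.* c ℤ.+ k ℤ.* p ≡ k ℤ.* (a ℤ.* c ℤ.+ p)
  lem = solve-∀

dot-⊕ʳ : ∀ {n} (v x y : ℤ^ n) → dot v (x ⊕ y) ≡ dot v x ℤ.+ dot v y
dot-⊕ʳ v x y = trans (dot-comm v (x ⊕ y))
  (trans (dot-⊕ˡ x y v) (cong₂ ℤ._+_ (dot-comm x v) (dot-comm y v)))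

dot-⊙ʳ : ∀ {n} k (v x : ℤ^ n) → dot v (k ⊙ x) ≡ k ℤ.* dot v x
dot-⊙ʳ k v x = trans (dot-comm v (k ⊙ x)) (trans (dot-⊙ˡ k x v) (cong (k ℤ.*_) (dot-comm x v)))

dot-comb : ∀ {m n} (u : ℤ^ m) (M : Mat m n) (x : ℤ^ n) → dot (comb u M) x ≡ dot u (M ⊛ x)
dot-comb []      []      x = dot-zeroˡ x
dot-comb (a ∷ u) (r ∷ M) x =
  trans (dot-⊕ˡ (a ⊙ r) (comb u M) x) (cong₂ ℤ._+_ (dot-⊙ˡ a r x) (dot-comb u M x))

⊠-⊛ : ∀ {k m n} (A : Mat k m) (M : Mat m n) (x : ℤ^ n) → (A ⊠ M) ⊛ x ≡ A ⊛ M ⊛ x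
⊠-⊛ []      M x = refl
⊠-⊛ (r ∷ A) M x = cong₂ _∷_ (dot-comb r M x) (⊠-⊛ A M x)

comb-ᵀ : ∀ {m n} (u : ℤ^ m) (M : Mat m n) → comb u M ≡ (M ᵀ) ⊛ u
comb-ᵀ []      []      = zeros _
  where
  zeros : ∀ n → replicate n (+ 0) ≡ map (λ r → dot r []) (replicate n [])
  zeros zero    = refl
  zeros (suc n) = cong (+ 0 ∷_) (zeros n)
comb-ᵀ (a ∷ u) (r ∷ M) rewrite comb-ᵀ u M = step r (M ᵀ)
  where
  step : ∀ {n} (r : ℤ^ n) (N : Mat n _) →
    a ⊙ r ⊕ N ⊛ u ≡ map (λ s → dot s (a ∷ u)) (zipWith _∷_ r N)
  step []      []      = refl
  step (b ∷ r) (s ∷ N) = cong₂ _∷_ (cong (ℤ._+ dot s u) (ℤₚ.*-comm a b)) (step r N)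

dot-ᵀ : ∀ {m n} (M : Mat m n) (x : ℤ^ n) (u : ℤ^ m) → dot (M ⊛ x) u ≡ dot x ((M ᵀ) ⊛ u)
dot-ᵀ M x u = begin
  dot (M ⊛ x) u ≡⟨ dot-comm (M ⊛ x) u ⟩
  dot u (M ⊛ x) ≡⟨ dot-comb u M x ⟨
  dot (comb u M) x ≡⟨ cong (λ t → dot t x) (comb-ᵀ u M) ⟩
  dot ((M ᵀ) ⊛ u) x ≡⟨ dot-comm ((M ᵀ) ⊛ u) x ⟩
  dot x ((M ᵀ) ⊛ u) ∎
  where open ≡-Reasoning

⊛-⊕ : ∀ {m n} (M : Mat m n) x y → M ⊛ (x ⊕ y) ≡ M ⊛ x ⊕ M ⊛ y
⊛-⊕ []      x y = refl
⊛-⊕ (r ∷ M) x y = cong₂ _∷_ (dot-⊕ʳ r x y) (⊛-⊕ M x y)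

⊛-⊙ : ∀ {m n} (M : Mat m n) k x → M ⊛ (k ⊙ x) ≡ k ⊙ M ⊛ x
⊛-⊙ []      k x = refl
⊛-⊙ (r ∷ M) k x = cong₂ _∷_ (dot-⊙ʳ k r x) (⊛-⊙ M k x)

⊞-⊛ : ∀ {m n} (A B : Mat m n) x → (A ⊞ B) ⊛ x ≡ A ⊛ x ⊕ B ⊛ x
⊞-⊛ []      []      x = refl
⊞-⊛ (r ∷ A) (s ∷ B) x = cong₂ _∷_ (dot-⊕ˡ r s x) (⊞-⊛ A B x)

scalar : ∀ n → ℤ → Mat n n
scalar zero    d = []
scalar (suc n) d = (d ∷ replicate n (+ 0)) ∷ map (+ 0 ∷_) (scalar n d)

scalar-⊛ : ∀ {n} d (x : ℤ^ n) → scalar n d ⊛ x ≡ d ⊙ x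
scalar-⊛ {zero}  d []      = refl
scalar-⊛ {suc n} d (a ∷ x) = cong₂ _∷_
  (trans (cong (λ t → d ℤ.* a ℤ.+ t) (dot-zeroˡ x)) (ℤₚ.+-identityʳ _))
  (trans (drop (scalar n d)) (scalar-⊛ d x))
  where
  drop : ∀ {k} (M : Mat k n) → map (+ 0 ∷_) M ⊛ (a ∷ x) ≡ M ⊛ x
  drop []      = refl
  drop (r ∷ M) = cong₂ _∷_ (ℤₚ.+-identityˡ _) (drop M)

⊙-cancel : ∀ {n} k .{{_ : ℤ.NonZero k}} (x y : ℤ^ n) → k ⊙ x ≡ k ⊙ y → x ≡ y
⊙-cancel k []      []      e = refl
⊙-cancel k (a ∷ x) (b ∷ y) e = cong₂ _∷_
  (ℤₚ.*-cancelˡ-≡ k a b (cong head e)) (⊙-cancel k x y (cong tail e))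

-- `H` need not be symmetric: a cross coefficient is stored on one side, so that forms such as a² +
-- ab + 2b² have integer matrices. The symmetric matrix is `polar H`, which gives twice the form.
quad : ∀ {n} → Mat n n → ℤ^ n → ℤ
quad H x = dot x (H ⊛ x)

polar : ∀ {n} → Mat n n → Mat n n
polar H = H ⊞ H ᵀ

quad-polar : ∀ {n} (H : Mat n n) x → dot x (polar H ⊛ x) ≡ + 2 ℤ.* quad H x
quad-polar H x = begin
  dot x ((H ⊞ H ᵀ) ⊛ x) ≡⟨ cong (dot x) (⊞-⊛ H (H ᵀ) x) ⟩
  dot x (H ⊛ x ⊕ (H ᵀ) ⊛ x) ≡⟨ dot-⊕ʳ x (H ⊛ x) ((H ᵀ) ⊛ x) ⟩
  quad H x ℤ.+ dot x ((H ᵀ) ⊛ x) ≡⟨ cong (λ t → quad H x ℤ.+ t) (dot-ᵀ H x x) ⟨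
  quad H x ℤ.+ dot (H ⊛ x) x ≡⟨ cong (λ t → quad H x ℤ.+ t) (dot-comm (H ⊛ x) x) ⟩
  quad H x ℤ.+ quad H x ≡⟨ lem (quad H x) ⟩
  + 2 ℤ.* quad H x ∎
  where
  open ≡-Reasoning
  lem : ∀ t → t ℤ.+ t ≡ + 2 ℤ.* t
  lem = solve-∀

quad-scale : ∀ {n} (H : Mat n n) k x → quad H (k ⊙ x) ≡ k ℤ.* k ℤ.* quad H x
quad-scale H k x = trans (cong (dot (k ⊙ x)) (⊛-⊙ H k x))
  (trans (dot-⊙ˡ k x _) (trans (cong (k ℤ.*_) (dot-⊙ʳ k x _)) (sym (ℤₚ.*-assoc k k _))))

-- For concrete matrices the hypothesis is a closed identity, settled by evaluation. It compares the
-- doubled forms, and the factor 2 is cancelled.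
quad-similar : ∀ {m n} (M : Mat m n) (H : Mat m m) (K : Mat n n) c →
  M ᵀ ⊠ (polar H ⊠ M) ≡ scalar n c ⊠ polar K → ∀ x → quad H (M ⊛ x) ≡ c ℤ.* quad K x
quad-similar M H K c e x = ℤₚ.*-cancelˡ-≡ (+ 2) _ _ (begin
  + 2 ℤ.* quad H (M ⊛ x) ≡⟨ quad-polar H (M ⊛ x) ⟨
  dot (M ⊛ x) (polar H ⊛ M ⊛ x) ≡⟨ dot-ᵀ M x _ ⟩
  dot x ((M ᵀ) ⊛ polar H ⊛ M ⊛ x) ≡⟨ cong (λ t → dot x ((M ᵀ) ⊛ t)) (⊠-⊛ (polar H) M x) ⟨
  dot x ((M ᵀ) ⊛ (polar H ⊠ M) ⊛ x) ≡⟨ cong (dot x) (⊠-⊛ (M ᵀ) (polar H ⊠ M) x) ⟨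
  dot x ((M ᵀ ⊠ (polar H ⊠ M)) ⊛ x) ≡⟨ cong (λ t → dot x (t ⊛ x)) e ⟩
  dot x ((scalar _ c ⊠ polar K) ⊛ x) ≡⟨ cong (dot x) (⊠-⊛ (scalar _ c) (polar K) x) ⟩
  dot x (scalar _ c ⊛ polar K ⊛ x) ≡⟨ cong (dot x) (scalar-⊛ c (polar K ⊛ x)) ⟩
  dot x (c ⊙ polar K ⊛ x) ≡⟨ dot-⊙ʳ c x _ ⟩
  c ℤ.* dot x (polar K ⊛ x) ≡⟨ cong (c ℤ.*_) (quad-polar K x) ⟩
  c ℤ.* (+ 2 ℤ.* quad K x) ≡⟨ lem c (quad K x) ⟩
  + 2 ℤ.* (c ℤ.* quad K x) ∎)
  where
  open ≡-Reasoning
  lem : ∀ c t → c ℤ.* (+ 2 ℤ.* t) ≡ + 2 ℤ.* (c ℤ.* t)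
  lem = solve-∀

-- Residues modulo p and exhaustive checks over residue classes.

module _ (p : ℕ) .{{_ : ℕ.NonZero p}} where

  %ℕ-unique-≤ : ∀ {r s} k → r < p → s ≤ r → + r ≡ + s ℤ.+ k ℤ.* + p → r ≡ s
  %ℕ-unique-≤ {r} {s} k r<p s≤r e = ℕₚ.≤-antisym (ℕₚ.m∸n≡0⇒m≤n (none (r ∸ s) refl)) s≤r
    where
    lem : ∀ s t → s ℤ.+ t ℤ.- s ≡ t
    lem = solve-∀
    diff : + (r ∸ s) ≡ k ℤ.* + p
    diff = trans (sym (trans (ℤₚ.m-n≡m⊖n r s) (ℤₚ.⊖-≥ s≤r)))
      (trans (cong (ℤ._- + s) e) (lem (+ s) (k ℤ.* + p)))
    none : ∀ t → r ∸ s ≡ t → t ≡ 0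
    none zero    _ = refl
    none (suc t) d = contradiction
      (ℕ∣.divides ℤ.∣ k ∣ (trans (sym d) (trans (cong ℤ.∣_∣ diff) (ℤₚ.abs-* k (+ p)))))
      (ℕ∣.>⇒∤ (subst (ℕ._< p) d (ℕₚ.≤-<-trans (ℕₚ.m∸n≤m r s) r<p)))

  %ℕ-unique : ∀ {r s} k → r < p → s < p → + r ≡ + s ℤ.+ k ℤ.* + p → r ≡ s
  %ℕ-unique {r} {s} k r<p s<p e with ℕₚ.≤-total s r
  ... | inj₁ s≤r = %ℕ-unique-≤ k r<p s≤r e
  ... | inj₂ r≤s = sym (%ℕ-unique-≤ (ℤ.- k) s<p r≤s
    (trans (lem (+ s) k (+ p)) (cong (ℤ._+ (ℤ.- k) ℤ.* + p) (sym e))))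
    where
    lem : ∀ s k p → s ≡ s ℤ.+ k ℤ.* p ℤ.+ (ℤ.- k) ℤ.* p
    lem = solve-∀

  %ℕ-cong : ∀ a b k → a ≡ b ℤ.+ + p ℤ.* k → a %ℕ p ≡ b %ℕ p
  %ℕ-cong a b k e = %ℕ-unique (k ℤ.+ b /ℕ p ℤ.- a /ℕ p) (n%ℕd<d a p) (n%ℕd<d b p)
    (lem (+ (a %ℕ p)) (+ (b %ℕ p)) (a /ℕ p) (b /ℕ p) k (+ p)
      (trans (sym (a≡a%ℕn+[a/ℕn]*n a p)) (trans e (cong (λ t → t ℤ.+ + p ℤ.* k) (a≡a%ℕn+[a/ℕn]*n b p)))))
    where
    lem : ∀ r s i j k p → r ℤ.+ i ℤ.* p ≡ s ℤ.+ j ℤ.* p ℤ.+ p ℤ.* k → r ≡ s ℤ.+ (k ℤ.+ j ℤ.- i) ℤ.* p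
    lem r s i j k p e = trans (l1 r i p) (trans (cong (ℤ._- i ℤ.* p) e) (l2 s i j k p))
      where
      l1 : ∀ r i p → r ≡ r ℤ.+ i ℤ.* p ℤ.- i ℤ.* p
      l1 = solve-∀
      l2 : ∀ s i j k p → s ℤ.+ j ℤ.* p ℤ.+ p ℤ.* k ℤ.- i ℤ.* p ≡ s ℤ.+ (k ℤ.+ j ℤ.- i) ℤ.* p
      l2 = solve-∀

  red : ∀ {n} → ℤ^ n → ℤ^ n
  red = map (λ t → + (t %ℕ p))

  quo : ∀ {n} → ℤ^ n → ℤ^ n
  quo = map (λ t → t /ℕ p)

  red-quo : ∀ {n} (x : ℤ^ n) → x ≡ red x ⊕ + p ⊙ quo x
  red-quo []      = refl
  red-quo (a ∷ x) = cong₂ _∷_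
    (trans (a≡a%ℕn+[a/ℕn]*n a p) (cong (λ t → + (a %ℕ p) ℤ.+ t) (ℤₚ.*-comm (a /ℕ p) (+ p)))) (red-quo x)

  dot-red : ∀ {n} (r x : ℤ^ n) → dot r x %ℕ p ≡ dot r (red x) %ℕ p
  dot-red r x = %ℕ-cong _ (dot r (red x)) (dot r (quo x)) (trans (cong (dot r) (red-quo x))
    (trans (dot-⊕ʳ r (red x) _) (cong (λ t → dot r (red x) ℤ.+ t) (dot-⊙ʳ (+ p) r (quo x)))))

  dot-redˡ : ∀ {n} (r x : ℤ^ n) → dot r x %ℕ p ≡ dot (red r) x %ℕ p
  dot-redˡ r x = trans (cong (_%ℕ p) (dot-comm r x))
    (trans (dot-red x r) (cong (_%ℕ p) (dot-comm x (red r))))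

  ⊛-red : ∀ {m n} (M : Mat m n) x → red (M ⊛ x) ≡ red (M ⊛ red x)
  ⊛-red []      x = refl
  ⊛-red (r ∷ M) x = cong₂ _∷_ (cong +_ (dot-red r x)) (⊛-red M x)

  ⊛-redˡ : ∀ {m n} (M : Mat m n) x → red (M ⊛ x) ≡ red (map red M ⊛ x)
  ⊛-redˡ []      x = refl
  ⊛-redˡ (r ∷ M) x = cong₂ _∷_ (cong +_ (dot-redˡ r x)) (⊛-redˡ M x)

  ⊛-≡ₚ : ∀ {m n} (M N : Mat m n) → map red M ≡ map red N → ∀ x → red (M ⊛ x) ≡ red (N ⊛ x)
  ⊛-≡ₚ M N e x = trans (⊛-redˡ M x) (trans (cong (λ K → red (K ⊛ x)) e) (sym (⊛-redˡ N x)))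

  quad-red : ∀ {n} (H : Mat n n) x → quad H x %ℕ p ≡ quad H (red x) %ℕ p
  quad-red H x = trans (dot-redˡ x (H ⊛ x)) (trans (cong (_%ℕ p) flip)
      (trans (dot-red ((H ᵀ) ⊛ red x) x) (cong (_%ℕ p) (sym flip′))))
    where
    flip : dot (red x) (H ⊛ x) ≡ dot ((H ᵀ) ⊛ red x) x
    flip = trans (dot-comm (red x) _) (trans (dot-ᵀ H x (red x)) (dot-comm x _))
    flip′ : dot (red x) (H ⊛ red x) ≡ dot ((H ᵀ) ⊛ red x) (red x)
    flip′ = trans (dot-comm (red x) _) (trans (dot-ᵀ H (red x) (red x)) (dot-comm (red x) _))

  red-⊙ : ∀ {n} (x : ℤ^ n) → red (+ p ⊙ x) ≡ replicate n (+ 0)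
  red-⊙ []      = refl
  red-⊙ (a ∷ x) = cong₂ _∷_ (cong +_ (trans
    (%ℕ-cong (+ p ℤ.* a) (+ 0) a (sym (ℤₚ.+-identityˡ _))) zero%)) (red-⊙ x)
    where
    zero% : + 0 %ℕ p ≡ 0
    zero% = %ℕ-unique (ℤ.- (+ 0 /ℕ p)) (n%ℕd<d (+ 0) p) (ℕ.>-nonZero⁻¹ p)
      (lem (+ (+ 0 %ℕ p)) (+ 0 /ℕ p) (+ p) (sym (a≡a%ℕn+[a/ℕn]*n (+ 0) p)))
      where
      lem : ∀ a b p → a ℤ.+ b ℤ.* p ≡ + 0 → a ≡ + 0 ℤ.+ (ℤ.- b) ℤ.* p
      lem a b p e = trans (l1 a b p) (cong (ℤ._+ (ℤ.- b) ℤ.* p) e)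
        where
        l1 : ∀ a b p → a ≡ a ℤ.+ b ℤ.* p ℤ.+ (ℤ.- b) ℤ.* p
        l1 = solve-∀

  red-zero : ∀ {n} (x : ℤ^ n) → red x ≡ replicate n (+ 0) → x ≡ + p ⊙ quo x
  red-zero x e = trans (red-quo x) (trans (cong (_⊕ + p ⊙ quo x) e) (zero-⊕ (+ p ⊙ quo x)))
    where
    zero-⊕ : ∀ {n} (y : ℤ^ n) → replicate n (+ 0) ⊕ y ≡ y
    zero-⊕ []      = refl
    zero-⊕ (a ∷ y) = cong₂ _∷_ (ℤₚ.+-identityˡ a) (zero-⊕ y)

allBelow : ℕ → (ℕ → Bool) → Bool
allBelow zero    P = true
allBelow (suc n) P = P n ∧ allBelow n P

allCube : ℕ → (n : ℕ) → (ℤ^ n → Bool) → Bool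
allCube p zero    P = P []
allCube p (suc n) P = allBelow p (λ i → allCube p n (λ v → P (+ i ∷ v)))

allBelow-sound : ∀ {n P} → T (allBelow n P) → ∀ i → i < n → T (P i)
allBelow-sound {suc n} {P} t i i<n with i ℕ.≟ n
... | yes refl = proj₁ (Equivalence.to (T-∧ {P n}) t)
... | no  i≢n  = allBelow-sound (proj₂ (Equivalence.to (T-∧ {P n}) t)) i (ℕₚ.≤∧≢⇒< (ℕ.s≤s⁻¹ i<n) i≢n)

-- A record, since unfolding allCube for a symbolic P produces enormous terms.
record Verified (p n : ℕ) (P : ℤ^ n → Bool) : Set where
  constructor verified
  field holds : T (allCube p n P)

allCube-sound : ∀ p .{{_ : ℕ.NonZero p}} {n} {P : ℤ^ n → Bool} → T (allCube p n P) → ∀ x → T (P (red p x))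
allCube-sound p t []      = t
allCube-sound p t (a ∷ x) = allCube-sound p (allBelow-sound {p} t (a %ℕ p) (n%ℕd<d a p)) x

verify : ∀ p .{{_ : ℕ.NonZero p}} {n} {P : ℤ^ n → Bool} → Verified p n P → ∀ x → T (P (red p x))
verify p v = allCube-sound p (Verified.holds v)

-- Weighted sums over finite lists and changes of variables.

private variable A B : Set

total : (A → ℕ) → List A → ℕ
total w xs = sum (List.map w xs)

total-cong : ∀ (xs : List A) {v w : A → ℕ} → (∀ x → x ∈ xs → v x ≡ w x) → total v xs ≡ total w xs
total-cong []       e = refl
total-cong (x ∷ xs) e = cong₂ ℕ._+_ (e x (here refl)) (total-cong xs (λ y i → e y (there i)))

total-mono : ∀ (xs : List A) {v w : A → ℕ} → (∀ x → x ∈ xs → v x ≤ w x) → total v xs ≤ total w xs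
total-mono []       e = ℕ.z≤n
total-mono (x ∷ xs) e = ℕₚ.+-mono-≤ (e x (here refl)) (total-mono xs (λ y i → e y (there i)))

total-+ : ∀ (v w : A → ℕ) xs → total (λ x → v x + w x) xs ≡ total v xs + total w xs
total-+ v w []       = refl
total-+ v w (x ∷ xs) rewrite total-+ v w xs = +-interchange (v x) (w x) _ _

total-* : ∀ k (w : A → ℕ) xs → total (λ x → k * w x) xs ≡ k * total w xs
total-* k w []       = sym (ℕₚ.*-zeroʳ k)
total-* k w (x ∷ xs) rewrite total-* k w xs = sym (ℕₚ.*-distribˡ-+ k (w x) _)

total-zero : ∀ (xs : List A) {w : A → ℕ} → (∀ x → x ∈ xs → w x ≡ 0) → total w xs ≡ 0
total-zero []       e = refl
total-zero (x ∷ xs) e = cong₂ ℕ._+_ (e x (here refl)) (total-zero xs (λ y i → e y (there i)))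

total-const : ∀ (xs : List A) {w : A → ℕ} → (∀ x → x ∈ xs → w x ≡ 1) → total w xs ≡ List.length xs
total-const []       e = refl
total-const (x ∷ xs) e = cong₂ ℕ._+_ (e x (here refl)) (total-const xs (λ y i → e y (there i)))

total-↭ : ∀ (w : A → ℕ) {xs ys} → xs ↭ ys → total w xs ≡ total w ys
total-↭ w p = sum-↭ (↭ₚ.map⁺ w p)

-- Induction on the smaller list: its head is moved to the front of the larger list and removed from
-- both. Once the smaller list is empty, all remaining weights vanish.
total-support : ∀ (w : A → ℕ) {zs ys : List A} → Unique zs → Unique ys →
  (∀ {z} → z ∈ zs → z ∈ ys) → (∀ {y} → y ∈ ys → w y ≢ 0 → y ∈ zs) → total w ys ≡ total w zs
total-support w {[]} {ys} _ _ _ supp = total-zero ys vanish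
  where
  vanish : ∀ y → y ∈ ys → w y ≡ 0
  vanish y y∈ with w y ℕ.≟ 0
  ... | yes e = e
  ... | no ne with () ← supp y∈ ne
total-support w {z ∷ zs} {ys} (z∉ ∷ uz) uy sub supp with ∈-∃++ (sub (here refl))
... | as , bs , refl = trans (total-↭ w perm) (cong (w z ℕ.+_) (total-support w uz uy′ sub′ supp′))
  where
  perm : as ++ z ∷ bs ↭ z ∷ as ++ bs
  perm = ↭ₚ.shift z as bs
  uy-perm : Unique (z ∷ as ++ bs)
  uy-perm = ↭ₛₚ.Unique-resp-↭ (setoid _) (↭⇒↭ₛ perm) uy
  uy′ : Unique (as ++ bs)
  uy′ with uy-perm
  ... | _ ∷ u = u
  z∉ys : z ∉ as ++ bs
  z∉ys = Uniqueₚ.Unique[x∷xs]⇒x∉xs uy-perm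
  sub′ : ∀ {x} → x ∈ zs → x ∈ as ++ bs
  sub′ x∈ with ↭ₚ.∈-resp-↭ perm (sub (there x∈))
  ... | here refl = contradiction x∈ (Uniqueₚ.Unique[x∷xs]⇒x∉xs (z∉ ∷ uz))
  ... | there i   = i
  supp′ : ∀ {y} → y ∈ as ++ bs → w y ≢ 0 → y ∈ zs
  supp′ y∈ ne with supp (↭ₚ.∈-resp-↭ (↭-sym perm) (there y∈)) ne
  ... | here refl = contradiction y∈ z∉ys
  ... | there i   = i

Unique-map : ∀ (f : A → B) {xs} → (∀ {x y} → x ∈ xs → y ∈ xs → f x ≡ f y → x ≡ y) → Unique xs → Unique (List.map f xs)
Unique-map f {[]}     inj []        = []
Unique-map f {x ∷ xs} inj (x∉ ∷ u) =
  All.tabulate (λ {b} b∈ e → let y , y∈ , b≡ = ∈-map⁻ f b∈ in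
    All.lookup x∉ y∈ (inj (here refl) (there y∈) (trans e b≡)))
  ∷ Unique-map f (λ i j → inj (there i) (there j)) u

-- Surjectivity is required only where the weight is nonzero, so `w` may carry the indicator of the
-- image of `f`.
total-bij : ∀ (f : A → B) {xs ys} {v : A → ℕ} {w : B → ℕ} → Unique xs → Unique ys →
  (∀ {x y} → x ∈ xs → y ∈ xs → f x ≡ f y → x ≡ y) →
  (∀ {x} → x ∈ xs → f x ∈ ys) →
  (∀ {x} → x ∈ xs → w (f x) ≡ v x) →
  (∀ {y} → y ∈ ys → w y ≢ 0 → ∃ λ x → x ∈ xs × y ≡ f x) →
  total w ys ≡ total v xs
total-bij f {xs} {ys} {v} {w} ux uy inj into weight onto = begin
  total w ys ≡⟨ total-support w (Unique-map f inj ux) uy back forth ⟩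
  total w (List.map f xs) ≡⟨ cong sum (Listₚ.map-∘ xs) ⟨
  total (w ∘ f) xs ≡⟨ total-cong xs (λ x i → weight i) ⟩
  total v xs ∎
  where
  open ≡-Reasoning
  back : ∀ {z} → z ∈ List.map f xs → z ∈ ys
  back z∈ with ∈-map⁻ f z∈
  ... | x , x∈ , refl = into x∈
  forth : ∀ {y} → y ∈ ys → w y ≢ 0 → y ∈ List.map f xs
  forth y∈ ne with onto y∈ ne
  ... | x , x∈ , refl = ∈-map⁺ f x∈

ind : Bool → ℕ
ind true  = 1
ind false = 0

ind-true : ∀ b → T b → ind b ≡ 1
ind-true true _ = refl

ind-false : ∀ b → ¬ T b → ind b ≡ 0
ind-false true  f = contradiction _ f
ind-false false f = refl

ind≢0⇒T : ∀ b → ind b ≢ 0 → T b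
ind≢0⇒T true  _ = _
ind≢0⇒T false f = contradiction refl f

-- Divisibility, lattices with finite shells, and their embeddings.

multiple : ∀ p .{{_ : ℕ.NonZero p}} {n} → ℤ^ n → Bool
multiple p []      = true
multiple p (a ∷ x) = (a %ℕ p ≡ᵇ 0) ∧ multiple p x

module _ (p : ℕ) .{{_ : ℕ.NonZero p}} where

  multiple⇒red≡0 : ∀ {n} (x : ℤ^ n) → T (multiple p x) → red p x ≡ replicate n (+ 0)
  multiple⇒red≡0 []      t = refl
  multiple⇒red≡0 (a ∷ x) t with Equivalence.to (T-∧ {a %ℕ p ≡ᵇ 0}) t
  ... | t₁ , t₂ = cong₂ _∷_ (cong +_ (ℕₚ.≡ᵇ⇒≡ _ 0 t₁)) (multiple⇒red≡0 x t₂)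

  multiple⇒ : ∀ {n} (x : ℤ^ n) → T (multiple p x) → x ≡ + p ⊙ quo p x
  multiple⇒ x t = red-zero p x (multiple⇒red≡0 x t)

  red≡0⇒multiple : ∀ {n} (x : ℤ^ n) → red p x ≡ replicate n (+ 0) → T (multiple p x)
  red≡0⇒multiple []      e = _
  red≡0⇒multiple (a ∷ x) e = Equivalence.from (T-∧ {a %ℕ p ≡ᵇ 0})
    (ℕₚ.≡⇒≡ᵇ _ 0 (ℤₚ.+-injective (cong head e)) , red≡0⇒multiple x (cong tail e))

  ⇒multiple : ∀ {n} (x : ℤ^ n) → T (multiple p (+ p ⊙ x))
  ⇒multiple x = red≡0⇒multiple (+ p ⊙ x) (red-⊙ p x)

  multiple-cong : ∀ {n} (x y : ℤ^ n) → red p x ≡ red p y → multiple p x ≡ multiple p y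
  multiple-cong []      []      e = refl
  multiple-cong (a ∷ x) (b ∷ y) e = cong₂ _∧_
    (cong (_≡ᵇ 0) (ℤₚ.+-injective (cong head e))) (multiple-cong x y (cong tail e))

-- The shells are part of the data, so that finiteness needs a bound only for 𝒪³; sublattices obtain
-- their shells by filtering and pulling back.
record Lattice : Set where
  field
    form         : Mat 6 6
    shell        : ℕ → List (ℤ^ 6)
    shell-unique : ∀ m → Unique (shell m)
    ∈-shell⁻     : ∀ {m x} → x ∈ shell m → quad form x ≡ + m
    ∈-shell⁺     : ∀ {m x} → quad form x ≡ + m → x ∈ shell m

open Lattice public using (form; shell)

Σ[_⊢_] : Lattice → ℕ → (ℤ^ 6 → ℕ) → ℕ
Σ[ E ⊢ m ] w = total w (shell E m)

-- M embeds (ℤ⁶, K) into (ℤ⁶, H), multiplying the form by scale; since N M = M N = index,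
-- the image consists of the x with N ⊛ x divisible by index.
record Embedding (K H : Mat 6 6) : Set where
  field
    M N         : Mat 6 6
    index scale : ℕ
    .{{index≢0}} : ℕ.NonZero index
    .{{scale≢0}} : ℕ.NonZero scale
    N-M         : ∀ y → N ⊛ M ⊛ y ≡ + index ⊙ y
    M-N         : ∀ x → M ⊛ N ⊛ x ≡ + index ⊙ x
    quad-M      : ∀ y → quad H (M ⊛ y) ≡ + scale ℤ.* quad K y

  instance
    +index≢0 : ℤ.NonZero (+ index)
    +index≢0 = ℤ.≢-nonZero (λ e → ℕ.≢-nonZero⁻¹ index (ℤₚ.+-injective e))
    +scale≢0 : ℤ.NonZero (+ scale)
    +scale≢0 = ℤ.≢-nonZero (λ e → ℕ.≢-nonZero⁻¹ scale (ℤₚ.+-injective e))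

  image : ℤ^ 6 → Bool
  image x = multiple index (N ⊛ x)

  M-injective : ∀ {x y} → M ⊛ x ≡ M ⊛ y → x ≡ y
  M-injective {x} {y} e = ⊙-cancel (+ index) x y (trans (sym (N-M x)) (trans (cong (N ⊛_) e) (N-M y)))

  image-M : ∀ y → T (image (M ⊛ y))
  image-M y = subst (T ∘ multiple index) (sym (N-M y)) (⇒multiple index y)

  preimage : ℤ^ 6 → ℤ^ 6
  preimage x = quo index (N ⊛ x)

  M-preimage : ∀ x → T (image x) → M ⊛ preimage x ≡ x
  M-preimage x t = ⊙-cancel (+ index) _ x (begin
    + index ⊙ M ⊛ preimage x ≡⟨ ⊛-⊙ M (+ index) (preimage x) ⟨
    M ⊛ (+ index ⊙ preimage x) ≡⟨ cong (M ⊛_) (multiple⇒ index (N ⊛ x) t) ⟨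
    M ⊛ N ⊛ x ≡⟨ M-N x ⟩
    + index ⊙ x ∎)
    where open ≡-Reasoning

  preimage-M : ∀ y → preimage (M ⊛ y) ≡ y
  preimage-M y = M-injective (M-preimage (M ⊛ y) (image-M y))

  quad-M⁺ : ∀ {y m} → quad K y ≡ + m → quad H (M ⊛ y) ≡ + (scale * m)
  quad-M⁺ {y} e = trans (quad-M y) (trans (cong (+ scale ℤ.*_) e) (sym (ℤₚ.pos-* scale _)))

  quad-M⁻ : ∀ {y m} → quad H (M ⊛ y) ≡ + (scale * m) → quad K y ≡ + m
  quad-M⁻ {y} {m} e = ℤₚ.*-cancelˡ-≡ (+ scale) _ (+ m) (trans (sym (quad-M y)) (trans e (ℤₚ.pos-* scale m)))

⊠-scalar : ∀ {n} (N M : Mat n n) d → N ⊠ M ≡ scalar n d → ∀ y → N ⊛ M ⊛ y ≡ d ⊙ y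
⊠-scalar N M d e y = trans (sym (⊠-⊛ N M y)) (trans (cong (_⊛ y) e) (scalar-⊛ d y))

matrixEmbedding : ∀ {K H} (M N : Mat 6 6) index scale .{{_ : ℕ.NonZero index}} .{{_ : ℕ.NonZero scale}} →
  N ⊠ M ≡ scalar 6 (+ index) → M ⊠ N ≡ scalar 6 (+ index) →
  M ᵀ ⊠ (polar H ⊠ M) ≡ scalar 6 (+ scale) ⊠ polar K → Embedding K H
matrixEmbedding {K} {H} M N i c NM MN sim = record
  { M = M ; N = N ; index = i ; scale = c
  ; N-M = ⊠-scalar N M (+ i) NM ; M-N = ⊠-scalar M N (+ i) MN ; quad-M = quad-similar M H K (+ c) sim }

module _ (E F : Lattice) (e : Embedding (form E) (form F)) where
  open Embedding e
  private
    module E = Lattice E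
    module F = Lattice F

  -- The common source of the counting identities between lattices: neighbours, isometries,
  -- multiplication by 2 and the kernel of the slope are all treated as embeddings.
  Σ-image : ∀ m (w : ℤ^ 6 → ℕ) → Σ[ F ⊢ scale * m ] (λ x → ind (image x) * w x) ≡ Σ[ E ⊢ m ] (λ y → w (M ⊛ y))
  Σ-image m w = total-bij (M ⊛_) {v = λ y → w (M ⊛ y)} {w = λ x → ind (image x) * w x} (E.shell-unique m) (F.shell-unique _) (λ _ _ → M-injective)
      (λ y∈ → F.∈-shell⁺ (quad-M⁺ (E.∈-shell⁻ y∈))) (λ {y} _ → weight y (image-M y)) onto
    where
    weight : ∀ y → T (image (M ⊛ y)) → ind (image (M ⊛ y)) * w (M ⊛ y) ≡ w (M ⊛ y)
    weight y t with true ← image (M ⊛ y) = ℕₚ.+-identityʳ _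
    onto : ∀ {x} → x ∈ F.shell (scale * m) → ind (image x) * w x ≢ 0 → ∃ λ y → y ∈ E.shell m × x ≡ M ⊛ y
    onto {x} x∈ ne with image x in eq
    ... | false = contradiction refl ne
    ... | true  = preimage x , E.∈-shell⁺ (quad-M⁻ (trans (cong (quad F.form) back) (F.∈-shell⁻ x∈))) , sym back
      where
      back : M ⊛ preimage x ≡ x
      back = M-preimage x (subst T (sym eq) _)

sublattice : ∀ (F : Lattice) K → Embedding K (form F) → Lattice
sublattice F K e = record
  { form         = K
  ; shell        = λ m → List.map preimage (List.filter (λ x → T? (image x)) (F.shell (scale * m)))
  ; shell-unique = λ m → Unique-map preimage (λ x∈ y∈ eq → inj x∈ y∈ eq) (Uniqueₚ.filter⁺ _ (F.shell-unique _))
  ; ∈-shell⁻     = sound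
  ; ∈-shell⁺     = λ {m} {y} q → subst (_∈ _) (preimage-M y)
      (∈-map⁺ preimage (∈-filter⁺ _ (F.∈-shell⁺ (quad-M⁺ q)) (image-M y)))
  }
  where
  open Embedding e
  module F = Lattice F
  inj : ∀ {m x y} → x ∈ List.filter (λ x → T? (image x)) (F.shell m) →
    y ∈ List.filter (λ x → T? (image x)) (F.shell m) → preimage x ≡ preimage y → x ≡ y
  inj {m} {x} {y} x∈ y∈ eq = trans (sym (M-preimage x (tr x∈))) (trans (cong (M ⊛_) eq) (M-preimage y (tr y∈)))
    where
    tr : ∀ {x} → x ∈ List.filter (λ x → T? (image x)) (F.shell m) → T (image x)
    tr i = proj₂ (∈-filter⁻ (λ x → T? (image x)) {xs = F.shell m} i)
  sound : ∀ {m y} → y ∈ List.map preimage (List.filter (λ x → T? (image x)) (F.shell (scale * m))) → quad K y ≡ + m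
  sound {m} y∈ with ∈-map⁻ preimage y∈
  ... | x , x∈ , refl with ∈-filter⁻ (λ x → T? (image x)) {xs = F.shell (scale * m)} x∈
  ... | x∈F , t = quad-M⁻ (trans (cong (quad F.form) (M-preimage x t)) (F.∈-shell⁻ x∈F))

-- The ring 𝒪, the lattice 𝒪³ and the Klein lattice.

-- a , b stands for a + b α, where α = (1 + √-7)/2, so that α² = α - 2
𝒪 : Set
𝒪 = ℤ × ℤ

𝟘 𝟙 -𝟙 𝟚 -𝟚 α -α ᾱ -ᾱ √-7 : 𝒪
𝟘   = + 0 , + 0
𝟙   = + 1 , + 0
-𝟙  = -[1+ 0 ] , + 0
𝟚   = + 2 , + 0
-𝟚  = -[1+ 1 ] , + 0
α   = + 0 , + 1
-α  = + 0 , -[1+ 0 ]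
ᾱ   = + 1 , -[1+ 0 ]
-ᾱ  = -[1+ 0 ] , + 1
√-7 = -[1+ 0 ] , + 2

conj : 𝒪 → 𝒪
conj (a , b) = a ℤ.+ b , ℤ.- b

𝒪Mat : Set
𝒪Mat = Vec (Vec 𝒪 3) 3

-- Each entry becomes its multiplication matrix in the basis 1, α; the second column comes from α² =
-- α - 2.
mat : ∀ {m n} → Vec (Vec 𝒪 n) m → Mat (m * 2) (n * 2)
mat []      = []
mat (r ∷ M) = top r ∷ bot r ∷ mat M
  where
  top bot : ∀ {n} → Vec 𝒪 n → ℤ^ (n * 2)
  top []            = []
  top ((a , b) ∷ r) = a ∷ ℤ.- (+ 2 ℤ.* b) ∷ top r
  bot []            = []
  bot ((a , b) ∷ r) = b ∷ a ℤ.+ b ∷ bot r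

_ᴴ : 𝒪Mat → 𝒪Mat
((a ∷ b ∷ c ∷ []) ∷ (d ∷ e ∷ f ∷ []) ∷ (g ∷ h ∷ i ∷ []) ∷ []) ᴴ =
  (conj a ∷ conj d ∷ conj g ∷ []) ∷ (conj b ∷ conj e ∷ conj h ∷ []) ∷ (conj c ∷ conj f ∷ conj i ∷ []) ∷ []

diag : 𝒪 → 𝒪 → 𝒪 → 𝒪Mat
diag a b c = (a ∷ 𝟘 ∷ 𝟘 ∷ []) ∷ (𝟘 ∷ b ∷ 𝟘 ∷ []) ∷ (𝟘 ∷ 𝟘 ∷ c ∷ []) ∷ []

-- Σ |xᵢ|² with xᵢ = aᵢ + bᵢ α, that is Σ (aᵢ² + aᵢ bᵢ + 2 bᵢ²)
norm : Mat 6 6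
norm =
    (+ 1 ∷ + 1 ∷ + 0 ∷ + 0 ∷ + 0 ∷ + 0 ∷ [])
  ∷ (+ 0 ∷ + 2 ∷ + 0 ∷ + 0 ∷ + 0 ∷ + 0 ∷ [])
  ∷ (+ 0 ∷ + 0 ∷ + 1 ∷ + 1 ∷ + 0 ∷ + 0 ∷ [])
  ∷ (+ 0 ∷ + 0 ∷ + 0 ∷ + 2 ∷ + 0 ∷ + 0 ∷ [])
  ∷ (+ 0 ∷ + 0 ∷ + 0 ∷ + 0 ∷ + 1 ∷ + 1 ∷ [])
  ∷ (+ 0 ∷ + 0 ∷ + 0 ∷ + 0 ∷ + 0 ∷ + 2 ∷ []) ∷ []

interval : ℕ → List ℤ
interval B = List.map (λ i → + i ℤ.- + B) (List.upTo (suc (B + B)))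

box : ℕ → (n : ℕ) → List (ℤ^ n)
box B zero    = [] ∷ []
box B (suc n) = List.cartesianProductWith _∷_ (interval B) (box B n)

box-unique : ∀ B n → Unique (box B n)
box-unique B zero    = [] ∷ []
box-unique B (suc n) = Uniqueₚ.cartesianProductWith⁺ _∷_ (λ { refl → refl , refl })
  (Uniqueₚ.map⁺ (λ {i} {j} e → ℤₚ.+-injective (cancel (+ i) (+ j) (+ B) e)) (Uniqueₚ.upTo⁺ (suc (B + B)))) (box-unique B n)
  where
  cancel : ∀ i j k → i ℤ.- k ≡ j ℤ.- k → i ≡ j
  cancel i j k e = trans (sym (lem i k)) (trans (cong (ℤ._+ k) e) (lem j k))
    where
    lem : ∀ i k → i ℤ.- k ℤ.+ k ≡ i
    lem = solve-∀

∈-interval : ∀ B a → ℤ.∣ a ∣ ≤ B → a ∈ interval B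
∈-interval B (+ n) h = subst (_∈ interval B) (lem (+ n) (+ B))
  (∈-map⁺ (λ i → + i ℤ.- + B) (∈-upTo⁺ {suc (B + B)} {n + B} (ℕ.s≤s (ℕₚ.+-monoˡ-≤ B h))))
  where
  lem : ∀ x y → x ℤ.+ y ℤ.- y ≡ x
  lem = solve-∀
∈-interval B -[1+ n ] h = subst (_∈ interval B) eq
  (∈-map⁺ (λ i → + i ℤ.- + B) (∈-upTo⁺ {suc (B + B)} {B ∸ suc n}
    (ℕ.s≤s (ℕₚ.≤-trans (ℕₚ.m∸n≤m B (suc n)) (ℕₚ.m≤m+n B B)))))
  where
  lem : ∀ x y → x ℤ.- y ℤ.- x ≡ ℤ.- y
  lem = solve-∀
  eq : + (B ∸ suc n) ℤ.- + B ≡ -[1+ n ]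
  eq = trans (cong (ℤ._- + B) (trans (sym (ℤₚ.⊖-≥ h)) (sym (ℤₚ.m-n≡m⊖n B (suc n))))) (lem (+ B) (+ suc n))

∈-box : ∀ B {n} (x : ℤ^ n) → Vecᴬ.All (λ a → ℤ.∣ a ∣ ≤ B) x → x ∈ box B n
∈-box B []      []      = here refl
∈-box B (a ∷ x) (h ∷ t) = ∈-cartesianProductWith⁺ _∷_ (∈-interval B a h) (∈-box B x t)

sq : ℤ → ℕ
sq a = ℤ.∣ a ∣ * ℤ.∣ a ∣

+sq : ∀ a → + sq a ≡ a ℤ.* a
+sq (+ n)    = ℤₚ.pos-* n n
+sq -[1+ n ] = refl

∣a∣≤sq : ∀ a → ℤ.∣ a ∣ ≤ sq a
∣a∣≤sq a with ℤ.∣ a ∣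
... | zero  = ℕ.z≤n
... | suc n = ℕₚ.m≤m*n (suc n) (suc n)

sumsq : ∀ {n} → ℤ^ n → ℕ
sumsq []      = 0
sumsq (a ∷ x) = sq a + sumsq x

+sumsq : ∀ {n} (x : ℤ^ n) → + sumsq x ≡ dot x x
+sumsq []      = refl
+sumsq (a ∷ x) = trans (ℤₚ.pos-+ (sq a) (sumsq x)) (cong₂ ℤ._+_ (+sq a) (+sumsq x))

entries≤ : ∀ {n B} (x : ℤ^ n) → sumsq x ≤ B → Vecᴬ.All (λ a → ℤ.∣ a ∣ ≤ B) x
entries≤ []      h = []
entries≤ (a ∷ x) h = ℕₚ.≤-trans (∣a∣≤sq a) (ℕₚ.≤-trans (ℕₚ.m≤m+n (sq a) _) h)
  ∷ entries≤ x (ℕₚ.≤-trans (ℕₚ.m≤n+m (sumsq x) (sq a)) h)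

-- 2 Σ |xᵢ|² - Σ (aᵢ² + bᵢ²) = Σ ((aᵢ + bᵢ)² + 2 bᵢ²) is the sum of the squares of these forms.
remainder : Mat 9 6
remainder =
    (+ 1 ∷ + 1 ∷ + 0 ∷ + 0 ∷ + 0 ∷ + 0 ∷ [])
  ∷ (+ 0 ∷ + 0 ∷ + 1 ∷ + 1 ∷ + 0 ∷ + 0 ∷ [])
  ∷ (+ 0 ∷ + 0 ∷ + 0 ∷ + 0 ∷ + 1 ∷ + 1 ∷ [])
  ∷ b₁ ∷ b₁ ∷ b₂ ∷ b₂ ∷ b₃ ∷ b₃ ∷ []
  where
  b₁ b₂ b₃ : ℤ^ 6
  b₁ = + 0 ∷ + 1 ∷ + 0 ∷ + 0 ∷ + 0 ∷ + 0 ∷ []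
  b₂ = + 0 ∷ + 0 ∷ + 0 ∷ + 1 ∷ + 0 ∷ + 0 ∷ []
  b₃ = + 0 ∷ + 0 ∷ + 0 ∷ + 0 ∷ + 0 ∷ + 1 ∷ []

norm-bound : ∀ {m x} → quad norm x ≡ + m → x ∈ box (2 * m) 6
norm-bound {m} {x} q = ∈-box _ x (entries≤ x (ℕₚ.≤-trans (ℕₚ.m≤m+n (sumsq x) (sumsq (remainder ⊛ x))) (ℕₚ.≤-reflexive eq)))
  where
  open ≡-Reasoning
  split : polar norm ≡ scalar 6 (+ 1) ⊞ (remainder ᵀ ⊠ remainder)
  split = refl
  eq : sumsq x + sumsq (remainder ⊛ x) ≡ 2 * m
  eq = ℤₚ.+-injective (begin
    + (sumsq x + sumsq (remainder ⊛ x)) ≡⟨ ℤₚ.pos-+ (sumsq x) _ ⟩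
    + sumsq x ℤ.+ + sumsq (remainder ⊛ x) ≡⟨ cong₂ ℤ._+_ (+sumsq x) (+sumsq (remainder ⊛ x)) ⟩
    dot x x ℤ.+ dot (remainder ⊛ x) (remainder ⊛ x) ≡⟨ cong₂ ℤ._+_ one two ⟨
    dot x (scalar 6 (+ 1) ⊛ x) ℤ.+ dot x ((remainder ᵀ ⊠ remainder) ⊛ x) ≡⟨ dot-⊕ʳ x _ _ ⟨
    dot x (scalar 6 (+ 1) ⊛ x ⊕ (remainder ᵀ ⊠ remainder) ⊛ x) ≡⟨ cong (dot x) (⊞-⊛ (scalar 6 (+ 1)) (remainder ᵀ ⊠ remainder) x) ⟨
    dot x ((scalar 6 (+ 1) ⊞ (remainder ᵀ ⊠ remainder)) ⊛ x) ≡⟨ cong (λ G → dot x (G ⊛ x)) split ⟨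
    dot x (polar norm ⊛ x) ≡⟨ quad-polar norm x ⟩
    + 2 ℤ.* quad norm x ≡⟨ cong (λ t → + 2 ℤ.* t) q ⟩
    + 2 ℤ.* + m ≡⟨ ℤₚ.pos-* 2 m ⟨
    + (2 * m) ∎)
    where
    one : dot x (scalar 6 (+ 1) ⊛ x) ≡ dot x x
    one = trans (cong (dot x) (scalar-⊛ (+ 1) x)) (trans (dot-⊙ʳ (+ 1) x x) (ℤₚ.*-identityˡ _))
    two : dot x ((remainder ᵀ ⊠ remainder) ⊛ x) ≡ dot (remainder ⊛ x) (remainder ⊛ x)
    two = trans (cong (dot x) (⊠-⊛ (remainder ᵀ) remainder x)) (sym (dot-ᵀ remainder x (remainder ⊛ x)))

-- Opaque, so that the enumeration of the box is not unfolded.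
abstract
  norm-shell : ℕ → List (ℤ^ 6)
  norm-shell m = List.filter (λ x → quad norm x ℤ.≟ + m) (box (2 * m) 6)

  norm-shell-unique : ∀ m → Unique (norm-shell m)
  norm-shell-unique m = Uniqueₚ.filter⁺ (λ x → quad norm x ℤ.≟ + m) (box-unique (2 * m) 6)

  ∈-norm-shell⁻ : ∀ {m x} → x ∈ norm-shell m → quad norm x ≡ + m
  ∈-norm-shell⁻ {m} x∈ = proj₂ (∈-filter⁻ (λ x → quad norm x ℤ.≟ + m) {xs = box (2 * m) 6} x∈)

  ∈-norm-shell⁺ : ∀ {m x} → quad norm x ≡ + m → x ∈ norm-shell m
  ∈-norm-shell⁺ {m} q = ∈-filter⁺ (λ x → quad norm x ℤ.≟ + m) (norm-bound q) q

𝒪³ : Lattice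
𝒪³ = record
  { form         = norm
  ; shell        = norm-shell
  ; shell-unique = norm-shell-unique
  ; ∈-shell⁻     = ∈-norm-shell⁻
  ; ∈-shell⁺     = ∈-norm-shell⁺
  }

-- The Klein lattice: the x ∈ 𝒪³ with x₁ ≡ x₂ ≡ x₃ mod α and x₁ + x₂ + x₃ ≡ 0 mod ᾱ, with the
-- form Σ |xᵢ|² / 2, in the 𝒪-basis given by the columns of basis.
basis cobasis : 𝒪Mat
basis   = (α ∷ 𝟘 ∷ 𝟙 ∷ []) ∷ (α ∷ α ∷ 𝟙 ∷ []) ∷ (𝟘 ∷ α ∷ ᾱ ∷ []) ∷ []
cobasis = (-α ∷ 𝟙 ∷ -𝟙 ∷ []) ∷ (-ᾱ ∷ ᾱ ∷ 𝟘 ∷ []) ∷ (α ∷ -α ∷ α ∷ []) ∷ []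

ι ι* : Mat 6 6
ι  = mat basis
ι* = mat cobasis

klein : Mat 6 6
klein =
    (+ 2 ∷ + 2 ∷ + 2 ∷ + 1 ∷ + 1 ∷ + 4 ∷ [])
  ∷ (+ 0 ∷ + 4 ∷ + 1 ∷ + 4 ∷ −3 ∷ + 2 ∷ [])
  ∷ (+ 0 ∷ + 0 ∷ + 2 ∷ + 2 ∷ −1 ∷ + 3 ∷ [])
  ∷ (+ 0 ∷ + 0 ∷ + 0 ∷ + 4 ∷ −4 ∷ −2 ∷ [])
  ∷ (+ 0 ∷ + 0 ∷ + 0 ∷ + 0 ∷ + 2 ∷ + 2 ∷ [])
  ∷ (+ 0 ∷ + 0 ∷ + 0 ∷ + 0 ∷ + 0 ∷ + 4 ∷ []) ∷ []

-- `ι*` is twice the inverse of `ι`, whence the index 2; the scale 2 undoes the halving of the form.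
inclusion : Embedding klein norm
inclusion = matrixEmbedding ι ι* 2 2 refl refl refl

ℒ : Lattice
ℒ = sublattice 𝒪³ klein inclusion

-- Primitivity at √-7 and the Hecke relations at 2.

halve : ∀ {m n} → Mat m n → Mat m n
halve = map (quo 2)

θ : Mat 6 6
θ = mat (diag √-7 √-7 √-7)

-- x ≢ 0 mod √-7
primitive7 : ℤ^ 6 → Bool
primitive7 x = not (multiple 7 (θ ⊛ x))

multiple-⊛ : ∀ p .{{_ : ℕ.NonZero p}} {m n} (M : Mat m n) x → T (multiple p x) → T (multiple p (M ⊛ x))
multiple-⊛ p M x t = subst (T ∘ multiple p) (sym (trans (cong (M ⊛_) (multiple⇒ p x t)) (⊛-⊙ M (+ p) (quo p x))))
  (⇒multiple p (M ⊛ quo p x))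

multiple-cancel : ∀ p .{{_ : ℕ.NonZero p}} {n} u d l → u ℤ.* d ≡ + 1 ℤ.+ + p ℤ.* l →
  ∀ (x : ℤ^ n) → T (multiple p (d ⊙ x)) → T (multiple p x)
multiple-cancel p u d l e x t = subst (T ∘ multiple p) (sym (go x (quo p (d ⊙ x)) (multiple⇒ p (d ⊙ x) t)))
  (⇒multiple p (u ⊙ quo p (d ⊙ x) ⊕ (ℤ.- l) ⊙ x))
  where
  lem : ∀ u d l p a b → u ℤ.* d ≡ + 1 ℤ.+ p ℤ.* l → d ℤ.* a ≡ p ℤ.* b → a ≡ p ℤ.* (u ℤ.* b ℤ.+ (ℤ.- l) ℤ.* a)
  lem u d l p a b e h = begin
    a ≡⟨ l₁ p l a ⟩
    (+ 1 ℤ.+ p ℤ.* l) ℤ.* a ℤ.+ p ℤ.* ((ℤ.- l) ℤ.* a) ≡⟨ cong (λ t → t ℤ.* a ℤ.+ p ℤ.* ((ℤ.- l) ℤ.* a)) e ⟨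
    u ℤ.* d ℤ.* a ℤ.+ p ℤ.* ((ℤ.- l) ℤ.* a) ≡⟨ cong (ℤ._+ p ℤ.* ((ℤ.- l) ℤ.* a)) (trans (ℤₚ.*-assoc u d a) (cong (u ℤ.*_) h)) ⟩
    u ℤ.* (p ℤ.* b) ℤ.+ p ℤ.* ((ℤ.- l) ℤ.* a) ≡⟨ l₂ u p b l a ⟩
    p ℤ.* (u ℤ.* b ℤ.+ (ℤ.- l) ℤ.* a) ∎
    where
    open ≡-Reasoning
    l₁ : ∀ p l a → a ≡ (+ 1 ℤ.+ p ℤ.* l) ℤ.* a ℤ.+ p ℤ.* ((ℤ.- l) ℤ.* a)
    l₁ = solve-∀
    l₂ : ∀ u p b l a → u ℤ.* (p ℤ.* b) ℤ.+ p ℤ.* ((ℤ.- l) ℤ.* a) ≡ p ℤ.* (u ℤ.* b ℤ.+ (ℤ.- l) ℤ.* a)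
    l₂ = solve-∀
  go : ∀ {n} (x w : ℤ^ n) → d ⊙ x ≡ + p ⊙ w → x ≡ + p ⊙ (u ⊙ w ⊕ (ℤ.- l) ⊙ x)
  go []      []      h = refl
  go (a ∷ x) (b ∷ w) h = cong₂ _∷_ (lem u d l (+ p) a b e (cong head h)) (go x w (cong tail h))

T-ext : ∀ {a b} → (T a → T b) → (T b → T a) → a ≡ b
T-ext {true}  {true}  f g = refl
T-ext {true}  {false} f g with () ← f _
T-ext {false} {true}  f g with () ← g _
T-ext {false} {false} f g = refl

-- `M` and `N` commute with √-7, and `N` inverts `M` up to `d`, which `u` inverts modulo 7. Hence
-- divisibility by 7 passes between √-7 y and √-7 M y in both directions.
primitive7-⊛ : ∀ (M N : Mat 6 6) u d l → u ℤ.* d ≡ + 1 ℤ.+ + 7 ℤ.* l → N ⊠ M ≡ scalar 6 d →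
  θ ⊠ M ≡ M ⊠ θ → θ ⊠ N ≡ N ⊠ θ → ∀ y → primitive7 (M ⊛ y) ≡ primitive7 y
primitive7-⊛ M N u d l e NM θM θN y = cong not (T-ext back forth)
  where
  comm : ∀ (K : Mat 6 6) → θ ⊠ K ≡ K ⊠ θ → ∀ x → θ ⊛ K ⊛ x ≡ K ⊛ θ ⊛ x
  comm K c x = trans (sym (⊠-⊛ θ K x)) (trans (cong (_⊛ x) c) (⊠-⊛ K θ x))
  back : T (multiple 7 (θ ⊛ M ⊛ y)) → T (multiple 7 (θ ⊛ y))
  back t = multiple-cancel 7 u d l e (θ ⊛ y) (subst (T ∘ multiple 7) eq (multiple-⊛ 7 N (θ ⊛ M ⊛ y) t))
    where
    eq : N ⊛ θ ⊛ M ⊛ y ≡ d ⊙ θ ⊛ y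
    eq = trans (cong (N ⊛_) (comm M θM y))
      (trans (sym (⊠-⊛ N M (θ ⊛ y))) (trans (cong (_⊛ θ ⊛ y) NM) (scalar-⊛ d (θ ⊛ y))))
  forth : T (multiple 7 (θ ⊛ y)) → T (multiple 7 (θ ⊛ M ⊛ y))
  forth t = subst (T ∘ multiple 7) (sym (comm M θM y)) (multiple-⊛ 7 M (θ ⊛ y) t)

-- an 𝒪-linear embedding multiplying norms by 2
record Similarity (K H : Mat 6 6) : Set where
  constructor similarity
  field
    M N     : Mat 6 6
    N⊠M     : N ⊠ M ≡ scalar 6 (+ 2)
    M⊠N     : M ⊠ N ≡ scalar 6 (+ 2)
    similar : M ᵀ ⊠ (polar H ⊠ M) ≡ scalar 6 (+ 2) ⊠ polar K
    θ⊠M     : θ ⊠ M ≡ M ⊠ θ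
    θ⊠N     : θ ⊠ N ≡ N ⊠ θ

  embedding : Embedding K H
  embedding = matrixEmbedding M N 2 2 N⊠M M⊠N similar


hit : Mat 6 6 → ℤ^ 6 → ℕ
hit N x = ind (multiple 2 (N ⊛ x))

prim : ℤ^ 6 → ℕ
prim x = ind (primitive7 x)

Σ-similarity : ∀ E F (s : Similarity (form E) (form F)) m →
  Σ[ F ⊢ 2 * m ] (λ x → hit (Similarity.N s) x * prim x) ≡ Σ[ E ⊢ m ] prim
Σ-similarity E F s m = trans (Σ-image E F embedding m prim)
  (total-cong (shell E m) (λ y _ → cong ind (primitive7-⊛ M N (+ 4) (+ 2) (+ 1) refl N⊠M θ⊠M θ⊠N y)))
  where open Similarity s

hits : List (Mat 6 6) → ℤ^ 6 → ℕ
hits Ns x = total (λ N → hit N x) Ns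

Σ-hits : ∀ E F (ss : List (Similarity (form E) (form F))) m →
  Σ[ F ⊢ 2 * m ] (λ x → hits (List.map Similarity.N ss) x * prim x) ≡ List.length ss * Σ[ E ⊢ m ] prim
Σ-hits E F []       m = total-zero (shell F (2 * m)) (λ _ _ → refl)
Σ-hits E F (s ∷ ss) m = begin
  Σ[ F ⊢ 2 * m ] (λ x → (hit (Similarity.N s) x + hits (List.map Similarity.N ss) x) * prim x)
    ≡⟨ total-cong (shell F _) (λ x _ → ℕₚ.*-distribʳ-+ (prim x) (hit (Similarity.N s) x) _) ⟩
  Σ[ F ⊢ 2 * m ] (λ x → hit (Similarity.N s) x * prim x + hits (List.map Similarity.N ss) x * prim x)
    ≡⟨ total-+ _ _ (shell F _) ⟩
  Σ[ F ⊢ 2 * m ] (λ x → hit (Similarity.N s) x * prim x) ℕ.+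
  Σ[ F ⊢ 2 * m ] (λ x → hits (List.map Similarity.N ss) x * prim x)
    ≡⟨ cong₂ ℕ._+_ (Σ-similarity E F s m) (Σ-hits E F ss m) ⟩
  suc (List.length ss) * Σ[ E ⊢ m ] prim ∎
  where open ≡-Reasoning

hit-red : ∀ N x → hit N (red 2 x) ≡ hit N x
hit-red N x = cong ind (multiple-cong 2 (N ⊛ red 2 x) (N ⊛ x) (sym (⊛-red 2 N x)))

hits-red : ∀ Ns x → hits Ns (red 2 x) ≡ hits Ns x
hits-red []       x = refl
hits-red (N ∷ Ns) x = cong₂ ℕ._+_ (hit-red N x) (hits-red Ns x)

one : Mat 6 6
one = scalar 6 (+ 1)

-- In 𝒪³, x modulo 2 amounts to u = x mod α and v = x mod ᾱ in 𝔽₂³, and the norm modulo 2 is the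
-- pairing of u and v. A line of 𝔽₂³ is hit when it contains u and its annihilator contains v. If
-- the pairing vanishes, the number of such lines is 1 for u ≠ 0, 3 for u = 0 ≠ v, and 7 for u = v =
-- 0. `hit N` detects u = 0 and `hit one` detects u = v = 0. For ℒ the roles of α and ᾱ are
-- exchanged.
neighbourCheck : Mat 6 6 → List (Mat 6 6) → Mat 6 6 → ℤ^ 6 → Bool
neighbourCheck H Ns N x =
  not (quad H x %ℕ 2 ≡ᵇ 0) ∨ (hits Ns x ≡ᵇ 1 + 2 * hit N x + 4 * hit one x)

even%2 : ∀ m → + (2 * m) %ℕ 2 ≡ 0
even%2 m = %ℕ-cong 2 (+ (2 * m)) (+ 0) (+ m) (trans (ℤₚ.pos-* 2 m) (sym (ℤₚ.+-identityˡ _)))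

neighbour : ∀ H Ns N → Verified 2 6 (neighbourCheck H Ns N) → ∀ {m} x → quad H x ≡ + (2 * m) →
  hits Ns x ≡ 1 + 2 * hit N x + 4 * hit one x
neighbour H Ns N t {m} x q = begin
  hits Ns x ≡⟨ hits-red Ns x ⟨
  hits Ns (red 2 x) ≡⟨ guarded _ (verify 2 t x) even ⟩
  1 + 2 * hit N (red 2 x) + 4 * hit one (red 2 x)
    ≡⟨ cong₂ (λ i j → 1 + 2 * i + 4 * j) (hit-red N x) (hit-red one x) ⟩
  1 + 2 * hit N x + 4 * hit one x ∎
  where
  open ≡-Reasoning
  guarded : ∀ a {b c} → T (not (a ≡ᵇ 0) ∨ (b ≡ᵇ c)) → a ≡ 0 → b ≡ c
  guarded _ t refl = ℕₚ.≡ᵇ⇒≡ _ _ t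
  even : quad H (red 2 x) %ℕ 2 ≡ 0
  even = trans (sym (quad-red 2 H x)) (trans (cong (_%ℕ 2) q) (even%2 m))

Σ-neighbour : ∀ F Ns N → Verified 2 6 (neighbourCheck (form F) Ns N) → ∀ m →
  Σ[ F ⊢ 2 * m ] (λ x → hits Ns x * prim x) ≡
  Σ[ F ⊢ 2 * m ] prim + 2 * Σ[ F ⊢ 2 * m ] (λ x → hit N x * prim x)
    + 4 * Σ[ F ⊢ 2 * m ] (λ x → hit one x * prim x)
Σ-neighbour F Ns N t m = begin
  Σ[ F ⊢ 2 * m ] (λ x → hits Ns x * prim x)
    ≡⟨ total-cong xs (λ x x∈ → trans (cong (ℕ._* prim x) (neighbour (form F) Ns N t {m} x (Lattice.∈-shell⁻ F x∈)))
         (lem (hit N x) (hit one x) (prim x))) ⟩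
  total (λ x → prim x + 2 * (hit N x * prim x) + 4 * (hit one x * prim x)) xs
    ≡⟨ total-+ _ _ xs ⟩
  total (λ x → prim x + 2 * (hit N x * prim x)) xs + total (λ x → 4 * (hit one x * prim x)) xs
    ≡⟨ cong₂ ℕ._+_ (trans (total-+ _ _ xs) (cong (total prim xs ℕ.+_) (total-* 2 _ xs))) (total-* 4 _ xs) ⟩
  total prim xs + 2 * total (λ x → hit N x * prim x) xs + 4 * total (λ x → hit one x * prim x) xs ∎
  where
  open ≡-Reasoning
  xs = shell F (2 * m)
  lem : ∀ a b p → (1 + 2 * a + 4 * b) * p ≡ p + 2 * (a * p) + 4 * (b * p)
  lem = solveℕ

double : ∀ K → Embedding K K
double K = record
  { M = scalar 6 (+ 2) ; N = one ; index = 2 ; scale = 4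
  ; N-M = ⊠-scalar one (scalar 6 (+ 2)) (+ 2) refl
  ; M-N = ⊠-scalar (scalar 6 (+ 2)) one (+ 2) refl
  ; quad-M = λ y → trans (cong (quad K) (scalar-⊛ (+ 2) y)) (quad-scale K (+ 2) y)
  }

-- The term at m/2 of the Hecke relations: the vectors of norm 2m in twice the lattice are the
-- doubles of those of norm m/2. This form makes sense for odd m as well.
halved : Lattice → ℕ → ℕ
halved F m = Σ[ F ⊢ 2 * m ] (λ x → hit one x * prim x)

module _ (F : Lattice) where

  halved-even : ∀ k → halved F (2 * k) ≡ Σ[ F ⊢ k ] prim
  halved-even k = begin
    Σ[ F ⊢ 2 * (2 * k) ] (λ x → hit one x * prim x) ≡⟨ cong (λ j → Σ[ F ⊢ j ] (λ x → hit one x * prim x)) (sym (ℕₚ.*-assoc 2 2 k)) ⟩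
    Σ[ F ⊢ 4 * k ] (λ x → hit one x * prim x) ≡⟨ Σ-image F F (double (form F)) k prim ⟩
    Σ[ F ⊢ k ] (λ y → prim (scalar 6 (+ 2) ⊛ y))
      ≡⟨ total-cong (shell F k) (λ y _ → cong ind (primitive7-⊛ (scalar 6 (+ 2)) one (+ 4) (+ 2) (+ 1) refl refl refl refl y)) ⟩
    Σ[ F ⊢ k ] prim ∎
    where open ≡-Reasoning

  halved-odd : ∀ k → halved F (1 + 2 * k) ≡ 0
  halved-odd k = total-zero (shell F _) vanish
    where
    open Embedding (double (form F)) using (image; M-preimage; quad-M; preimage)
    vanish : ∀ x → x ∈ shell F (2 * (1 + 2 * k)) → hit one x * prim x ≡ 0
    vanish x x∈ = cong (ℕ._* prim x) (ind-false (multiple 2 (one ⊛ x)) impossible)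
      where
      q = quad (form F) (preimage x)
      4q : T (image x) → + 2 ℤ.* (+ 2 ℤ.* q) ≡ + 2 ℤ.* + (1 + 2 * k)
      4q t = trans (lem q) (trans (sym (quad-M (preimage x))) (trans (cong (quad (form F)) (M-preimage x t))
        (trans (Lattice.∈-shell⁻ F x∈) (ℤₚ.pos-* 2 (1 + 2 * k)))))
        where
        lem : ∀ q → + 2 ℤ.* (+ 2 ℤ.* q) ≡ + 4 ℤ.* q
        lem = solve-∀
      even% : ∀ q → (+ 2 ℤ.* q) %ℕ 2 ≡ 0
      even% q = %ℕ-cong 2 (+ 2 ℤ.* q) (+ 0) q (sym (ℤₚ.+-identityˡ _))
      m% : + (1 + 2 * k) %ℕ 2 ≡ 1
      m% = %ℕ-cong 2 (+ (1 + 2 * k)) (+ 1) (+ k) (trans (ℤₚ.pos-+ 1 (2 * k)) (cong (λ t → + 1 ℤ.+ t) (ℤₚ.pos-* 2 k)))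
      impossible : ¬ T (image x)
      impossible t = contradiction (trans (sym (even% q)) (trans (cong (_%ℕ 2) (ℤₚ.*-cancelˡ-≡ (+ 2) (+ 2 ℤ.* q) (+ (1 + 2 * k)) (4q t))) m%)) λ ()

-- 𝒪³ and the Klein lattice are neighbours at α: the seven sublattices of 𝒪³ defined by a line mod α
-- and its annihilator mod ᾱ are, with the form halved, six copies of 𝒪³ and one Klein lattice; the
-- analogous seven sublattices of the Klein lattice are all copies of 𝒪³.
𝒪³→𝒪³ : List (Similarity norm norm)
𝒪³→𝒪³ =
    similarity (mat d₁) (mat (d₁ ᴴ)) refl refl refl refl refl
  ∷ similarity (mat d₂) (mat (d₂ ᴴ)) refl refl refl refl refl
  ∷ similarity (mat d₃) (mat (d₃ ᴴ)) refl refl refl refl refl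
  ∷ similarity (mat e₁) (mat (e₁ ᴴ)) refl refl refl refl refl
  ∷ similarity (mat e₂) (mat (e₂ ᴴ)) refl refl refl refl refl
  ∷ similarity (mat e₃) (mat (e₃ ᴴ)) refl refl refl refl refl ∷ []
  where
  d₁ d₂ d₃ e₁ e₂ e₃ : 𝒪Mat
  d₁ = diag ᾱ α α
  d₂ = diag α ᾱ α
  d₃ = diag α α ᾱ
  e₁ = (α ∷ 𝟘 ∷ 𝟘 ∷ []) ∷ (𝟘 ∷ 𝟙 ∷  𝟙 ∷ []) ∷ (𝟘 ∷ 𝟙 ∷ -𝟙 ∷ []) ∷ []
  e₂ = (𝟙 ∷ 𝟘 ∷ 𝟙 ∷ []) ∷ (𝟘 ∷ α ∷ 𝟘 ∷ []) ∷ (𝟙 ∷ 𝟘 ∷ -𝟙 ∷ []) ∷ []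
  e₃ = (𝟙 ∷ 𝟙 ∷ 𝟘 ∷ []) ∷ (𝟙 ∷ -𝟙 ∷ 𝟘 ∷ []) ∷ (𝟘 ∷ 𝟘 ∷ α ∷ []) ∷ []

ℒ→𝒪³ : Similarity klein norm
ℒ→𝒪³ = similarity ι ι* refl refl refl refl refl

𝒪³→ℒ : List (Similarity norm klein)
𝒪³→ℒ =
    similarity (to f₀) (from f₀) refl refl refl refl refl
  ∷ similarity (to f₁) (from f₁) refl refl refl refl refl
  ∷ similarity (to f₂) (from f₂) refl refl refl refl refl
  ∷ similarity (to f₃) (from f₃) refl refl refl refl refl
  ∷ similarity (to f₄) (from f₄) refl refl refl refl refl
  ∷ similarity (to f₅) (from f₅) refl refl refl refl refl
  ∷ similarity (to f₆) (from f₆) refl refl refl refl refl ∷ []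
  where
  to from : 𝒪Mat → Mat 6 6
  to F   = halve (ι* ⊠ mat F)
  from F = halve (mat (F ᴴ) ⊠ ι)
  f₀ f₁ f₂ f₃ f₄ f₅ f₆ : 𝒪Mat
  f₀ = diag 𝟚 𝟚 𝟚
  f₁ = (𝟘 ∷ ᾱ ∷ -ᾱ ∷ []) ∷ (α ∷ 𝟙 ∷ 𝟙 ∷ []) ∷ ( α ∷ -𝟙 ∷ -𝟙 ∷ []) ∷ []
  f₂ = (𝟘 ∷ ᾱ ∷ -ᾱ ∷ []) ∷ (α ∷ 𝟙 ∷ 𝟙 ∷ []) ∷ (-α ∷  𝟙 ∷  𝟙 ∷ []) ∷ []
  f₃ = (α ∷ 𝟙 ∷ 𝟙 ∷ []) ∷ (𝟘 ∷ ᾱ ∷ -ᾱ ∷ []) ∷ ( α ∷ -𝟙 ∷ -𝟙 ∷ []) ∷ []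
  f₄ = (α ∷ 𝟙 ∷ 𝟙 ∷ []) ∷ (𝟘 ∷ ᾱ ∷ -ᾱ ∷ []) ∷ (-α ∷  𝟙 ∷  𝟙 ∷ []) ∷ []
  f₅ = (α ∷ 𝟙 ∷ 𝟙 ∷ []) ∷ ( α ∷ -𝟙 ∷ -𝟙 ∷ []) ∷ (𝟘 ∷ ᾱ ∷ -ᾱ ∷ []) ∷ []
  f₆ = (α ∷ 𝟙 ∷ 𝟙 ∷ []) ∷ (-α ∷  𝟙 ∷  𝟙 ∷ []) ∷ (𝟘 ∷ ᾱ ∷ -ᾱ ∷ []) ∷ []

α· ᾱ· : Mat 6 6
α· = mat (diag α α α)
ᾱ· = mat (diag ᾱ ᾱ ᾱ)

αᴼ : Similarity norm norm
αᴼ = similarity α· ᾱ· refl refl refl refl refl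

αᴸ ᾱᴸ : Similarity klein klein
αᴸ = similarity α· ᾱ· refl refl refl refl refl
ᾱᴸ = similarity ᾱ· α· refl refl refl refl refl

𝐫 𝐍 : ℕ → ℕ
𝐫 m = Σ[ 𝒪³ ⊢ m ] prim
𝐍 m = Σ[ ℒ ⊢ m ] prim

-- Double counting of pairs of a primitive vector of norm 2m and a neighbour containing it: by
-- neighbours, six copies of 𝒪³ and one of ℒ, and by vectors.
hecke-𝒪³ : ∀ m → 6 * 𝐫 m + 𝐍 m ≡ 𝐫 (2 * m) + 2 * 𝐫 m + 4 * halved 𝒪³ m
hecke-𝒪³ m = begin
  6 * 𝐫 m + 𝐍 m
    ≡⟨ cong₂ ℕ._+_ (Σ-hits 𝒪³ 𝒪³ 𝒪³→𝒪³ m) (Σ-similarity ℒ 𝒪³ ℒ→𝒪³ m) ⟨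
  Σ[ 𝒪³ ⊢ 2 * m ] (λ x → hits Ns x * prim x) + Σ[ 𝒪³ ⊢ 2 * m ] (λ x → hit ι* x * prim x)
    ≡⟨ total-+ _ _ (shell 𝒪³ (2 * m)) ⟨
  Σ[ 𝒪³ ⊢ 2 * m ] (λ x → hits Ns x * prim x + hit ι* x * prim x)
    ≡⟨ total-cong (shell 𝒪³ (2 * m)) (λ x _ → lem (hits Ns x) (hit ι* x) (prim x)) ⟩
  Σ[ 𝒪³ ⊢ 2 * m ] (λ x → hits (ι* ∷ Ns) x * prim x)
    ≡⟨ Σ-neighbour 𝒪³ (ι* ∷ Ns) ᾱ· (verified _) m ⟩
  𝐫 (2 * m) + 2 * Σ[ 𝒪³ ⊢ 2 * m ] (λ x → hit ᾱ· x * prim x) + 4 * halved 𝒪³ m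
    ≡⟨ cong (λ t → 𝐫 (2 * m) + 2 * t + 4 * halved 𝒪³ m) (Σ-similarity 𝒪³ 𝒪³ αᴼ m) ⟩
  𝐫 (2 * m) + 2 * 𝐫 m + 4 * halved 𝒪³ m ∎
  where
  open ≡-Reasoning
  Ns : List (Mat 6 6)
  Ns = List.map Similarity.N 𝒪³→𝒪³
  lem : ∀ a b p → a * p + b * p ≡ (b + a) * p
  lem = solveℕ

hecke-ℒ : ∀ m → 7 * 𝐫 m ≡ 𝐍 (2 * m) + 2 * 𝐍 m + 4 * halved ℒ m
hecke-ℒ m = begin
  7 * 𝐫 m
    ≡⟨ Σ-hits 𝒪³ ℒ 𝒪³→ℒ m ⟨
  Σ[ ℒ ⊢ 2 * m ] (λ x → hits (List.map Similarity.N 𝒪³→ℒ) x * prim x)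
    ≡⟨ Σ-neighbour ℒ (List.map Similarity.N 𝒪³→ℒ) α· (verified _) m ⟩
  𝐍 (2 * m) + 2 * Σ[ ℒ ⊢ 2 * m ] (λ x → hit α· x * prim x) + 4 * halved ℒ m
    ≡⟨ cong (λ t → 𝐍 (2 * m) + 2 * t + 4 * halved ℒ m) (Σ-similarity ℒ ℒ ᾱᴸ m) ⟩
  𝐍 (2 * m) + 2 * 𝐍 m + 4 * halved ℒ m ∎
  where open ≡-Reasoning

-- The primitive vectors of norm 2m in αℒ, and likewise those in ᾱℒ, are as many as the primitive
-- vectors of norm m. Since α and ᾱ are coprime, a vector in both lies in 2ℒ.
two-multiples : ∀ m → 2 * 𝐍 m ≤ 𝐍 (2 * m) + halved ℒ m
two-multiples m = begin
  2 * 𝐍 m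
    ≡⟨ cong₂ (λ i j → i + (j + 0)) (Σ-similarity ℒ ℒ αᴸ m) (Σ-similarity ℒ ℒ ᾱᴸ m) ⟨
  total (λ x → hit ᾱ· x * prim x) xs + (total (λ x → hit α· x * prim x) xs + 0)
    ≡⟨ cong (total (λ x → hit ᾱ· x * prim x) xs ℕ.+_) (ℕₚ.+-identityʳ _) ⟩
  total (λ x → hit ᾱ· x * prim x) xs + total (λ x → hit α· x * prim x) xs
    ≡⟨ total-+ _ _ xs ⟨
  total (λ x → hit ᾱ· x * prim x + hit α· x * prim x) xs
    ≤⟨ total-mono xs (λ x _ → bound x) ⟩
  total (λ x → prim x + hit one x * prim x) xs
    ≡⟨ total-+ _ _ xs ⟩
  𝐍 (2 * m) + halved ℒ m ∎
  where
  open ℕₚ.≤-Reasoning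
  xs = shell ℒ (2 * m)
  disjoint : ℤ^ 6 → Bool
  disjoint x = (hit ᾱ· x + hit α· x) ≤ᵇ (1 + hit one x)
  hits≤ : ∀ x → hit ᾱ· x + hit α· x ≤ 1 + hit one x
  hits≤ x = subst₂ ℕ._≤_ (cong₂ ℕ._+_ (hit-red ᾱ· x) (hit-red α· x)) (cong suc (hit-red one x))
    (ℕₚ.≤ᵇ⇒≤ _ _ (verify 2 {P = disjoint} (verified _) x))
  bound : ∀ x → hit ᾱ· x * prim x + hit α· x * prim x ≤ prim x + hit one x * prim x
  bound x = ℕₚ.≤-trans (ℕₚ.≤-reflexive (sym (ℕₚ.*-distribʳ-+ (prim x) (hit ᾱ· x) _)))
    (ℕₚ.*-monoˡ-≤ (prim x) (hits≤ x))

-- Diagonalising the Hecke relations along the powers of 2.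

parity : ∀ n → (∃ λ k → n ≡ 2 * k) ⊎ (∃ λ k → n ≡ 1 + 2 * k)
parity zero = inj₁ (0 , refl)
parity (suc n) with parity n
... | inj₁ (k , refl) = inj₂ (k , refl)
... | inj₂ (k , refl) = inj₁ (suc k , cong suc (sym (ℕₚ.+-suc k (k + 0))))

doubled : ℕ → ℕ → ℕ
doubled zero    m = m
doubled (suc k) m = 2 * doubled k m

odd-part : ∀ m → 0 < m → ∃₂ λ k j → m ≡ doubled k (1 + 2 * j)
odd-part m = go m (<-wellFounded m)
  where
  go : ∀ m → Acc ℕ._<_ m → 0 < m → ∃₂ λ k j → m ≡ doubled k (1 + 2 * j)
  go m (acc rs) m>0 with parity m
  ... | inj₂ (j , e) = 0 , j , e
  ... | inj₁ (zero , refl) with () ← m>0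
  ... | inj₁ (suc i , refl) with go (suc i) (rs (ℕₚ.m<m+n (suc i) {suc i + 0} (ℕ.s≤s ℕ.z≤n))) (ℕ.s≤s ℕ.z≤n)
  ...   | k , j , e = suc k , j , cong (2 ℕ.*_) e

infixl 6 _⟨+⟩_
_⟨+⟩_ : ∀ {a b} → + 0 ℤ.≤ a → + 0 ℤ.≤ b → + 0 ℤ.≤ a ℤ.+ b
_⟨+⟩_ = ℤₚ.+-mono-≤

infixr 7 _⟨*⟩_
_⟨*⟩_ : ∀ k {a} → + 0 ℤ.≤ a → + 0 ℤ.≤ + k ℤ.* a
_⟨*⟩_ k {a} p = subst (ℤ._≤ + k ℤ.* a) (ℤₚ.*-zeroʳ (+ k)) (ℤₚ.*-monoˡ-≤-nonNeg (+ k) p)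

nonneg : ∀ {a b} → a ≡ b → + 0 ℤ.≤ a → + 0 ℤ.≤ b
nonneg = subst (+ 0 ℤ.≤_)

nonneg-÷ : ∀ k .{{_ : ℕ.NonZero k}} {a} → + 0 ℤ.≤ + k ℤ.* a → + 0 ℤ.≤ a
nonneg-÷ (suc k) {+ n}      p = ℤ.+≤+ ℕ.z≤n
nonneg-÷ (suc k) { -[1+ n ]} ()

-- In the basis of Hecke eigenvectors e (eigenvalue σ₂(2) = 5) and h (eigenvalue -3), expressed through
-- two quantities x, y known to be nonnegative, the inequalities become termwise positive.
module Eigen (x y : ℤ) (x≥0 : + 0 ℤ.≤ x) (y≥0 : + 0 ℤ.≤ y) where

  -- Coefficients in x and y. Along 2^k m with m odd, e is 8 (N + 7 r) and h is 56 (r - N), so v = e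
  -- - h is 64 N, where x = 8 N(m) and y = 8 (7 r(m) - 4 N(m)).
  E H V : ℕ → ℤ^ 2
  E 0             = + 5 ∷ + 1 ∷ []
  E 1             = + 5 ⊙ E 0
  E (suc (suc k)) = + 5 ⊙ E (suc k) ⊕ -[1+ 3 ] ⊙ E k
  H 0             = −3 ∷ + 1 ∷ []
  H 1             = -[1+ 2 ] ⊙ H 0
  H (suc (suc k)) = -[1+ 2 ] ⊙ H (suc k) ⊕ -[1+ 3 ] ⊙ H k
  V k             = E k ⊕ −1 ⊙ H k

  at : ℤ^ 2 → ℤ
  at u = dot u (x ∷ y ∷ [])

  e h v : ℕ → ℤ
  e k = at (E k)
  h k = at (H k)
  v k = at (V k)

  at-⊕ : ∀ u c w → at (u ⊕ c ⊙ w) ≡ at u ℤ.+ c ℤ.* at w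
  at-⊕ u c w = trans (dot-⊕ˡ u (c ⊙ w) _) (cong (λ t → at u ℤ.+ t) (dot-⊙ˡ c w _))

  at-rec : ∀ b u c w → at (b ⊙ u ⊕ c ⊙ w) ≡ b ℤ.* at u ℤ.+ c ℤ.* at w
  at-rec b u c w = trans (at-⊕ (b ⊙ u) c w) (cong (ℤ._+ c ℤ.* at w) (dot-⊙ˡ b u _))

  positive : ∀ m n → + 0 ℤ.≤ at (+ m ∷ + n ∷ [])
  positive m n = m ⟨*⟩ x≥0 ⟨+⟩ (n ⟨*⟩ y≥0 ⟨+⟩ ℤ.+≤+ ℕ.z≤n)

  -- In short, 3 |h| ≤ e at two consecutive indices, as the recursion has order two, and e at least
  -- quadruples. The difference in `growth` does not depend on k, because the recursion of e has the
  -- roots 1 and 4.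
  record Bounds (k : ℕ) : Set where
    field
      upper  : + 0 ℤ.≤ e k ℤ.+ -[1+ 2 ] ℤ.* h k
      lower  : + 0 ℤ.≤ e k ℤ.+ + 3 ℤ.* h k
      upper⁺ : + 0 ℤ.≤ e (suc k) ℤ.+ -[1+ 2 ] ℤ.* h (suc k)
      lower⁺ : + 0 ℤ.≤ e (suc k) ℤ.+ + 3 ℤ.* h (suc k)
      growth : + 0 ℤ.≤ e (suc k) ℤ.+ -[1+ 3 ] ℤ.* e k

  -- The induction starts at index 2, since e - 3h still has a negative coefficient at 0 and at 1.
  -- The literals are the coefficients of x and y.
  bounds : ∀ k → Bounds (2 + k)
  bounds zero = record
    { upper  = nonneg (at-⊕ (E 2) -[1+ 2 ] (H 2)) (positive 150 6)
    ; lower  = nonneg (at-⊕ (E 2) (+ 3) (H 2)) (positive 60 36)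
    ; upper⁺ = nonneg (at-⊕ (E 3) -[1+ 2 ] (H 3)) (positive 398 94)
    ; lower⁺ = nonneg (at-⊕ (E 3) (+ 3) (H 3)) (positive 452 76)
    ; growth = nonneg (at-⊕ (E 3) -[1+ 3 ] (E 2)) (positive 5 1)
    }
  bounds (suc k) = record
    { upper  = upper⁺
    ; lower  = lower⁺
    ; upper⁺ = nonneg (trans (l₁ a b c d) (cong₂ (λ s t → s ℤ.+ -[1+ 2 ] ℤ.* t) (sym e-rec) (sym h-rec)))
        (3 ⟨*⟩ lower⁺ ⟨+⟩ 4 ⟨*⟩ lower ⟨+⟩ 2 ⟨*⟩ growth)
    ; lower⁺ = nonneg (trans (l₂ a b c d) (cong₂ (λ s t → s ℤ.+ + 3 ℤ.* t) (sym e-rec) (sym h-rec)))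
        (3 ⟨*⟩ upper⁺ ⟨+⟩ 4 ⟨*⟩ upper ⟨+⟩ 2 ⟨*⟩ growth)
    ; growth = nonneg (trans (l₃ a b) (cong (ℤ._+ -[1+ 3 ] ℤ.* a) (sym e-rec))) growth
    }
    where
    open Bounds (bounds k)
    a b c d : ℤ
    a = e (3 + k)
    b = e (2 + k)
    c = h (3 + k)
    d = h (2 + k)
    e-rec : e (4 + k) ≡ + 5 ℤ.* a ℤ.+ -[1+ 3 ] ℤ.* b
    e-rec = at-rec (+ 5) (E (3 + k)) -[1+ 3 ] (E (2 + k))
    h-rec : h (4 + k) ≡ -[1+ 2 ] ℤ.* c ℤ.+ -[1+ 3 ] ℤ.* d
    h-rec = at-rec -[1+ 2 ] (H (3 + k)) -[1+ 3 ] (H (2 + k))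
    l₁ : ∀ a b c d → + 3 ℤ.* (a ℤ.+ + 3 ℤ.* c) ℤ.+ + 4 ℤ.* (b ℤ.+ + 3 ℤ.* d) ℤ.+ + 2 ℤ.* (a ℤ.+ -[1+ 3 ] ℤ.* b)
      ≡ + 5 ℤ.* a ℤ.+ -[1+ 3 ] ℤ.* b ℤ.+ -[1+ 2 ] ℤ.* (-[1+ 2 ] ℤ.* c ℤ.+ -[1+ 3 ] ℤ.* d)
    l₁ = solve-∀
    l₂ : ∀ a b c d →
      + 3 ℤ.* (a ℤ.+ -[1+ 2 ] ℤ.* c) ℤ.+ + 4 ℤ.* (b ℤ.+ -[1+ 2 ] ℤ.* d) ℤ.+ + 2 ℤ.* (a ℤ.+ -[1+ 3 ] ℤ.* b)
      ≡ + 5 ℤ.* a ℤ.+ -[1+ 3 ] ℤ.* b ℤ.+ + 3 ℤ.* (-[1+ 2 ] ℤ.* c ℤ.+ -[1+ 3 ] ℤ.* d)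
    l₂ = solve-∀
    l₃ : ∀ a b → a ℤ.+ -[1+ 3 ] ℤ.* b ≡ + 5 ℤ.* a ℤ.+ -[1+ 3 ] ℤ.* b ℤ.+ -[1+ 3 ] ℤ.* a
    l₃ = solve-∀

  v-value : ∀ k → v k ≡ e k ℤ.+ -[1+ 0 ] ℤ.* h k
  v-value k = at-⊕ (E k) -[1+ 0 ] (H k)

  module Step (k : ℕ) where
    open Bounds (bounds k) public
    a b c d : ℤ
    a = e (3 + k)
    b = e (2 + k)
    c = h (3 + k)
    d = h (2 + k)
    v₄ : v (4 + k) ≡ (+ 5 ℤ.* a ℤ.+ -[1+ 3 ] ℤ.* b) ℤ.+ -[1+ 0 ] ℤ.* (-[1+ 2 ] ℤ.* c ℤ.+ -[1+ 3 ] ℤ.* d)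
    v₄ = trans (v-value (4 + k)) (cong₂ (λ s t → s ℤ.+ -[1+ 0 ] ℤ.* t)
      (at-rec (+ 5) (E (3 + k)) -[1+ 3 ] (E (2 + k))) (at-rec -[1+ 2 ] (H (3 + k)) -[1+ 3 ] (H (2 + k))))

  -- Three times the difference is a combination of the bounds with nonnegative integer
  -- coefficients; in the three initial cases its coefficients in x and y are nonnegative outright.
  -- The same holds for `growth₁₀`.
  growth₂ : ∀ k → + 0 ℤ.≤ v (suc k) ℤ.+ -[1+ 1 ] ℤ.* v k
  growth₂ 0 = nonneg (at-⊕ (V 1) -[1+ 1 ] (V 0)) (positive 0 8)
  growth₂ 1 = nonneg (at-⊕ (V 2) -[1+ 1 ] (V 1)) (positive 88 0)
  growth₂ 2 = nonneg (at-⊕ (V 3) -[1+ 1 ] (V 2)) (positive 176 56)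
  growth₂ (suc (suc (suc k))) = nonneg-÷ 3 (nonneg
      (trans (lem a b c d) (cong₂ (λ s t → + 3 ℤ.* (s ℤ.+ -[1+ 1 ] ℤ.* t)) (sym v₄) (sym (v-value (3 + k)))))
      (5 ⟨*⟩ lower⁺ ⟨+⟩ 4 ⟨*⟩ lower ⟨+⟩ 4 ⟨*⟩ growth))
    where
    open Step k
    lem : ∀ a b c d → + 5 ℤ.* (a ℤ.+ + 3 ℤ.* c) ℤ.+ + 4 ℤ.* (b ℤ.+ + 3 ℤ.* d) ℤ.+ + 4 ℤ.* (a ℤ.+ -[1+ 3 ] ℤ.* b)
      ≡ + 3 ℤ.* ((+ 5 ℤ.* a ℤ.+ -[1+ 3 ] ℤ.* b) ℤ.+ -[1+ 0 ] ℤ.* (-[1+ 2 ] ℤ.* c ℤ.+ -[1+ 3 ] ℤ.* d)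
          ℤ.+ -[1+ 1 ] ℤ.* (a ℤ.+ -[1+ 0 ] ℤ.* c))
    lem = solve-∀

  growth₁₀ : ∀ k → + 0 ℤ.≤ v (2 + k) ℤ.+ -[1+ 9 ] ℤ.* v k
  growth₁₀ 0 = nonneg (at-⊕ (V 2) -[1+ 9 ] (V 0)) (positive 40 16)
  growth₁₀ 1 = nonneg (at-⊕ (V 3) -[1+ 9 ] (V 1)) (positive 256 8)
  growth₁₀ 2 = nonneg (at-⊕ (V 4) -[1+ 9 ] (V 2)) (positive 472 192)
  growth₁₀ (suc (suc (suc k))) = nonneg-÷ 3 (nonneg
      (trans (lem a b c d) (cong₂ (λ s t → + 3 ℤ.* (s ℤ.+ -[1+ 9 ] ℤ.* t)) (sym v₅) (sym (v-value (3 + k)))))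
      (10 ⟨*⟩ lower⁺ ⟨+⟩ 5 ⟨*⟩ upper⁺ ⟨+⟩ 12 ⟨*⟩ upper ⟨+⟩ 18 ⟨*⟩ growth))
    where
    open Step k
    v₅ : v (5 + k) ≡ (+ 5 ℤ.* (+ 5 ℤ.* a ℤ.+ -[1+ 3 ] ℤ.* b) ℤ.+ -[1+ 3 ] ℤ.* a)
      ℤ.+ -[1+ 0 ] ℤ.* (-[1+ 2 ] ℤ.* (-[1+ 2 ] ℤ.* c ℤ.+ -[1+ 3 ] ℤ.* d) ℤ.+ -[1+ 3 ] ℤ.* c)
    v₅ = trans (v-value (5 + k)) (cong₂ (λ s t → s ℤ.+ -[1+ 0 ] ℤ.* t)
      (trans (at-rec (+ 5) (E (4 + k)) -[1+ 3 ] (E (3 + k)))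
        (cong (λ s → + 5 ℤ.* s ℤ.+ -[1+ 3 ] ℤ.* a) (at-rec (+ 5) (E (3 + k)) -[1+ 3 ] (E (2 + k)))))
      (trans (at-rec -[1+ 2 ] (H (4 + k)) -[1+ 3 ] (H (3 + k)))
        (cong (λ s → -[1+ 2 ] ℤ.* s ℤ.+ -[1+ 3 ] ℤ.* c) (at-rec -[1+ 2 ] (H (3 + k)) -[1+ 3 ] (H (2 + k))))))
    lem : ∀ a b c d → + 10 ℤ.* (a ℤ.+ + 3 ℤ.* c) ℤ.+ + 5 ℤ.* (a ℤ.+ -[1+ 2 ] ℤ.* c)
      ℤ.+ + 12 ℤ.* (b ℤ.+ -[1+ 2 ] ℤ.* d) ℤ.+ + 18 ℤ.* (a ℤ.+ -[1+ 3 ] ℤ.* b)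
      ≡ + 3 ℤ.* ((+ 5 ℤ.* (+ 5 ℤ.* a ℤ.+ -[1+ 3 ] ℤ.* b) ℤ.+ -[1+ 3 ] ℤ.* a)
        ℤ.+ -[1+ 0 ] ℤ.* (-[1+ 2 ] ℤ.* (-[1+ 2 ] ℤ.* c ℤ.+ -[1+ 3 ] ℤ.* d) ℤ.+ -[1+ 3 ] ℤ.* c)
        ℤ.+ -[1+ 9 ] ℤ.* (a ℤ.+ -[1+ 0 ] ℤ.* c))
    lem = solve-∀

-- The argument uses only the relations, so the sequences are left abstract; `N½` and `r½` stand for
-- the values at m/2, read as 0 for odd m.
module Growth (N r N½ r½ : ℕ → ℕ)
  (hecke-N : ∀ m → 7 * r m ≡ N (2 * m) + 2 * N m + 4 * N½ m)
  (hecke-r : ∀ m → 6 * r m + N m ≡ r (2 * m) + 2 * r m + 4 * r½ m)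
  (N-bound : ∀ m → 2 * N m ≤ N (2 * m) + N½ m)
  (N½-even : ∀ k → N½ (2 * k) ≡ N k) (N½-odd : ∀ k → N½ (1 + 2 * k) ≡ 0)
  (r½-even : ∀ k → r½ (2 * k) ≡ r k) (r½-odd : ∀ k → r½ (1 + 2 * k) ≡ 0)
  where

  N-next : ∀ m → + N (2 * m) ≡ + 7 ℤ.* + r m ℤ.- + 2 ℤ.* + N m ℤ.- + 4 ℤ.* + N½ m
  N-next m = trans (lem (+ N (2 * m)) (+ N m) (+ N½ m))
      (cong (λ t → t ℤ.- + 2 ℤ.* + N m ℤ.- + 4 ℤ.* + N½ m) (sym cast))
    where
    cast : + 7 ℤ.* + r m ≡ + N (2 * m) ℤ.+ + 2 ℤ.* + N m ℤ.+ + 4 ℤ.* + N½ m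
    cast = trans (sym (ℤₚ.pos-* 7 (r m))) (trans (cong +_ (hecke-N m))
      (trans (ℤₚ.pos-+ (N (2 * m) + 2 * N m) (4 * N½ m)) (cong₂ ℤ._+_
        (trans (ℤₚ.pos-+ (N (2 * m)) (2 * N m)) (cong (λ t → + N (2 * m) ℤ.+ t) (ℤₚ.pos-* 2 (N m))))
        (ℤₚ.pos-* 4 (N½ m)))))
    lem : ∀ a b c → a ≡ a ℤ.+ + 2 ℤ.* b ℤ.+ + 4 ℤ.* c ℤ.- + 2 ℤ.* b ℤ.- + 4 ℤ.* c
    lem = solve-∀

  r-next : ∀ m → + r (2 * m) ≡ + 4 ℤ.* + r m ℤ.+ + N m ℤ.- + 4 ℤ.* + r½ m
  r-next m = trans (lem₁ (+ r (2 * m)) (+ r m) (+ r½ m))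
      (trans (cong (λ t → t ℤ.- + 2 ℤ.* + r m ℤ.- + 4 ℤ.* + r½ m) (sym cast)) (lem₂ (+ r m) (+ N m) (+ r½ m)))
    where
    cast : + 6 ℤ.* + r m ℤ.+ + N m ≡ + r (2 * m) ℤ.+ + 2 ℤ.* + r m ℤ.+ + 4 ℤ.* + r½ m
    cast = trans (sym (trans (ℤₚ.pos-+ (6 * r m) (N m)) (cong (ℤ._+ + N m) (ℤₚ.pos-* 6 (r m)))))
      (trans (cong +_ (hecke-r m))
      (trans (ℤₚ.pos-+ (r (2 * m) + 2 * r m) (4 * r½ m)) (cong₂ ℤ._+_
        (trans (ℤₚ.pos-+ (r (2 * m)) (2 * r m)) (cong (λ t → + r (2 * m) ℤ.+ t) (ℤₚ.pos-* 2 (r m))))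
        (ℤₚ.pos-* 4 (r½ m)))))
    lem₁ : ∀ a b c → a ≡ a ℤ.+ + 2 ℤ.* b ℤ.+ + 4 ℤ.* c ℤ.- + 2 ℤ.* b ℤ.- + 4 ℤ.* c
    lem₁ = solve-∀
    lem₂ : ∀ a b c → + 6 ℤ.* a ℤ.+ b ℤ.- + 2 ℤ.* a ℤ.- + 4 ℤ.* c ≡ + 4 ℤ.* a ℤ.+ b ℤ.- + 4 ℤ.* c
    lem₂ = solve-∀

  module Odd (j : ℕ) where
    m : ℕ → ℕ
    m k = doubled k (1 + 2 * j)

    a b : ℕ → ℤ
    a k = + N (m k)
    b k = + r (m k)

    a₁ : a 1 ≡ + 7 ℤ.* b 0 ℤ.- + 2 ℤ.* a 0
    a₁ = trans (N-next (m 0)) (trans (cong (λ t → + 7 ℤ.* b 0 ℤ.- + 2 ℤ.* a 0 ℤ.- + 4 ℤ.* + t) (N½-odd j)) (lem (b 0) (a 0)))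
      where
      lem : ∀ b a → + 7 ℤ.* b ℤ.- + 2 ℤ.* a ℤ.- + 4 ℤ.* + 0 ≡ + 7 ℤ.* b ℤ.- + 2 ℤ.* a
      lem = solve-∀

    b₁ : b 1 ≡ + 4 ℤ.* b 0 ℤ.+ a 0
    b₁ = trans (r-next (m 0)) (trans (cong (λ t → + 4 ℤ.* b 0 ℤ.+ a 0 ℤ.- + 4 ℤ.* + t) (r½-odd j)) (lem (b 0) (a 0)))
      where
      lem : ∀ b a → + 4 ℤ.* b ℤ.+ a ℤ.- + 4 ℤ.* + 0 ≡ + 4 ℤ.* b ℤ.+ a
      lem = solve-∀

    a₂ : ∀ k → a (2 + k) ≡ + 7 ℤ.* b (1 + k) ℤ.- + 2 ℤ.* a (1 + k) ℤ.- + 4 ℤ.* a k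
    a₂ k = trans (N-next (m (1 + k)))
      (cong (λ t → + 7 ℤ.* b (1 + k) ℤ.- + 2 ℤ.* a (1 + k) ℤ.- + 4 ℤ.* + t) (N½-even (m k)))

    b₂ : ∀ k → b (2 + k) ≡ + 4 ℤ.* b (1 + k) ℤ.+ a (1 + k) ℤ.- + 4 ℤ.* b k
    b₂ k = trans (r-next (m (1 + k)))
      (cong (λ t → + 4 ℤ.* b (1 + k) ℤ.+ a (1 + k) ℤ.- + 4 ℤ.* + t) (r½-even (m k)))

    x y : ℤ
    x = + 8 ℤ.* a 0
    y = + 8 ℤ.* (+ 7 ℤ.* b 0 ℤ.- + 4 ℤ.* a 0)

    x≥0 : + 0 ℤ.≤ x
    x≥0 = _⟨*⟩_ 8 {a 0} (ℤ.+≤+ ℕ.z≤n)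

    -- By the Hecke relation 7 b₀ - 4 a₀ is a₁ - 2 a₀, and `N-bound` has no correction term at an
    -- odd index.
    y≥0 : + 0 ℤ.≤ y
    y≥0 = 8 ⟨*⟩ nonneg (lem (b 0) (a 0)) (nonneg (cong (ℤ._- + 2 ℤ.* a 0) a₁) (ℤₚ.i≤j⇒0≤j-i
      (subst (ℤ._≤ a 1) (ℤₚ.pos-* 2 (N (m 0))) (ℤ.+≤+ (subst (2 * N (m 0) ℕ.≤_)
        (trans (cong (N (m 1) ℕ.+_) (N½-odd j)) (ℕₚ.+-identityʳ _)) (N-bound (m 0)))))))
      where
      lem : ∀ b a → + 7 ℤ.* b ℤ.- + 2 ℤ.* a ℤ.- + 2 ℤ.* a ≡ + 7 ℤ.* b ℤ.- + 4 ℤ.* a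
      lem = solve-∀

    open Eigen x y x≥0 y≥0

    e≡ : ∀ k → (e k ≡ + 8 ℤ.* (a k ℤ.+ + 7 ℤ.* b k)) × (e (suc k) ≡ + 8 ℤ.* (a (suc k) ℤ.+ + 7 ℤ.* b (suc k)))
    e≡ zero = l₀ (a 0) (b 0) , trans (l₁ (a 0) (b 0)) (cong₂ (λ s t → + 8 ℤ.* (s ℤ.+ + 7 ℤ.* t)) (sym a₁) (sym b₁))
      where
      l₀ : ∀ a b → + 5 ℤ.* (+ 8 ℤ.* a) ℤ.+ (+ 1 ℤ.* (+ 8 ℤ.* (+ 7 ℤ.* b ℤ.- + 4 ℤ.* a)) ℤ.+ + 0) ≡ + 8 ℤ.* (a ℤ.+ + 7 ℤ.* b)
      l₀ = solve-∀
      l₁ : ∀ a b → + 25 ℤ.* (+ 8 ℤ.* a) ℤ.+ (+ 5 ℤ.* (+ 8 ℤ.* (+ 7 ℤ.* b ℤ.- + 4 ℤ.* a)) ℤ.+ + 0)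
        ≡ + 8 ℤ.* (+ 7 ℤ.* b ℤ.- + 2 ℤ.* a ℤ.+ + 7 ℤ.* (+ 4 ℤ.* b ℤ.+ a))
      l₁ = solve-∀
    e≡ (suc k) = proj₂ (e≡ k) , trans (at-rec (+ 5) (E (suc k)) -[1+ 3 ] (E k))
      (trans (cong₂ (λ s t → + 5 ℤ.* s ℤ.+ -[1+ 3 ] ℤ.* t) (proj₂ (e≡ k)) (proj₁ (e≡ k)))
      (trans (l (a (suc k)) (b (suc k)) (a k) (b k)) (cong₂ (λ s t → + 8 ℤ.* (s ℤ.+ + 7 ℤ.* t)) (sym (a₂ k)) (sym (b₂ k)))))
      where
      l : ∀ a b c d → + 5 ℤ.* (+ 8 ℤ.* (a ℤ.+ + 7 ℤ.* b)) ℤ.+ -[1+ 3 ] ℤ.* (+ 8 ℤ.* (c ℤ.+ + 7 ℤ.* d))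
        ≡ + 8 ℤ.* (+ 7 ℤ.* b ℤ.- + 2 ℤ.* a ℤ.- + 4 ℤ.* c ℤ.+ + 7 ℤ.* (+ 4 ℤ.* b ℤ.+ a ℤ.- + 4 ℤ.* d))
      l = solve-∀

    h≡ : ∀ k → (h k ≡ + 56 ℤ.* (b k ℤ.- a k)) × (h (suc k) ≡ + 56 ℤ.* (b (suc k) ℤ.- a (suc k)))
    h≡ zero = l₀ (a 0) (b 0) , trans (l₁ (a 0) (b 0)) (cong₂ (λ s t → + 56 ℤ.* (t ℤ.- s)) (sym a₁) (sym b₁))
      where
      l₀ : ∀ a b → -[1+ 2 ] ℤ.* (+ 8 ℤ.* a) ℤ.+ (+ 1 ℤ.* (+ 8 ℤ.* (+ 7 ℤ.* b ℤ.- + 4 ℤ.* a)) ℤ.+ + 0) ≡ + 56 ℤ.* (b ℤ.- a)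
      l₀ = solve-∀
      l₁ : ∀ a b → + 9 ℤ.* (+ 8 ℤ.* a) ℤ.+ (-[1+ 2 ] ℤ.* (+ 8 ℤ.* (+ 7 ℤ.* b ℤ.- + 4 ℤ.* a)) ℤ.+ + 0)
        ≡ + 56 ℤ.* (+ 4 ℤ.* b ℤ.+ a ℤ.- (+ 7 ℤ.* b ℤ.- + 2 ℤ.* a))
      l₁ = solve-∀
    h≡ (suc k) = proj₂ (h≡ k) , trans (at-rec -[1+ 2 ] (H (suc k)) -[1+ 3 ] (H k))
      (trans (cong₂ (λ s t → -[1+ 2 ] ℤ.* s ℤ.+ -[1+ 3 ] ℤ.* t) (proj₂ (h≡ k)) (proj₁ (h≡ k)))
      (trans (l (a (suc k)) (b (suc k)) (a k) (b k)) (cong₂ (λ s t → + 56 ℤ.* (t ℤ.- s)) (sym (a₂ k)) (sym (b₂ k)))))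
      where
      l : ∀ a b c d → -[1+ 2 ] ℤ.* (+ 56 ℤ.* (b ℤ.- a)) ℤ.+ -[1+ 3 ] ℤ.* (+ 56 ℤ.* (d ℤ.- c))
        ≡ + 56 ℤ.* (+ 4 ℤ.* b ℤ.+ a ℤ.- + 4 ℤ.* d ℤ.- (+ 7 ℤ.* b ℤ.- + 2 ℤ.* a ℤ.- + 4 ℤ.* c))
      l = solve-∀

    v≡ : ∀ k → v k ≡ + 64 ℤ.* a k
    v≡ k = trans (v-value k) (trans (cong₂ (λ s t → s ℤ.+ -[1+ 0 ] ℤ.* t) (proj₁ (e≡ k)) (proj₁ (h≡ k))) (lem (a k) (b k)))
      where
      lem : ∀ a b → + 8 ℤ.* (a ℤ.+ + 7 ℤ.* b) ℤ.+ -[1+ 0 ] ℤ.* (+ 56 ℤ.* (b ℤ.- a)) ≡ + 64 ℤ.* a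
      lem = solve-∀

    extract : ∀ i k c → + 0 ℤ.≤ v i ℤ.+ (ℤ.- + c) ℤ.* v k → c * N (m k) ≤ N (m i)
    extract i k c p = ℤₚ.drop‿+≤+ (subst (ℤ._≤ a i) (sym (ℤₚ.pos-* c _)) (ℤₚ.0≤i-j⇒j≤i (nonneg-÷ 64
      (nonneg (trans (cong₂ (λ s t → s ℤ.+ (ℤ.- + c) ℤ.* t) (v≡ i) (v≡ k)) (lem (a i) (+ c) (a k))) p))))
      where
      lem : ∀ a c b → + 64 ℤ.* a ℤ.+ (ℤ.- c) ℤ.* (+ 64 ℤ.* b) ≡ + 64 ℤ.* (a ℤ.- c ℤ.* b)
      lem = solve-∀

  N-double : ∀ m → 0 < m → 2 * N m ≤ N (2 * m)
  N-double m m>0 with odd-part m m>0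
  ... | k , j , refl = extract (suc k) k 2 (growth₂ k)
    where
    open Odd j
    open Eigen x y x≥0 y≥0

  N-quadruple : ∀ m → 0 < m → 10 * N m ≤ N (2 * (2 * m))
  N-quadruple m m>0 with odd-part m m>0
  ... | k , j , refl = extract (2 + k) k 10 (growth₁₀ k)
    where
    open Odd j
    open Eigen x y x≥0 y≥0

-- Residues modulo √-7, signed permutations and slopes.

multiple-≡ : ∀ p .{{_ : ℕ.NonZero p}} {k l n} (A : Mat k n) (W : Mat k l) (B : Mat l n) →
  map (red p) A ≡ map (red p) (W ⊠ B) → ∀ x → T (multiple p (B ⊛ x)) → T (multiple p (A ⊛ x))
multiple-≡ p A W B e x t = subst T (sym (multiple-cong p (A ⊛ x) (W ⊛ B ⊛ x)
  (trans (⊛-≡ₚ p A (W ⊠ B) e x) (cong (red p) (⊠-⊛ W B x))))) (multiple-⊛ p W (B ⊛ x) t)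

-- the residues of the coordinates modulo √-7, where α ≡ 4
ρ : Mat 3 6
ρ = (+ 1 ∷ + 4 ∷ + 0 ∷ + 0 ∷ + 0 ∷ + 0 ∷ [])
  ∷ (+ 0 ∷ + 0 ∷ + 1 ∷ + 4 ∷ + 0 ∷ + 0 ∷ [])
  ∷ (+ 0 ∷ + 0 ∷ + 0 ∷ + 0 ∷ + 1 ∷ + 4 ∷ []) ∷ []

-- Modulo 7 the rows of `θ` and of `ρ` span the same space; `W` and `W′` express each by the other.
prim-ρ : ∀ x → primitive7 x ≡ not (multiple 7 (ρ ⊛ x))
prim-ρ x = cong not (T-ext (multiple-≡ 7 ρ W θ refl x) (multiple-≡ 7 θ W′ ρ refl x))
  where
  W : Mat 3 6
  W = (−1 ∷ + 0 ∷ + 0 ∷ + 0 ∷ + 0 ∷ + 0 ∷ [])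
    ∷ (+ 0 ∷ + 0 ∷ −1 ∷ + 0 ∷ + 0 ∷ + 0 ∷ [])
    ∷ (+ 0 ∷ + 0 ∷ + 0 ∷ + 0 ∷ −1 ∷ + 0 ∷ []) ∷ []
  W′ : Mat 6 3
  W′ = (−1 ∷ + 0 ∷ + 0 ∷ []) ∷ (+ 2 ∷ + 0 ∷ + 0 ∷ [])
     ∷ (+ 0 ∷ −1 ∷ + 0 ∷ []) ∷ (+ 0 ∷ + 2 ∷ + 0 ∷ [])
     ∷ (+ 0 ∷ + 0 ∷ −1 ∷ []) ∷ (+ 0 ∷ + 0 ∷ + 2 ∷ []) ∷ []

prim-ρι : ∀ z → primitive7 z ≡ not (multiple 7 ((ρ ⊠ ι) ⊛ z))
prim-ρι z = begin
  primitive7 z ≡⟨ primitive7-⊛ ι ι* (+ 4) (+ 2) (+ 1) refl refl refl refl z ⟨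
  primitive7 (ι ⊛ z) ≡⟨ prim-ρ (ι ⊛ z) ⟩
  not (multiple 7 (ρ ⊛ ι ⊛ z)) ≡⟨ cong (λ v → not (multiple 7 v)) (⊠-⊛ ρ ι z) ⟨
  not (multiple 7 ((ρ ⊠ ι) ⊛ z)) ∎
  where open ≡-Reasoning

-- Conjugation is trivial modulo √-7, so the norm reduces to a sum of squares. The doubling brings
-- in the symmetric matrix: 2 ρᵀρ is congruent to `polar norm` modulo 7.
norm-ρ : ∀ x → (+ 2 ℤ.* dot (ρ ⊛ x) (ρ ⊛ x)) %ℕ 7 ≡ (+ 2 ℤ.* quad norm x) %ℕ 7
norm-ρ x = begin
  (+ 2 ℤ.* dot (ρ ⊛ x) (ρ ⊛ x)) %ℕ 7 ≡⟨ cong (λ t → (+ 2 ℤ.* t) %ℕ 7) (dot-ᵀ ρ x (ρ ⊛ x)) ⟩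
  (+ 2 ℤ.* dot x ((ρ ᵀ) ⊛ ρ ⊛ x)) %ℕ 7 ≡⟨ cong (_%ℕ 7) (dot-⊙ʳ (+ 2) x _) ⟨
  dot x (+ 2 ⊙ (ρ ᵀ) ⊛ ρ ⊛ x) %ℕ 7 ≡⟨ cong (λ v → dot x v %ℕ 7) fold ⟩
  dot x ((scalar 6 (+ 2) ⊠ (ρ ᵀ ⊠ ρ)) ⊛ x) %ℕ 7 ≡⟨ dot-red 7 x _ ⟩
  dot x (red 7 ((scalar 6 (+ 2) ⊠ (ρ ᵀ ⊠ ρ)) ⊛ x)) %ℕ 7
    ≡⟨ cong (λ v → dot x v %ℕ 7) (⊛-≡ₚ 7 (scalar 6 (+ 2) ⊠ (ρ ᵀ ⊠ ρ)) (polar norm) refl x) ⟩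
  dot x (red 7 (polar norm ⊛ x)) %ℕ 7 ≡⟨ dot-red 7 x (polar norm ⊛ x) ⟨
  dot x (polar norm ⊛ x) %ℕ 7 ≡⟨ cong (_%ℕ 7) (quad-polar norm x) ⟩
  (+ 2 ℤ.* quad norm x) %ℕ 7 ∎
  where
  open ≡-Reasoning
  fold : + 2 ⊙ (ρ ᵀ) ⊛ ρ ⊛ x ≡ (scalar 6 (+ 2) ⊠ (ρ ᵀ ⊠ ρ)) ⊛ x
  fold = sym (trans (⊠-⊛ (scalar 6 (+ 2)) (ρ ᵀ ⊠ ρ) x) (trans (scalar-⊛ (+ 2) _) (cong (+ 2 ⊙_) (⊠-⊛ (ρ ᵀ) ρ x))))

multiple-1 : ∀ {n} (x : ℤ^ n) → T (multiple 1 x)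
multiple-1 x = subst (T ∘ multiple 1) (one⊙ x) (⇒multiple 1 x)
  where
  one⊙ : ∀ {n} (x : ℤ^ n) → + 1 ⊙ x ≡ x
  one⊙ []      = refl
  one⊙ (a ∷ x) = cong₂ _∷_ (ℤₚ.*-identityˡ a) (one⊙ x)

Σ-isometry : ∀ (E : Lattice) (M N : Mat 6 6) → N ⊠ M ≡ one → M ⊠ N ≡ one →
  M ᵀ ⊠ (polar (form E) ⊠ M) ≡ scalar 6 (+ 1) ⊠ polar (form E) →
  ∀ m (w : ℤ^ 6 → ℕ) → Σ[ E ⊢ m ] (λ x → w (M ⊛ x)) ≡ Σ[ E ⊢ m ] w
Σ-isometry E M N NM MN sim m w = begin
  Σ[ E ⊢ m ] (λ x → w (M ⊛ x)) ≡⟨ Σ-image E E (matrixEmbedding M N 1 1 NM MN sim) m w ⟨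
  Σ[ E ⊢ 1 * m ] (λ x → ind (multiple 1 (N ⊛ x)) * w x)
    ≡⟨ total-cong (shell E (1 * m)) (λ x _ → trans (cong (ℕ._* w x) (ind-true (multiple 1 (N ⊛ x)) (multiple-1 (N ⊛ x)))) (ℕₚ.*-identityˡ (w x))) ⟩
  Σ[ E ⊢ 1 * m ] w ≡⟨ cong (λ k → Σ[ E ⊢ k ] w) (ℕₚ.*-identityˡ m) ⟩
  Σ[ E ⊢ m ] w ∎
  where
  open ≡-Reasoning

-- By `residue`, the slope of σ x is the form ℓ σ̄ evaluated at the residues of x. This turns a sum
-- over an orbit into a count of forms on 𝔽₇³.
record Symmetry (E : Lattice) (R : Mat 3 6) : Set where
  field
    σ         : Mat 6 6
    σ̄         : Mat 3 3
    invariant : ∀ m (w : ℤ^ 6 → ℕ) → Σ[ E ⊢ m ] (λ x → w (σ ⊛ x)) ≡ Σ[ E ⊢ m ] w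
    residue   : ∀ x → R ⊛ σ ⊛ x ≡ σ̄ ⊛ R ⊛ x

open Symmetry

module _ {E : Lattice} {R : Mat 3 6} where

  _∙_ : Symmetry E R → Symmetry E R → Symmetry E R
  s ∙ t = record
    { σ = σ s ⊠ σ t
    ; σ̄ = σ̄ s ⊠ σ̄ t
    ; invariant = λ m w → trans
        (total-cong (shell E m) (λ x _ → cong w (⊠-⊛ (σ s) (σ t) x)))
        (trans (invariant t m (λ x → w (σ s ⊛ x))) (invariant s m w))
    ; residue = λ x → trans (cong (R ⊛_) (⊠-⊛ (σ s) (σ t) x)) (trans (residue s (σ t ⊛ x))
        (trans (cong (σ̄ s ⊛_) (residue t x)) (sym (⊠-⊛ (σ̄ s) (σ̄ t) (R ⊛ x)))))
    }

  isometry : ∀ (M N : Mat 6 6) (r : Mat 3 3) → N ⊠ M ≡ one → M ⊠ N ≡ one →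
    M ᵀ ⊠ (polar (form E) ⊠ M) ≡ scalar 6 (+ 1) ⊠ polar (form E) → R ⊠ M ≡ r ⊠ R → Symmetry E R
  isometry M N r NM MN sim res = record
    { σ = M ; σ̄ = r ; invariant = Σ-isometry E M N NM MN sim
    ; residue = λ x → trans (sym (⊠-⊛ R M x)) (trans (cong (_⊛ x) res) (⊠-⊛ r R x)) }

  Σ-symmetrize : ∀ (G : List (Symmetry E R)) m w →
    Σ[ E ⊢ m ] (λ x → total (λ s → w (σ s ⊛ x)) G) ≡ List.length G * Σ[ E ⊢ m ] w
  Σ-symmetrize []      m w = total-zero (shell E m) (λ _ _ → refl)
  Σ-symmetrize (s ∷ G) m w = trans (total-+ _ _ (shell E m)) (cong₂ ℕ._+_ (invariant s m w) (Σ-symmetrize G m w))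

intPart : 𝒪Mat → Mat 3 3
intPart = map (map proj₁)

idᴮ flip₁ flip₂ flip₃ cycle cycle² swap₁₂ : 𝒪Mat
idᴮ    = diag 𝟙 𝟙 𝟙
flip₁  = diag -𝟙 𝟙 𝟙
flip₂  = diag 𝟙 -𝟙 𝟙
flip₃  = diag 𝟙 𝟙 -𝟙
cycle  = (𝟘 ∷ 𝟙 ∷ 𝟘 ∷ []) ∷ (𝟘 ∷ 𝟘 ∷ 𝟙 ∷ []) ∷ (𝟙 ∷ 𝟘 ∷ 𝟘 ∷ []) ∷ []
cycle² = (𝟘 ∷ 𝟘 ∷ 𝟙 ∷ []) ∷ (𝟙 ∷ 𝟘 ∷ 𝟘 ∷ []) ∷ (𝟘 ∷ 𝟙 ∷ 𝟘 ∷ []) ∷ []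
swap₁₂ = (𝟘 ∷ 𝟙 ∷ 𝟘 ∷ []) ∷ (𝟙 ∷ 𝟘 ∷ 𝟘 ∷ []) ∷ (𝟘 ∷ 𝟘 ∷ 𝟙 ∷ []) ∷ []

-- the 48 signed permutations, acting on both lattices
products : ∀ {A : Set} → (A → A → A) → (i s₁ s₂ s₃ c c² t : A) → List A
products _∙_ i s₁ s₂ s₃ c c² t = (i ∷ s₁ ∷ []) ⊗ ((i ∷ s₂ ∷ []) ⊗ ((i ∷ s₃ ∷ []) ⊗ ((i ∷ c ∷ c² ∷ []) ⊗ (i ∷ t ∷ []))))
  where _⊗_ = List.cartesianProductWith _∙_

B₃ᴼ : List (Symmetry 𝒪³ ρ)
B₃ᴼ = products _∙_ (g idᴮ refl refl refl refl) (g flip₁ refl refl refl refl) (g flip₂ refl refl refl refl)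
  (g flip₃ refl refl refl refl) (g cycle refl refl refl refl) (g cycle² refl refl refl refl) (g swap₁₂ refl refl refl refl)
  where
  g : ∀ F → mat (F ᴴ) ⊠ mat F ≡ one → mat F ⊠ mat (F ᴴ) ≡ one →
    mat F ᵀ ⊠ (polar norm ⊠ mat F) ≡ scalar 6 (+ 1) ⊠ polar norm → ρ ⊠ mat F ≡ intPart F ⊠ ρ → Symmetry 𝒪³ ρ
  g F = isometry (mat F) (mat (F ᴴ)) (intPart F)

-- The conjugate ι⁻¹ F ι, integral for a signed permutation `F` because that preserves ℒ.
onKlein : 𝒪Mat → Mat 6 6
onKlein F = halve (ι* ⊠ (mat F ⊠ ι))

-- Deciding equality of closed matrices by evaluation is much faster than by conversion.
equalᵛ : ∀ {n} → ℤ^ n → ℤ^ n → Bool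
equalᵛ []      []      = true
equalᵛ (a ∷ x) (b ∷ y) = isYes (a ℤ.≟ b) ∧ equalᵛ x y

equal : ∀ {m n} → Mat m n → Mat m n → Bool
equal []      []      = true
equal (r ∷ A) (s ∷ B) = equalᵛ r s ∧ equal A B

equalᵛ⇒≡ : ∀ {n} (x y : ℤ^ n) → T (equalᵛ x y) → x ≡ y
equalᵛ⇒≡ []      []      _ = refl
equalᵛ⇒≡ (a ∷ x) (b ∷ y) t with a ℤ.≟ b
... | yes refl = cong (a ∷_) (equalᵛ⇒≡ x y t)

equal⇒≡ : ∀ {m n} (A B : Mat m n) → T (equal A B) → A ≡ B
equal⇒≡ []      []      _ = refl
equal⇒≡ (r ∷ A) (s ∷ B) t with Equivalence.to (T-∧ {equalᵛ r s}) t
... | t₁ , t₂ = cong₂ _∷_ (equalᵛ⇒≡ r s t₁) (equal⇒≡ A B t₂)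

B₃ᴸ : List (Symmetry ℒ (ρ ⊠ ι))
B₃ᴸ = products _∙_ (g idᴮ _ _ _ _) (g flip₁ _ _ _ _) (g flip₂ _ _ _ _) (g flip₃ _ _ _ _) (g cycle _ _ _ _) (g cycle² _ _ _ _) (g swap₁₂ _ _ _ _)
  where
  g : ∀ F → T (equal (onKlein (F ᴴ) ⊠ onKlein F) one) → T (equal (onKlein F ⊠ onKlein (F ᴴ)) one) →
    T (equal (onKlein F ᵀ ⊠ (polar klein ⊠ onKlein F)) (scalar 6 (+ 1) ⊠ polar klein)) →
    T (equal ((ρ ⊠ ι) ⊠ onKlein F) (intPart F ⊠ (ρ ⊠ ι))) → Symmetry ℒ (ρ ⊠ ι)
  g F a b d e = isometry (onKlein F) (onKlein (F ᴴ)) (intPart F)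
    (equal⇒≡ _ _ a) (equal⇒≡ _ _ b) (equal⇒≡ _ _ d) (equal⇒≡ _ _ e)

-- an isotropic vector modulo 7; the linear form it defines is the slope
ℓ : ℤ^ 3
ℓ = + 1 ∷ + 2 ∷ + 3 ∷ []

slope : Mat 3 6 → ℕ → ℤ^ 6 → ℕ
slope R k x = ind (dot ℓ (R ⊛ x) %ℕ 7 ≡ᵇ k)

-- the images of ℓ under the signed permutations, in the order of B₃ᴼ and B₃ᴸ
forms : List (ℤ^ 3)
forms =
    (+ 1 ∷ + 2 ∷ + 3 ∷ []) ∷ (+ 2 ∷ + 1 ∷ + 3 ∷ []) ∷ (+ 3 ∷ + 1 ∷ + 2 ∷ []) ∷ (+ 1 ∷ + 3 ∷ + 2 ∷ [])
  ∷ (+ 2 ∷ + 3 ∷ + 1 ∷ []) ∷ (+ 3 ∷ + 2 ∷ + 1 ∷ []) ∷ (+ 1 ∷ + 2 ∷ −3 ∷ []) ∷ (+ 2 ∷ + 1 ∷ −3 ∷ [])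
  ∷ (−3 ∷ + 1 ∷ + 2 ∷ []) ∷ (+ 1 ∷ −3 ∷ + 2 ∷ []) ∷ (+ 2 ∷ −3 ∷ + 1 ∷ []) ∷ (−3 ∷ + 2 ∷ + 1 ∷ [])
  ∷ (+ 1 ∷ −2 ∷ + 3 ∷ []) ∷ (−2 ∷ + 1 ∷ + 3 ∷ []) ∷ (+ 3 ∷ + 1 ∷ −2 ∷ []) ∷ (+ 1 ∷ + 3 ∷ −2 ∷ [])
  ∷ (−2 ∷ + 3 ∷ + 1 ∷ []) ∷ (+ 3 ∷ −2 ∷ + 1 ∷ []) ∷ (+ 1 ∷ −2 ∷ −3 ∷ []) ∷ (−2 ∷ + 1 ∷ −3 ∷ [])
  ∷ (−3 ∷ + 1 ∷ −2 ∷ []) ∷ (+ 1 ∷ −3 ∷ −2 ∷ []) ∷ (−2 ∷ −3 ∷ + 1 ∷ []) ∷ (−3 ∷ −2 ∷ + 1 ∷ [])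
  ∷ (−1 ∷ + 2 ∷ + 3 ∷ []) ∷ (+ 2 ∷ −1 ∷ + 3 ∷ []) ∷ (+ 3 ∷ −1 ∷ + 2 ∷ []) ∷ (−1 ∷ + 3 ∷ + 2 ∷ [])
  ∷ (+ 2 ∷ + 3 ∷ −1 ∷ []) ∷ (+ 3 ∷ + 2 ∷ −1 ∷ []) ∷ (−1 ∷ + 2 ∷ −3 ∷ []) ∷ (+ 2 ∷ −1 ∷ −3 ∷ [])
  ∷ (−3 ∷ −1 ∷ + 2 ∷ []) ∷ (−1 ∷ −3 ∷ + 2 ∷ []) ∷ (+ 2 ∷ −3 ∷ −1 ∷ []) ∷ (−3 ∷ + 2 ∷ −1 ∷ [])
  ∷ (−1 ∷ −2 ∷ + 3 ∷ []) ∷ (−2 ∷ −1 ∷ + 3 ∷ []) ∷ (+ 3 ∷ −1 ∷ −2 ∷ []) ∷ (−1 ∷ + 3 ∷ −2 ∷ [])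
  ∷ (−2 ∷ + 3 ∷ −1 ∷ []) ∷ (+ 3 ∷ −2 ∷ −1 ∷ []) ∷ (−1 ∷ −2 ∷ −3 ∷ []) ∷ (−2 ∷ −1 ∷ −3 ∷ [])
  ∷ (−3 ∷ −1 ∷ −2 ∷ []) ∷ (−1 ∷ −3 ∷ −2 ∷ []) ∷ (−2 ∷ −3 ∷ −1 ∷ []) ∷ (−3 ∷ −2 ∷ −1 ∷ []) ∷ []

count : List (ℤ^ 3) → ℕ → ℤ^ 3 → ℕ
count fs k v = total (λ f → ind (dot f v %ℕ 7 ≡ᵇ k)) fs

count-red : ∀ fs k v → count fs k (red 7 v) ≡ count fs k v
count-red fs k v = total-cong fs (λ f _ → cong (λ r → ind (r ≡ᵇ k)) (sym (dot-red 7 f v)))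

module _ {E : Lattice} {R : Mat 3 6} where

  forms-of : List (Symmetry E R) → List (ℤ^ 3)
  forms-of = List.map (λ s → comb ℓ (σ̄ s))

  slope-orbit : ∀ (G : List (Symmetry E R)) k x → total (λ s → slope R k (σ s ⊛ x)) G ≡ count (forms-of G) k (R ⊛ x)
  slope-orbit []      k x = refl
  slope-orbit (s ∷ G) k x = cong₂ ℕ._+_ (cong (λ r → ind (r %ℕ 7 ≡ᵇ k))
    (trans (cong (dot ℓ) (residue s x)) (sym (dot-comb ℓ (σ̄ s) (R ⊛ x))))) (slope-orbit G k x)

-- The 48 forms are the nonzero isotropic vectors modulo 7. For v ≠ 0 the plane orthogonal to v
-- contains 1, 0 or 2 isotropic lines, according as v · v is zero, a nonzero square or a
-- non-residue; it thus contains 6, 0 or 12 of the forms. The others are spread evenly over the six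
-- nonzero values at v, which leaves 7, 8 or 6 with value 1. The argument is 2 v · v, which is of
-- the same kind because 2 is a square.
κ : ℕ → ℕ
κ 0 = 7
κ 1 = 8
κ 2 = 8
κ 4 = 8
κ _ = 6

nonresidue : ℕ → Bool
nonresidue k = κ k ≡ᵇ 6

slopeCheck : ℤ^ 3 → Bool
slopeCheck v = count forms 1 v ≡ᵇ κ ((+ 2 ℤ.* dot v v) %ℕ 7) * ind (not (multiple 7 v))

perpCheck : ℤ^ 3 → Bool
perpCheck v = not (nonresidue ((+ 2 ℤ.* dot v v) %ℕ 7)) ∨ (count forms 0 v ≡ᵇ 12 * ind (not (multiple 7 v)))

slopeChecked : Verified 7 3 slopeCheck
slopeChecked = verified _

perpChecked : Verified 7 3 perpCheck
perpChecked = verified _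

formsᴼ : forms-of B₃ᴼ ≡ forms
formsᴼ = refl

formsᴸ : forms-of B₃ᴸ ≡ forms
formsᴸ = refl

red-idem : ∀ p .{{_ : ℕ.NonZero p}} {n} (v : ℤ^ n) → red p (red p v) ≡ red p v
red-idem p []      = refl
red-idem p (a ∷ v) = cong₂ _∷_ (cong +_ (%ℕ-cong p (+ (a %ℕ p)) a (ℤ.- (a /ℕ p))
    (lem (+ (a %ℕ p)) (a /ℕ p) (+ p) (a≡a%ℕn+[a/ℕn]*n a p)))) (red-idem p v)
  where
  lem : ∀ r q p → ∀ {a} → a ≡ r ℤ.+ q ℤ.* p → r ≡ a ℤ.+ p ℤ.* (ℤ.- q)
  lem r q p refl = l r q p
    where
    l : ∀ r q p → r ≡ r ℤ.+ q ℤ.* p ℤ.+ p ℤ.* (ℤ.- q)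
    l = solve-∀

2dot-red : ∀ (v : ℤ^ 3) → (+ 2 ℤ.* dot (red 7 v) (red 7 v)) %ℕ 7 ≡ (+ 2 ℤ.* dot v v) %ℕ 7
2dot-red v = sym (begin
  (+ 2 ℤ.* dot v v) %ℕ 7 ≡⟨ cong (_%ℕ 7) (dot-⊙ˡ (+ 2) v v) ⟨
  dot (+ 2 ⊙ v) v %ℕ 7 ≡⟨ dot-red 7 (+ 2 ⊙ v) v ⟩
  dot (+ 2 ⊙ v) v̄ %ℕ 7 ≡⟨ cong (_%ℕ 7) (trans (dot-⊙ˡ (+ 2) v v̄) (sym (dot-⊙ʳ (+ 2) v v̄))) ⟩
  dot v (+ 2 ⊙ v̄) %ℕ 7 ≡⟨ dot-redˡ 7 v (+ 2 ⊙ v̄) ⟩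
  dot v̄ (+ 2 ⊙ v̄) %ℕ 7 ≡⟨ cong (_%ℕ 7) (dot-⊙ʳ (+ 2) v̄ v̄) ⟩
  (+ 2 ℤ.* dot v̄ v̄) %ℕ 7 ∎)
  where
  open ≡-Reasoning
  v̄ = red 7 v

count-1 : ∀ v → count forms 1 v ≡ κ ((+ 2 ℤ.* dot v v) %ℕ 7) * ind (not (multiple 7 v))
count-1 v = begin
  count forms 1 v ≡⟨ count-red forms 1 v ⟨
  count forms 1 (red 7 v) ≡⟨ ℕₚ.≡ᵇ⇒≡ _ _ (verify 7 slopeChecked v) ⟩
  κ ((+ 2 ℤ.* dot (red 7 v) (red 7 v)) %ℕ 7) * ind (not (multiple 7 (red 7 v)))
    ≡⟨ cong₂ (λ k b → κ k * ind (not b)) (2dot-red v) (multiple-cong 7 _ v (red-idem 7 v)) ⟩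
  κ ((+ 2 ℤ.* dot v v) %ℕ 7) * ind (not (multiple 7 v)) ∎
  where open ≡-Reasoning

count-0 : ∀ v → κ ((+ 2 ℤ.* dot v v) %ℕ 7) ≡ 6 → count forms 0 v ≡ 12 * ind (not (multiple 7 v))
count-0 v e = begin
  count forms 0 v ≡⟨ count-red forms 0 v ⟨
  count forms 0 (red 7 v) ≡⟨ guarded (verify 7 perpChecked v) (trans (cong κ (2dot-red v)) e) ⟩
  12 * ind (not (multiple 7 (red 7 v))) ≡⟨ cong (λ b → 12 * ind (not b)) (multiple-cong 7 _ v (red-idem 7 v)) ⟩
  12 * ind (not (multiple 7 v)) ∎
  where
  open ≡-Reasoning
  guarded : ∀ {a b c} → T (not (a ≡ᵇ 6) ∨ (b ≡ᵇ c)) → a ≡ 6 → b ≡ c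
  guarded t refl = ℕₚ.≡ᵇ⇒≡ _ _ t

module _ {E : Lattice} {R : Mat 3 6} (G : List (Symmetry E R)) (G-forms : forms-of G ≡ forms)
  (prim-R : ∀ x → primitive7 x ≡ not (multiple 7 (R ⊛ x))) (m j : ℕ)
  (norm-R : ∀ x → x ∈ shell E m → (+ 2 ℤ.* dot (R ⊛ x) (R ⊛ x)) %ℕ 7 ≡ j) where

  Σ-slope : ∀ k c → (∀ x → x ∈ shell E m → count forms k (R ⊛ x) ≡ c * ind (not (multiple 7 (R ⊛ x)))) →
    List.length G * Σ[ E ⊢ m ] (slope R k) ≡ c * Σ[ E ⊢ m ] prim
  Σ-slope k c e = begin
    List.length G * Σ[ E ⊢ m ] (slope R k) ≡⟨ Σ-symmetrize G m (slope R k) ⟨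
    Σ[ E ⊢ m ] (λ x → total (λ s → slope R k (σ s ⊛ x)) G)
      ≡⟨ total-cong (shell E m) (λ x x∈ → begin
           total (λ s → slope R k (σ s ⊛ x)) G ≡⟨ slope-orbit G k x ⟩
           count (forms-of G) k (R ⊛ x) ≡⟨ cong (λ fs → count fs k (R ⊛ x)) G-forms ⟩
           count forms k (R ⊛ x) ≡⟨ e x x∈ ⟩
           c * ind (not (multiple 7 (R ⊛ x))) ≡⟨ cong (λ b → c * ind b) (prim-R x) ⟨
           c * prim x ∎) ⟩
    Σ[ E ⊢ m ] (λ x → c * prim x) ≡⟨ total-* c prim (shell E m) ⟩
    c * Σ[ E ⊢ m ] prim ∎
    where open ≡-Reasoning

  Σ-slope-1 : List.length G * Σ[ E ⊢ m ] (slope R 1) ≡ κ j * Σ[ E ⊢ m ] prim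
  Σ-slope-1 = Σ-slope 1 (κ j) (λ x x∈ → trans (count-1 (R ⊛ x))
    (cong (λ k → κ k * ind (not (multiple 7 (R ⊛ x)))) (norm-R x x∈)))

  Σ-slope-0 : κ j ≡ 6 → List.length G * Σ[ E ⊢ m ] (slope R 0) ≡ 12 * Σ[ E ⊢ m ] prim
  Σ-slope-0 e = Σ-slope 0 12 (λ x x∈ → count-0 (R ⊛ x) (trans (cong κ (norm-R x x∈)) e))

norm-𝒪³ : ∀ m x → x ∈ shell 𝒪³ m → (+ 2 ℤ.* dot (ρ ⊛ x) (ρ ⊛ x)) %ℕ 7 ≡ (2 * m) % 7
norm-𝒪³ m x x∈ = trans (norm-ρ x) (cong (_%ℕ 7)
  (trans (cong (+ 2 ℤ.*_) (Lattice.∈-shell⁻ 𝒪³ x∈)) (sym (ℤₚ.pos-* 2 m))))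

norm-ℒ : ∀ m z → z ∈ shell ℒ m → (+ 2 ℤ.* dot ((ρ ⊠ ι) ⊛ z) ((ρ ⊠ ι) ⊛ z)) %ℕ 7 ≡ (2 * (2 * m)) % 7
norm-ℒ m z z∈ = trans (cong (λ v → (+ 2 ℤ.* dot v v) %ℕ 7) (⊠-⊛ ρ ι z))
  (norm-𝒪³ (2 * m) (ι ⊛ z) (Lattice.∈-shell⁺ 𝒪³ {2 * m} {ι ⊛ z} (Embedding.quad-M⁺ inclusion {z} {m} (Lattice.∈-shell⁻ ℒ {m} {z} z∈))))

-- Both lattices contain, as the kernel of the slope modulo √-7, a copy of the lattice with Gram matrix 7 I - J.
kernel : Mat 6 6
kernel =
    (+ 3 ∷ −1 ∷ −1 ∷ −1 ∷ −1 ∷ −1 ∷ [])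
  ∷ (+ 0 ∷ + 3 ∷ −1 ∷ −1 ∷ −1 ∷ −1 ∷ [])
  ∷ (+ 0 ∷ + 0 ∷ + 3 ∷ −1 ∷ −1 ∷ −1 ∷ [])
  ∷ (+ 0 ∷ + 0 ∷ + 0 ∷ + 3 ∷ −1 ∷ −1 ∷ [])
  ∷ (+ 0 ∷ + 0 ∷ + 0 ∷ + 0 ∷ + 3 ∷ −1 ∷ [])
  ∷ (+ 0 ∷ + 0 ∷ + 0 ∷ + 0 ∷ + 0 ∷ + 3 ∷ []) ∷ []

kᴼ kᴼ′ kᴸ kᴸ′ : Mat 6 6
kᴼ =
    (−1 ∷ −1 ∷ + 0 ∷ + 0 ∷ + 0 ∷ + 1 ∷ [])
  ∷ (+ 0 ∷ + 1 ∷ −1 ∷ + 0 ∷ + 0 ∷ + 0 ∷ [])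
  ∷ (−1 ∷ + 0 ∷ + 0 ∷ + 1 ∷ + 1 ∷ −1 ∷ [])
  ∷ (+ 0 ∷ + 0 ∷ + 0 ∷ + 0 ∷ + 0 ∷ + 1 ∷ [])
  ∷ (+ 1 ∷ −1 ∷ −1 ∷ + 0 ∷ + 1 ∷ + 0 ∷ [])
  ∷ (+ 0 ∷ + 0 ∷ + 0 ∷ + 1 ∷ −1 ∷ + 0 ∷ []) ∷ []
kᴼ′ =
    (−4 ∷ −2 ∷ −1 ∷ + 3 ∷ + 2 ∷ + 1 ∷ [])
  ∷ (−3 ∷ + 2 ∷ + 1 ∷ + 4 ∷ −2 ∷ −1 ∷ [])
  ∷ (−3 ∷ −5 ∷ + 1 ∷ + 4 ∷ −2 ∷ −1 ∷ [])
  ∷ (−2 ∷ −1 ∷ + 3 ∷ + 5 ∷ + 1 ∷ + 4 ∷ [])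
  ∷ (−2 ∷ −1 ∷ + 3 ∷ + 5 ∷ + 1 ∷ −3 ∷ [])
  ∷ (+ 0 ∷ + 0 ∷ + 0 ∷ + 7 ∷ + 0 ∷ + 0 ∷ []) ∷ []
kᴸ =
    (−2 ∷ −1 ∷ + 0 ∷ + 0 ∷ + 1 ∷ + 1 ∷ [])
  ∷ (+ 1 ∷ + 0 ∷ −1 ∷ + 0 ∷ −1 ∷ + 0 ∷ [])
  ∷ (+ 1 ∷ −1 ∷ + 0 ∷ + 1 ∷ −2 ∷ + 0 ∷ [])
  ∷ (+ 1 ∷ + 0 ∷ + 0 ∷ + 0 ∷ + 1 ∷ −1 ∷ [])
  ∷ (+ 2 ∷ + 0 ∷ −1 ∷ + 1 ∷ −1 ∷ −2 ∷ [])
  ∷ (+ 0 ∷ + 1 ∷ + 0 ∷ + 0 ∷ + 1 ∷ + 0 ∷ []) ∷ []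
kᴸ′ =
    (−1 ∷ + 3 ∷ + 3 ∷ + 5 ∷ −3 ∷ + 2 ∷ [])
  ∷ (−2 ∷ −1 ∷ −1 ∷ −4 ∷ + 1 ∷ + 4 ∷ [])
  ∷ (−3 ∷ −5 ∷ + 2 ∷ + 1 ∷ −2 ∷ −1 ∷ [])
  ∷ (+ 3 ∷ −2 ∷ + 5 ∷ −1 ∷ + 2 ∷ + 8 ∷ [])
  ∷ (+ 2 ∷ + 1 ∷ + 1 ∷ + 4 ∷ −1 ∷ + 3 ∷ [])
  ∷ (+ 1 ∷ + 4 ∷ + 4 ∷ + 2 ∷ −4 ∷ + 5 ∷ []) ∷ []

kernelᴼ : Embedding kernel norm
kernelᴼ = matrixEmbedding kᴼ kᴼ′ 7 1 refl refl refl

kernelᴸ : Embedding kernel klein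
kernelᴸ = matrixEmbedding kᴸ kᴸ′ 7 1 refl refl refl

𝒦 : Lattice
𝒦 = sublattice 𝒪³ kernel kernelᴼ

-- Modulo 7 the rows of `N` are multiples of the slope form, with multipliers `W`; `W′` recovers the
-- form from `N`.
slope-image : ∀ (R : Mat 3 6) (N : Mat 6 6) (W : Mat 6 1) (W′ : Mat 1 6) →
  map (red 7) N ≡ map (red 7) (W ⊠ (comb ℓ R ∷ [])) → map (red 7) (comb ℓ R ∷ []) ≡ map (red 7) (W′ ⊠ N) →
  ∀ x → ind (multiple 7 (N ⊛ x)) * 1 ≡ slope R 0 x
slope-image R N W W′ e e′ x = trans (ℕₚ.*-identityʳ _) (cong ind
    (trans (T-ext (multiple-≡ 7 (comb ℓ R ∷ []) W′ N e′ x) (multiple-≡ 7 N W (comb ℓ R ∷ []) e x))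
      (trans (∧-true _) (cong (λ t → t %ℕ 7 ≡ᵇ 0) (dot-comb ℓ R x)))))
  where
  ∧-true : ∀ b → b ∧ true ≡ b
  ∧-true true  = refl
  ∧-true false = refl

Σ-kernel : ∀ (F : Lattice) (e : Embedding kernel (form F)) → Embedding.scale e ≡ 1 → ∀ (w : ℤ^ 6 → ℕ) →
  (∀ x → ind (Embedding.image e x) * 1 ≡ w x) → ∀ m → Σ[ F ⊢ m ] w ≡ Σ[ 𝒦 ⊢ m ] (λ _ → 1)
Σ-kernel F e s w h m = begin
  Σ[ F ⊢ m ] w ≡⟨ cong (λ k → Σ[ F ⊢ k ] w) (trans (sym (ℕₚ.*-identityˡ m)) (cong (ℕ._* m) (sym s))) ⟩
  Σ[ F ⊢ Embedding.scale e * m ] w ≡⟨ total-cong (shell F _) (λ x _ → h x) ⟨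
  Σ[ F ⊢ Embedding.scale e * m ] (λ x → ind (Embedding.image e x) * 1) ≡⟨ Σ-image 𝒦 F e m (λ _ → 1) ⟩
  Σ[ 𝒦 ⊢ m ] (λ _ → 1) ∎
  where open ≡-Reasoning

slope-0-equal : ∀ m → Σ[ 𝒪³ ⊢ m ] (slope ρ 0) ≡ Σ[ ℒ ⊢ m ] (slope (ρ ⊠ ι) 0)
slope-0-equal m = trans (Σ-kernel 𝒪³ kernelᴼ refl (slope ρ 0) (slope-image ρ kᴼ′ Wᴼ Wᴼ′ refl refl) m)
    (sym (Σ-kernel ℒ kernelᴸ refl (slope (ρ ⊠ ι) 0) (slope-image (ρ ⊠ ι) kᴸ′ Wᴸ Wᴸ′ refl refl) m))
  where
  Wᴼ Wᴸ : Mat 6 1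
  Wᴼ = (+ 3 ∷ []) ∷ (+ 4 ∷ []) ∷ (+ 4 ∷ []) ∷ (+ 5 ∷ []) ∷ (+ 5 ∷ []) ∷ (+ 0 ∷ []) ∷ []
  Wᴸ = (+ 4 ∷ []) ∷ (+ 1 ∷ []) ∷ (+ 5 ∷ []) ∷ (+ 2 ∷ []) ∷ (+ 6 ∷ []) ∷ (+ 3 ∷ []) ∷ []
  Wᴼ′ Wᴸ′ : Mat 1 6
  Wᴼ′ = (+ 5 ∷ + 0 ∷ + 0 ∷ + 0 ∷ + 0 ∷ + 0 ∷ []) ∷ []
  Wᴸ′ = (+ 2 ∷ + 0 ∷ + 0 ∷ + 0 ∷ + 0 ∷ + 0 ∷ []) ∷ []

𝐂 : ℕ → ℕ
𝐂 m = Σ[ ℒ ⊢ m ] (slope (ρ ⊠ ι) 1)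

𝐂-𝐍 : ∀ m → 48 * 𝐂 m ≡ κ ((2 * (2 * m)) % 7) * 𝐍 m
𝐂-𝐍 m = Σ-slope-1 B₃ᴸ formsᴸ prim-ρι m _ (norm-ℒ m)

-- At a non-residue, 12 of the 48 forms vanish at each primitive vector, in both lattices. So each
-- count is four times the number of vectors of slope 0, and these vectors correspond through
-- `kernel`.
𝐫≡𝐍 : ∀ m → κ ((2 * m) % 7) ≡ 6 → κ ((2 * (2 * m)) % 7) ≡ 6 → 𝐫 m ≡ 𝐍 m
𝐫≡𝐍 m e e′ = ℕₚ.*-cancelˡ-≡ (𝐫 m) (𝐍 m) 12 (begin
  12 * 𝐫 m ≡⟨ Σ-slope-0 B₃ᴼ formsᴼ prim-ρ m _ (norm-𝒪³ m) e ⟨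
  48 * Σ[ 𝒪³ ⊢ m ] (slope ρ 0) ≡⟨ cong (48 ℕ.*_) (slope-0-equal m) ⟩
  48 * Σ[ ℒ ⊢ m ] (slope (ρ ⊠ ι) 0) ≡⟨ Σ-slope-0 B₃ᴸ formsᴸ prim-ρι m _ (norm-ℒ m) e′ ⟩
  12 * 𝐍 m ∎)
  where open ≡-Reasoning

-- Seven coordinates, rotations and the minimal first entry.

-- The Klein lattice as an ideal of ℤ[ζ₇]: coordinates of √-7 z ∈ ℤ⁷ with vanishing sum. For z of slope 1
-- they are congruent modulo 7 to c, c + 1, …, c + 6, and the sum of their squares is 14 times the norm.
X : Mat 7 6
X = (+ 1 ∷ + 4 ∷ + 2 ∷ + 1 ∷ −3 ∷ + 2 ∷ [])
  ∷ (−1 ∷ + 3 ∷ + 1 ∷ + 4 ∷ −2 ∷ −1 ∷ [])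
  ∷ (−3 ∷ −5 ∷ + 0 ∷ + 0 ∷ −1 ∷ −4 ∷ [])
  ∷ (+ 2 ∷ + 1 ∷ −1 ∷ + 3 ∷ + 0 ∷ + 0 ∷ [])
  ∷ (+ 0 ∷ + 0 ∷ −2 ∷ −1 ∷ + 1 ∷ −3 ∷ [])
  ∷ (−2 ∷ −1 ∷ −3 ∷ −5 ∷ + 2 ∷ + 1 ∷ [])
  ∷ (+ 3 ∷ −2 ∷ + 3 ∷ −2 ∷ + 3 ∷ + 5 ∷ []) ∷ []

rotate : {A : Set} → Vec A 7 → Vec A 7
rotate (a ∷ b ∷ c ∷ d ∷ e ∷ f ∷ g ∷ []) = b ∷ c ∷ d ∷ e ∷ f ∷ g ∷ a ∷ []

-- multiplication by ζ₇
ζ ζ⁻¹ : Mat 6 6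
ζ   = mat ((-α ∷ -𝟙 ∷ 𝟘 ∷ []) ∷ (-𝟙 ∷ 𝟘 ∷ -𝟙 ∷ []) ∷ (-ᾱ ∷ α ∷ 𝟘 ∷ []) ∷ [])
ζ⁻¹ = mat ((α ∷ 𝟘 ∷ 𝟙 ∷ []) ∷ (ᾱ ∷ 𝟘 ∷ -α ∷ []) ∷ (-α ∷ -𝟙 ∷ -𝟙 ∷ []) ∷ [])

-- the linear form on the Klein lattice whose residue is the slope
ℓᴸ : Mat 1 6
ℓᴸ = comb ℓ (ρ ⊠ ι) ∷ []

slope₁ : ℤ^ 6 → ℕ
slope₁ = slope (ρ ⊠ ι) 1

slope-linear : ∀ k x → slope (ρ ⊠ ι) k x ≡ ind (dot (comb ℓ (ρ ⊠ ι)) x %ℕ 7 ≡ᵇ k)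
slope-linear k x = cong (λ t → ind (t %ℕ 7 ≡ᵇ k)) (sym (dot-comb ℓ (ρ ⊠ ι) x))

slope-invariant : ∀ (M : Mat 6 6) → map (red 7) (ℓᴸ ⊠ M) ≡ map (red 7) ℓᴸ → ∀ k x →
  slope (ρ ⊠ ι) k (M ⊛ x) ≡ slope (ρ ⊠ ι) k x
slope-invariant M e k x = trans (slope-linear k (M ⊛ x)) (trans (cong (λ r → ind (r ≡ᵇ k)) eq) (sym (slope-linear k x)))
  where
  eq : dot (comb ℓ (ρ ⊠ ι)) (M ⊛ x) %ℕ 7 ≡ dot (comb ℓ (ρ ⊠ ι)) x %ℕ 7
  eq = trans (cong (_%ℕ 7) (sym (dot-comb (comb ℓ (ρ ⊠ ι)) M x)))
    (ℤₚ.+-injective (cong head (⊛-≡ₚ 7 (ℓᴸ ⊠ M) ℓᴸ e x)))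

isMin : ℤ → List ℤ → Bool
isMin a = all (a ℤ.≤ᵇ_)

all-++ : ∀ (p : ℤ → Bool) xs x → all p (xs ++ x ∷ []) ≡ p x ∧ all p xs
all-++ p []       x = refl
all-++ p (y ∷ xs) x = trans (cong (p y ∧_) (all-++ p xs x)) (trans (sym (∧-assoc (p y) (p x) (all p xs)))
  (trans (cong (_∧ all p xs) (∧-comm (p y) (p x))) (∧-assoc (p x) (p y) (all p xs))))

minimum : ∀ x xs → ∃ λ m → m ∈ x ∷ xs × (∀ {y} → y ∈ x ∷ xs → m ℤ.≤ y)
minimum x []       = x , here refl , λ { (here refl) → ℤₚ.≤-refl }
minimum x (y ∷ xs) with minimum y xs
... | m , m∈ , low with ℤₚ.≤-total x m
...   | inj₁ x≤m = x , here refl , λ { (here refl) → ℤₚ.≤-refl ; (there i) → ℤₚ.≤-trans x≤m (low i) }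
...   | inj₂ m≤x = m , there m∈ , λ { (here refl) → m≤x ; (there i) → low i }

isMin⁺ : ∀ a xs → (∀ {y} → y ∈ xs → a ℤ.≤ y) → isMin a xs ≡ true
isMin⁺ a []       low = refl
isMin⁺ a (x ∷ xs) low = cong₂ _∧_ (T-ext (λ _ → _) (λ _ → ℤₚ.≤⇒≤ᵇ (low (here refl)))) (isMin⁺ a xs (λ i → low (there i)))

isMin⁻ : ∀ a xs → T (isMin a xs) → ∀ {y} → y ∈ xs → a ℤ.≤ y
isMin⁻ a (x ∷ xs) t i with Equivalence.to (T-∧ {a ℤ.≤ᵇ x}) t
isMin⁻ a (x ∷ xs) t (here refl) | t₁ , t₂ = ℤₚ.≤ᵇ⇒≤ t₁
isMin⁻ a (x ∷ xs) t (there i)   | t₁ , t₂ = isMin⁻ a xs t₂ i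

unique-minimum : ∀ x xs → Unique (x ∷ xs) → total (λ a → ind (isMin a (x ∷ xs))) (x ∷ xs) ≡ 1
unique-minimum x xs u with minimum x xs
... | m , m∈ , low = trans
  (total-support (λ a → ind (isMin a (x ∷ xs))) {zs = m ∷ []} ([] ∷ []) u (λ { (here refl) → m∈ }) only)
  (cong (λ b → ind b + 0) (isMin⁺ m (x ∷ xs) low))
  where
  only : ∀ {y} → y ∈ x ∷ xs → ind (isMin y (x ∷ xs)) ≢ 0 → y ∈ m ∷ []
  only {y} y∈ ne = here (ℤₚ.≤-antisym (isMin⁻ y (x ∷ xs) (ind≢0⇒T (isMin y (x ∷ xs)) ne) m∈) (low y∈))

headMin : ℤ^ 7 → ℕ
headMin (a ∷ v) = ind (isMin a (a ∷ toList v))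

rotations : (ℤ^ 7 → ℕ) → ℤ^ 7 → ℕ
rotations w v = w v + (w (r 1) + (w (r 2) + (w (r 3) + (w (r 4) + (w (r 5) + (w (r 6) + 0))))))
  where
  r : ℕ → ℤ^ 7
  r zero    = v
  r (suc n) = rotate (r n)

-- Minimality of an entry does not depend on the cyclic order, so the seven terms are the minimality
-- indicators of the seven entries.
rotations-headMin : ∀ v → Unique (toList v) → rotations headMin v ≡ 1
rotations-headMin (a ∷ b ∷ c ∷ d ∷ e ∷ f ∷ g ∷ []) u = trans
  (cong (ind (isMin a (a ∷ b ∷ c ∷ d ∷ e ∷ f ∷ g ∷ [])) ℕ.+_) (cong₂ ℕ._+_ (step b (b ∷ c ∷ d ∷ e ∷ f ∷ g ∷ []) (a ∷ []))
    (cong₂ ℕ._+_ (step c (c ∷ d ∷ e ∷ f ∷ g ∷ []) (a ∷ b ∷ []))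
    (cong₂ ℕ._+_ (step d (d ∷ e ∷ f ∷ g ∷ []) (a ∷ b ∷ c ∷ []))
    (cong₂ ℕ._+_ (step e (e ∷ f ∷ g ∷ []) (a ∷ b ∷ c ∷ d ∷ []))
    (cong₂ ℕ._+_ (step f (f ∷ g ∷ []) (a ∷ b ∷ c ∷ d ∷ e ∷ []))
    (cong (ℕ._+ 0) (step g (g ∷ []) (a ∷ b ∷ c ∷ d ∷ e ∷ f ∷ [])))))))))
  (unique-minimum a (b ∷ c ∷ d ∷ e ∷ f ∷ g ∷ []) u)
  where
  swap : ∀ x xs ys → isMin x (xs ++ ys) ≡ isMin x (ys ++ xs)
  swap x xs []       = cong (isMin x) (Listₚ.++-identityʳ xs)
  swap x xs (y ∷ ys) = begin
    isMin x (xs ++ y ∷ ys) ≡⟨ cong (isMin x) (Listₚ.++-assoc xs (y ∷ []) ys) ⟨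
    isMin x ((xs ++ y ∷ []) ++ ys) ≡⟨ swap x (xs ++ y ∷ []) ys ⟩
    isMin x (ys ++ xs ++ y ∷ []) ≡⟨ cong (isMin x) (Listₚ.++-assoc ys xs (y ∷ [])) ⟨
    isMin x ((ys ++ xs) ++ y ∷ []) ≡⟨ all-++ (x ℤ.≤ᵇ_) (ys ++ xs) y ⟩
    isMin x (y ∷ ys ++ xs) ∎
    where open ≡-Reasoning
  step : ∀ x xs ys → ind (isMin x (xs ++ ys)) ≡ ind (isMin x (ys ++ xs))
  step x xs ys = cong ind (swap x xs ys)

-- Modulo 7 these two forms determine all of `X`: the coordinates are an arithmetic progression from
-- the first one, with the slope as common difference.
X₀-and-slope : Mat 2 6
X₀-and-slope = head X ∷ ℓᴸ

progression : Mat 7 2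
progression = (+ 1 ∷ + 0 ∷ []) ∷ (+ 1 ∷ + 1 ∷ []) ∷ (+ 1 ∷ + 2 ∷ []) ∷ (+ 1 ∷ + 3 ∷ [])
  ∷ (+ 1 ∷ + 4 ∷ []) ∷ (+ 1 ∷ + 5 ∷ []) ∷ (+ 1 ∷ + 6 ∷ []) ∷ []

progressionCheck : ℕ → Bool
progressionCheck c = isYes (unique? (toList (red 7 (progression ⊛ (+ c ∷ + 1 ∷ [])))))

X-residues : ∀ z → dot ℓ ((ρ ⊠ ι) ⊛ z) %ℕ 7 ≡ 1 →
  red 7 (X ⊛ z) ≡ red 7 (progression ⊛ (+ (dot (head X) z %ℕ 7) ∷ + 1 ∷ []))
X-residues z s = begin
  red 7 (X ⊛ z) ≡⟨ ⊛-≡ₚ 7 X (progression ⊠ X₀-and-slope) refl z ⟩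
  red 7 ((progression ⊠ X₀-and-slope) ⊛ z) ≡⟨ cong (red 7) (⊠-⊛ progression X₀-and-slope z) ⟩
  red 7 (progression ⊛ X₀-and-slope ⊛ z) ≡⟨ ⊛-red 7 progression (X₀-and-slope ⊛ z) ⟩
  red 7 (progression ⊛ red 7 (X₀-and-slope ⊛ z))
    ≡⟨ cong (λ k → red 7 (progression ⊛ (+ (dot (head X) z %ℕ 7) ∷ + k ∷ [])))
         (trans (cong (_%ℕ 7) (dot-comb ℓ (ρ ⊠ ι) z)) s) ⟩
  red 7 (progression ⊛ (+ (dot (head X) z %ℕ 7) ∷ + 1 ∷ [])) ∎
  where open ≡-Reasoning

toList-map : ∀ {A B : Set} (f : A → B) {n} (v : Vec A n) → toList (map f v) ≡ List.map f (toList v)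
toList-map f []      = refl
toList-map f (a ∷ v) = cong (f a ∷_) (toList-map f v)

X-distinct : ∀ z → dot ℓ ((ρ ⊠ ι) ⊛ z) %ℕ 7 ≡ 1 → Unique (toList (X ⊛ z))
X-distinct z s = Uniqueₚ.map⁻ {f = λ t → + (t %ℕ 7)} (subst Unique (toList-map (λ t → + (t %ℕ 7)) (X ⊛ z))
  (subst (Unique ∘ toList) (sym (X-residues z s))
    (toUnique (allBelow-sound {7} {progressionCheck} _ _ (n%ℕd<d (dot (head X) z) 7)))))
  where
  toUnique : ∀ {xs} → T (isYes (unique? xs)) → Unique xs
  toUnique {xs} t with unique? xs
  ... | yes u = u

module _ (φ : ℤ^ 7 → ℕ) (φ-rotate : ∀ v → φ (rotate v) ≡ φ v) where

  private
    weight : (ℤ^ 7 → ℕ) → ℤ^ 6 → ℕ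
    weight w z = slope₁ z * (φ (X ⊛ z) * w (X ⊛ z))

    X-ζ : ∀ z → X ⊛ ζ ⊛ z ≡ rotate (X ⊛ z)
    -- By evaluation, the rows of `X ⊠ ζ` are those of `X` rotated.
    X-ζ z = trans (sym (⊠-⊛ X ζ z)) refl

    shift : ∀ m (w : ℤ^ 7 → ℕ) → Σ[ ℒ ⊢ m ] (weight (w ∘ rotate)) ≡ Σ[ ℒ ⊢ m ] (weight w)
    shift m w = trans (total-cong (shell ℒ m) (λ z _ → sym (cong₂ ℕ._*_ (slope-invariant ζ refl 1 z)
        (trans (cong (λ v → φ v * w v) (X-ζ z)) (cong (ℕ._* w (rotate (X ⊛ z))) (φ-rotate (X ⊛ z)))))))
      (Σ-isometry ℒ ζ ζ⁻¹ refl refl refl m (weight w))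

  -- Exactly one of the seven rotations of X ⊛ z starts with its minimum.
  Σ-rotations : ∀ m → Σ[ ℒ ⊢ m ] (λ z → slope₁ z * φ (X ⊛ z)) ≡
    7 * Σ[ ℒ ⊢ m ] (λ z → slope₁ z * (φ (X ⊛ z) * headMin (X ⊛ z)))
  Σ-rotations m = begin
    Σ[ ℒ ⊢ m ] (λ z → slope₁ z * φ (X ⊛ z))
      ≡⟨ total-cong (shell ℒ m) (λ z _ → pointwise z) ⟩
    total (λ z → W 0 z + (W 1 z + (W 2 z + (W 3 z + (W 4 z + (W 5 z + (W 6 z + 0))))))) (shell ℒ m)
      ≡⟨ expand ⟩
    7 * Σ[ ℒ ⊢ m ] (weight headMin) ∎
    where
    open ≡-Reasoning
    iter : ℕ → ℤ^ 7 → ℤ^ 7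
    iter zero    v = v
    iter (suc k) v = iter k (rotate v)
    W : ℕ → ℤ^ 6 → ℕ
    W k = weight (headMin ∘ iter k)
    ΣW : ∀ k → total (W k) (shell ℒ m) ≡ Σ[ ℒ ⊢ m ] (weight headMin)
    ΣW zero    = refl
    ΣW (suc k) = trans (shift m (headMin ∘ iter k)) (ΣW k)
    plus : ∀ k {f n} → total f (shell ℒ m) ≡ n →
      total (λ z → W k z + f z) (shell ℒ m) ≡ Σ[ ℒ ⊢ m ] (weight headMin) + n
    plus k {f} e = trans (total-+ (W k) f (shell ℒ m)) (cong₂ ℕ._+_ (ΣW k) e)
    expand = plus 0 (plus 1 (plus 2 (plus 3 (plus 4 (plus 5 (plus 6 (total-zero (shell ℒ m) (λ _ _ → refl))))))))
    distribute : ∀ s f a b c d e g h → s * (f * a) + (s * (f * b) + (s * (f * c) + (s * (f * d)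
      + (s * (f * e) + (s * (f * g) + (s * (f * h) + 0)))))) ≡
      (s * f) * (a + (b + (c + (d + (e + (g + (h + 0)))))))
    distribute = solveℕ
    once : ∀ z → (dot ℓ ((ρ ⊠ ι) ⊛ z) %ℕ 7 ≡ᵇ 1) ≡ true → rotations headMin (X ⊛ z) ≡ 1
    once z e = rotations-headMin (X ⊛ z) (X-distinct z (ℕₚ.≡ᵇ⇒≡ _ 1 (subst T (sym e) _)))
    pick : ∀ b f n → (b ≡ true → n ≡ 1) → ind b * f ≡ (ind b * f) * n
    pick true  f n h = sym (trans (cong (1 * f ℕ.*_) (h refl)) (ℕₚ.*-identityʳ (1 * f)))
    pick false f n h = refl
    pointwise : ∀ z → slope₁ z * φ (X ⊛ z) ≡ W 0 z + (W 1 z + (W 2 z + (W 3 z + (W 4 z + (W 5 z + (W 6 z + 0))))))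
    pointwise z = trans (pick (dot ℓ ((ρ ⊠ ι) ⊛ z) %ℕ 7 ≡ᵇ 1) (φ (X ⊛ z)) _ (once z))
      (sym (distribute (slope₁ z) (φ (X ⊛ z)) _ _ _ _ _ _ _))

-- Numbers of odd coordinates.

odd : ∀ {n} → ℤ^ n → ℕ
odd []      = 0
odd (a ∷ v) = a %ℕ 2 + odd v

odd-cong : ∀ {n} (u v : ℤ^ n) → red 2 u ≡ red 2 v → odd u ≡ odd v
odd-cong []      []      e = refl
odd-cong (a ∷ u) (b ∷ v) e = cong₂ ℕ._+_ (ℤₚ.+-injective (cong head e)) (odd-cong u v (cong tail e))

odd-red : ∀ {m} (M : Mat m 6) z → odd (M ⊛ red 2 z) ≡ odd (M ⊛ z)
odd-red M z = odd-cong (M ⊛ red 2 z) (M ⊛ z) (sym (⊛-red 2 M z))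

withOdd : ℕ → ℤ^ 7 → ℕ
withOdd k v = ind (odd v ≡ᵇ k)

odd-rotate : ∀ v → odd (rotate v) ≡ odd v
odd-rotate (a ∷ b ∷ c ∷ d ∷ e ∷ f ∷ g ∷ []) =
  lem (a %ℕ 2) (b %ℕ 2) (c %ℕ 2) (d %ℕ 2) (e %ℕ 2) (f %ℕ 2) (g %ℕ 2)
  where
  lem : ∀ a b c d e f g → b + (c + (d + (e + (f + (g + (a + 0)))))) ≡
    a + (b + (c + (d + (e + (f + (g + 0))))))
  lem = solveℕ

-- 𝐀 m counts the 7-cores of m - 2, and 𝐀ᵒ 0 m and 𝐀ᵒ 6 m those of BG-rank 2 and -1.
𝐀 : ℕ → ℕ
𝐀 m = Σ[ ℒ ⊢ m ] (λ z → slope₁ z * (1 * headMin (X ⊛ z)))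

𝐀ᵒ : ℕ → ℕ → ℕ
𝐀ᵒ k m = Σ[ ℒ ⊢ m ] (λ z → slope₁ z * (withOdd k (X ⊛ z) * headMin (X ⊛ z)))

7𝐀 : ∀ m → 𝐂 m ≡ 7 * 𝐀 m
7𝐀 m = trans (total-cong (shell ℒ m) (λ z _ → sym (ℕₚ.*-identityʳ (slope₁ z)))) (Σ-rotations (λ _ → 1) (λ _ → refl) m)

7𝐀ᵒ : ∀ k m → Σ[ ℒ ⊢ m ] (λ z → slope₁ z * withOdd k (X ⊛ z)) ≡ 7 * 𝐀ᵒ k m
7𝐀ᵒ k m = Σ-rotations (withOdd k) (λ v → cong (λ n → ind (n ≡ᵇ k)) (odd-rotate v)) m

336𝐀 : ∀ m → 336 * 𝐀 m ≡ κ ((2 * (2 * m)) % 7) * 𝐍 m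
336𝐀 m = trans (ℕₚ.*-assoc 48 7 (𝐀 m)) (trans (cong (48 ℕ.*_) (sym (7𝐀 m))) (𝐂-𝐍 m))

-- The parities depend on z modulo 2 and the slope on residues modulo 7. `sixCheck` treats the two
-- as independent: in each class modulo 2 it selects the forms whose symmetry gives six odd
-- coordinates, and then runs through all of 𝔽₇³.
select : List (ℤ^ 3 × Mat 7 6) → ℤ^ 6 → List (ℤ^ 3)
select []            z = []
select ((f , M) ∷ G) z = if odd (M ⊛ z) ≡ᵇ 6 then f ∷ select G z else select G z

signed : List (Symmetry ℒ (ρ ⊠ ι)) → List (ℤ^ 3 × Mat 7 6)
signed = List.map (λ s → comb ℓ (σ̄ s) , X ⊠ σ s)

atMostTwo : List (ℤ^ 3) → ℤ^ 3 → Bool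
atMostTwo fs v = count fs 1 v ≤ᵇ 2

sixCheck : List (ℤ^ 3 × Mat 7 6) → ℤ^ 6 → Bool
sixCheck G z = allCube 7 3 (atMostTwo (select G z))

sixChecked : Verified 2 6 (sixCheck (signed B₃ᴸ))
sixChecked = verified _

select-red : ∀ G z → select G (red 2 z) ≡ select G z
select-red []            z = refl
select-red ((f , M) ∷ G) z = cong₂ (λ n fs → if n ≡ᵇ 6 then f ∷ fs else fs) (odd-red M z) (select-red G z)

select≤2 : ∀ G → Verified 2 6 (sixCheck G) → ∀ z v → count (select G z) 1 v ≤ 2
select≤2 G c z v = subst (ℕ._≤ 2)
  (trans (cong (λ fs → count fs 1 (red 7 v)) (select-red G z)) (count-red (select G z) 1 v))
  (ℕₚ.≤ᵇ⇒≤ (count (select G (red 2 z)) 1 (red 7 v)) 2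
    (allCube-sound 7 {P = atMostTwo (select G (red 2 z))} (verify 2 {P = sixCheck G} c z) v))

count-select : ∀ (G : List (Symmetry ℒ (ρ ⊠ ι))) z →
  total (λ s → slope₁ (σ s ⊛ z) * withOdd 6 (X ⊛ σ s ⊛ z)) G ≡
  count (select (signed G) z) 1 ((ρ ⊠ ι) ⊛ z)
count-select []      z = refl
count-select (s ∷ G) z = trans (cong₂ ℕ._+_ here-slope (count-select G z))
    (pick (odd ((X ⊠ σ s) ⊛ z) ≡ᵇ 6) (comb ℓ (σ̄ s)) _)
  where
  v = (ρ ⊠ ι) ⊛ z
  here-slope : slope₁ (σ s ⊛ z) * withOdd 6 (X ⊛ σ s ⊛ z) ≡
    ind (dot (comb ℓ (σ̄ s)) v %ℕ 7 ≡ᵇ 1) * withOdd 6 ((X ⊠ σ s) ⊛ z)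
  here-slope = cong₂ ℕ._*_
    (cong (λ r → ind (r %ℕ 7 ≡ᵇ 1)) (trans (cong (dot ℓ) (Symmetry.residue s z)) (sym (dot-comb ℓ (σ̄ s) v))))
    (cong (withOdd 6) (sym (⊠-⊛ X (σ s) z)))
  pick : ∀ b f fs → ind (dot f v %ℕ 7 ≡ᵇ 1) * ind b + count fs 1 v ≡ count (if b then f ∷ fs else fs) 1 v
  pick true  f fs = cong (ℕ._+ count fs 1 v) (ℕₚ.*-identityʳ (ind (dot f v %ℕ 7 ≡ᵇ 1)))
  pick false f fs = cong (ℕ._+ count fs 1 v) (ℕₚ.*-zeroʳ (ind (dot f v %ℕ 7 ≡ᵇ 1)))

six≤κ : ∀ j → 6 ≤ κ j
six≤κ j = ℕₚ.≤ᵇ⇒≤ 6 (κ j) (go j)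
  where
  go : ∀ j → T (6 ≤ᵇ κ j)
  go 0 = _
  go 1 = _
  go 2 = _
  go 3 = _
  go 4 = _
  go (suc (suc (suc (suc (suc _))))) = _

total-≤-factor : ∀ {A : Set} (f g : A → ℕ) xs → total (λ x → f x * ind (g x ≡ᵇ 6)) xs ≤ total f xs
total-≤-factor f g xs = total-mono xs (λ x _ → ℕₚ.≤-trans (ℕₚ.*-monoʳ-≤ (f x) (ind≤1 (g x ≡ᵇ 6))) (ℕₚ.≤-reflexive (ℕₚ.*-identityʳ (f x))))
  where
  ind≤1 : ∀ b → ind b ≤ 1
  ind≤1 true  = ℕₚ.≤-refl
  ind≤1 false = ℕ.z≤n

-- Of the signed permutations taking a primitive z to a vector of slope 1 (there are at least 6) at most 2 also
-- take it to a vector with six odd coordinates.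
six-orbit : ∀ (G : List (Symmetry ℒ (ρ ⊠ ι))) → forms-of G ≡ forms → Verified 2 6 (sixCheck (signed G)) → ∀ z →
  3 * total (λ s → slope₁ (σ s ⊛ z) * withOdd 6 (X ⊛ σ s ⊛ z)) G ℕ.≤
  total (λ s → slope₁ (σ s ⊛ z)) G
six-orbit G e c z = bound
    (total (λ s → slope₁ (σ s ⊛ z) * withOdd 6 (X ⊛ σ s ⊛ z)) G)
    (total (λ s → slope₁ (σ s ⊛ z)) G)
    (κ ((+ 2 ℤ.* dot v v) %ℕ 7)) (not (multiple 7 v)) (six≤κ ((+ 2 ℤ.* dot v v) %ℕ 7))
    (subst (ℕ._≤ 2) (sym (count-select G z)) (select≤2 (signed G) c z v))
    (total-≤-factor (λ s → slope₁ (σ s ⊛ z)) (λ s → odd (X ⊛ σ s ⊛ z)) G)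
    (trans (slope-orbit G 1 z) (trans (cong (λ fs → count fs 1 v) e) (count-1 v)))
  where
  v = (ρ ⊠ ι) ⊛ z
  -- If p is false, v vanishes modulo 7 and both counts are 0; otherwise 3 · 2 ≤ 6 ≤ k.
  bound : ∀ a b k p → 6 ≤ k → a ≤ 2 → a ≤ b → b ≡ k * ind p → 3 * a ≤ b
  bound a b k true  6≤k a≤2 a≤b refl = ℕₚ.≤-trans (ℕₚ.*-monoʳ-≤ 3 a≤2) (ℕₚ.≤-trans 6≤k (ℕₚ.≤-reflexive (sym (ℕₚ.*-identityʳ k))))
  bound a b k false 6≤k a≤2 a≤b refl = subst (λ a → 3 * a ≤ k * 0) (sym (ℕₚ.n≤0⇒n≡0 (subst (a ℕ.≤_) (ℕₚ.*-zeroʳ k) a≤b))) ℕ.z≤n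

Σ-six : ∀ (G : List (Symmetry ℒ (ρ ⊠ ι))) → forms-of G ≡ forms → Verified 2 6 (sixCheck (signed G)) → ∀ m →
  3 * (List.length G * Σ[ ℒ ⊢ m ] (λ z → slope₁ z * withOdd 6 (X ⊛ z))) ≤ List.length G * 𝐂 m
Σ-six G e c m = begin
  3 * (List.length G * Σ[ ℒ ⊢ m ] w) ≡⟨ cong (3 ℕ.*_) (Σ-symmetrize G m w) ⟨
  3 * Σ[ ℒ ⊢ m ] (λ z → total (λ s → w (σ s ⊛ z)) G) ≡⟨ total-* 3 _ (shell ℒ m) ⟨
  Σ[ ℒ ⊢ m ] (λ z → 3 * total (λ s → w (σ s ⊛ z)) G) ≤⟨ total-mono (shell ℒ m) (λ z _ → six-orbit G e c z) ⟩
  Σ[ ℒ ⊢ m ] (λ z → total (λ s → slope₁ (σ s ⊛ z)) G) ≡⟨ Σ-symmetrize G m slope₁ ⟩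
  List.length G * 𝐂 m ∎
  where
  open ℕₚ.≤-Reasoning
  w : ℤ^ 6 → ℕ
  w z = slope₁ z * withOdd 6 (X ⊛ z)

3𝐀ᵒ6≤𝐀 : ∀ m → 3 * 𝐀ᵒ 6 m ≤ 𝐀 m
3𝐀ᵒ6≤𝐀 m = ℕₚ.*-cancelˡ-≤ 336 (subst₂ ℕ._≤_ (left (𝐀ᵒ 6 m) (7𝐀ᵒ 6 m)) (right (𝐀 m) (7𝐀 m)) (Σ-six B₃ᴸ formsᴸ sixChecked m))
  where
  lem : ∀ a → 3 * (48 * (7 * a)) ≡ 336 * (3 * a)
  lem = solveℕ
  left : ∀ a {b} → b ≡ 7 * a → 3 * (48 * b) ≡ 336 * (3 * a)
  left a refl = lem a
  right : ∀ a {b} → b ≡ 7 * a → 48 * b ≡ 336 * a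
  right a refl = sym (ℕₚ.*-assoc 48 7 a)

-- the automorphism ζ₇ ↦ ζ₇²
μ μ⁻¹ 2μ : Mat 6 6
μ   = mat ((-𝟙 ∷ 𝟘 ∷ -𝟙 ∷ []) ∷ (𝟘 ∷ -α ∷ -ᾱ ∷ []) ∷ (α ∷ -𝟙 ∷ (+ 1 , + 1) ∷ []) ∷ [])
μ⁻¹ = mat ((ᾱ ∷ 𝟙 ∷ -α ∷ []) ∷ (-𝟚 ∷ -𝟙 ∷ -ᾱ ∷ []) ∷ ((−2 , + 1) ∷ -𝟙 ∷ α ∷ []) ∷ [])
2μ  = scalar 6 (+ 2) ⊠ μ

-- Doubling turns slope 1 into slope 2, and `μ` multiplies slopes by 4. So `2μ` preserves the slope,
-- while all coordinates become even.
doubling : Embedding klein klein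
doubling = matrixEmbedding 2μ μ⁻¹ 2 4 refl refl refl

evenCheck : ℤ^ 6 → Bool
evenCheck z = ind (odd (X ⊛ z) ≡ᵇ 0) ≡ᵇ hit μ⁻¹ z

-- `X` is injective modulo 2, so all coordinates are even exactly on 2ℒ, which is the image of `2μ`
-- because `μ` is invertible.
even-image : ∀ z → withOdd 0 (X ⊛ z) ≡ hit μ⁻¹ z
even-image z = begin
  ind (odd (X ⊛ z) ≡ᵇ 0) ≡⟨ cong (λ n → ind (n ≡ᵇ 0)) (odd-red X z) ⟨
  ind (odd (X ⊛ red 2 z) ≡ᵇ 0) ≡⟨ ℕₚ.≡ᵇ⇒≡ _ _ (verify 2 {P = evenCheck} (verified _) z) ⟩
  hit μ⁻¹ (red 2 z) ≡⟨ hit-red μ⁻¹ z ⟩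
  hit μ⁻¹ z ∎
  where open ≡-Reasoning

𝐀ᵒ0-multiple : ∀ k → 𝐀ᵒ 0 (4 * k) ≡ 𝐀 k
𝐀ᵒ0-multiple k = ℕₚ.*-cancelˡ-≡ (𝐀ᵒ 0 (4 * k)) (𝐀 k) 7 (begin
  7 * 𝐀ᵒ 0 (4 * k) ≡⟨ 7𝐀ᵒ 0 (4 * k) ⟨
  Σ[ ℒ ⊢ 4 * k ] (λ z → slope₁ z * withOdd 0 (X ⊛ z))
    ≡⟨ total-cong (shell ℒ (4 * k)) (λ z _ → trans (ℕₚ.*-comm (slope₁ z) _) (cong (ℕ._* slope₁ z) (even-image z))) ⟩
  Σ[ ℒ ⊢ 4 * k ] (λ z → hit μ⁻¹ z * slope₁ z) ≡⟨ Σ-image ℒ ℒ doubling k slope₁ ⟩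
  Σ[ ℒ ⊢ k ] (λ y → slope₁ (2μ ⊛ y))
    ≡⟨ total-cong (shell ℒ k) (λ y _ → slope-invariant 2μ refl 1 y) ⟩
  𝐂 k ≡⟨ 7𝐀 k ⟩
  7 * 𝐀 k ∎)
  where open ≡-Reasoning

𝐀ᵒ0-nonmultiple : ∀ m → (∀ k → m ≢ 4 * k) → 𝐀ᵒ 0 m ≡ 0
𝐀ᵒ0-nonmultiple m h = total-zero (shell ℒ m) (λ z z∈ →
    trans (cong (λ t → slope₁ z * (t * headMin (X ⊛ z))) (trans (even-image z) (none z z∈ (image z) (M-preimage z))))
      (ℕₚ.*-zeroʳ (slope₁ z)))
  where
  open Embedding doubling
  none : ∀ z → z ∈ shell ℒ m → ∀ b → (T b → 2μ ⊛ preimage z ≡ z) → ind b ≡ 0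
  none z z∈ false _ = refl
  none z z∈ true  p = contradiction (trans (cong ℤ.∣_∣ eq) (ℤₚ.abs-* (+ 4) q)) (h ℤ.∣ q ∣)
    where
    q = quad klein (preimage z)
    eq : + m ≡ + 4 ℤ.* q
    eq = trans (sym (Lattice.∈-shell⁻ ℒ z∈)) (trans (cong (quad klein) (sym (p _))) (quad-M (preimage z)))

-- Hooks and first-column hook lengths.

Decreasing : List ℕ → Set
Decreasing = AllPairs ℕ._≥_

conj-∷-< : ∀ {j} x xs → j < x → conjPart (x ∷ xs) j ≡ suc (conjPart xs j)
conj-∷-< {j} x xs j<x = cong length (Listₚ.filter-accept (λ x → T? (j <ᵇ x)) {x = x} {xs = xs} (ℕₚ.<⇒<ᵇ j<x))

conj-∷-≥ : ∀ {j} x xs → x ≤ j → conjPart (x ∷ xs) j ≡ conjPart xs j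
conj-∷-≥ {j} x xs x≤j = cong length (Listₚ.filter-reject (λ x → T? (j <ᵇ x)) {x = x} {xs = xs}
  (λ t → ℕₚ.≤⇒≯ x≤j (ℕₚ.<ᵇ⇒< j x t)))

conj-zero : ∀ {j xs} → All (ℕ._≤ j) xs → conjPart xs j ≡ 0
conj-zero []                = refl
conj-zero {xs = x ∷ xs} (h ∷ hs) = trans (conj-∷-≥ x xs h) (conj-zero hs)

conj≤length : ∀ xs j → conjPart xs j ≤ length xs
conj≤length xs j = Listₚ.length-filter (λ x → T? (j <ᵇ x)) xs

conj-++ : ∀ {j} (pre : List ℕ) {xs} → All (j ℕ.<_) pre → conjPart (pre ++ xs) j ≡ length pre + conjPart xs j
conj-++ []        []       = refl
conj-++ (p ∷ pre) {xs} (h ∷ hs) = trans (conj-∷-< p (pre ++ xs) h) (cong suc (conj-++ pre hs))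

-- Hooks are read off row by row: the leg of a cell of the first row is a conjugate part of the
-- remaining rows, so row indices disappear.
Hook : ℕ → List ℕ → Set
Hook t []       = ⊥
Hook t (x ∷ xs) = (∃ λ j → j < x × (x ∸ suc j) + conjPart xs j + 1 ≡ t) ⊎ Hook t xs

above : ∀ pre {x xs} → Decreasing (pre ++ x ∷ xs) → All (x ℕ.≤_) pre
above []        d        = []
above (p ∷ pre) (h ∷ d)  = All.lookup h (Anyₚ.++⁺ʳ pre (here refl)) ∷ above pre d

module _ (t : ℕ) where

  private
    test : ℕ → Bool
    test h = h ≡ᵇ t

    cell : List ℕ → ℕ → ℕ → ℕ → ℕ
    cell l i x j = (x ∸ suc j) + (conjPart l j ∸ suc i) + 1

    cell-value : ∀ {l x j} pre xs → Decreasing l → l ≡ pre ++ x ∷ xs → j < x →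
      cell l (length pre) x j ≡ (x ∸ suc j) + conjPart xs j + 1
    cell-value {x = x} {j} pre xs d refl j<x = cong (λ k → (x ∸ suc j) + k + 1)
      (trans (cong (ℕ._∸ suc (length pre)) (trans (conj-++ pre (All.map (ℕₚ.<-≤-trans j<x) (above pre d)))
        (trans (cong (length pre ℕ.+_) (conj-∷-< x xs j<x)) (ℕₚ.+-suc (length pre) (conjPart xs j)))))
        (ℕₚ.m+n∸m≡n (length pre) (conjPart xs j)))

    shift : ∀ {l : List ℕ} pre x xs → l ≡ pre ++ x ∷ xs → l ≡ (pre ++ x ∷ []) ++ xs
    shift pre x xs e = trans e (sym (Listₚ.++-assoc pre (x ∷ []) xs))

    shift-index : ∀ (g : ℕ → ℕ) (pre : List ℕ) x → (∀ i → g i ≡ length pre + i) → ∀ i → g (suc i) ≡ length (pre ++ x ∷ []) + i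
    shift-index g pre x h i = trans (h (suc i)) (trans (ℕₚ.+-suc (length pre) i)
      (cong (ℕ._+ i) (trans (ℕₚ.+-comm 1 (length pre)) (sym (Listₚ.length-++ pre)))))

  -- `F` stands for the anonymous pattern-matching function inside `hookLengths`, and `F-def` is its
  -- equation.
  module _ (l : List ℕ) (d : Decreasing l) (F : ℕ × ℕ → List ℕ)
    (F-def : ∀ i x → F (i , x) ≡ List.map (λ j → (x ∸ suc j) + (conjPart l j ∸ suc i) + 1) (List.upTo x)) where

    -- The induction is on a suffix of `l`; `g` supplies the row indices, which start at the length
    -- of the prefix.
    any⇒Hook : ∀ pre suf g → l ≡ pre ++ suf → (∀ i → g i ≡ length pre + i) →
      Any (T ∘ test) (List.concatMap F (List.zip (List.applyUpTo g (length suf)) suf)) → Hook t suf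
    any⇒Hook pre (x ∷ xs) g e h a with Anyₚ.++⁻ (F (g 0 , x)) a
    ... | inj₂ a′ = inj₂ (any⇒Hook (pre ++ x ∷ []) xs (g ∘ suc) (shift pre x xs e) (shift-index g pre x h) a′)
    ... | inj₁ a′ with find (Anyₚ.map⁻ (subst (Any (T ∘ test)) (F-def (g 0) x) a′))
    ...   | j , j∈ , p with ∈-applyUpTo⁻ (λ i → i) j∈
    ...     | _ , j<x , refl = inj₁ (j , j<x , trans (sym (cell-value pre xs d e j<x))
                (trans (cong (λ i → cell l i x j) (sym (trans (h 0) (ℕₚ.+-identityʳ _)))) (ℕₚ.≡ᵇ⇒≡ _ t p)))

    Hook⇒any : ∀ pre suf g → l ≡ pre ++ suf → (∀ i → g i ≡ length pre + i) →
      Hook t suf → Any (T ∘ test) (List.concatMap F (List.zip (List.applyUpTo g (length suf)) suf))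
    Hook⇒any pre (x ∷ xs) g e h (inj₂ hk) = Anyₚ.++⁺ʳ (F (g 0 , x))
      (Hook⇒any (pre ++ x ∷ []) xs (g ∘ suc) (shift pre x xs e) (shift-index g pre x h) hk)
    Hook⇒any pre (x ∷ xs) g e h (inj₁ (j , j<x , p)) = Anyₚ.++⁺ˡ (subst (Any (T ∘ test)) (sym (F-def (g 0) x))
      (Anyₚ.map⁺ (Anyₚ.applyUpTo⁺ (λ i → i) (ℕₚ.≡⇒≡ᵇ _ t
        (trans (cong (λ i → cell l i x j) (trans (h 0) (ℕₚ.+-identityʳ _))) (trans (cell-value pre xs d e j<x) p))) j<x)))

  isCore⇒¬Hook : ∀ l → Decreasing l → T (isCore t l) → ¬ Hook t l
  isCore⇒¬Hook l d c hk = excluded (any test (hookLengths l)) c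
    (Anyₚ.any⁺ test (Hook⇒any l d _ (λ i x → refl) [] l (λ i → i) refl (λ i → refl) hk))
    where
    excluded : ∀ b → T (not b) → ¬ T b
    excluded false _ ()

  ¬Hook⇒isCore : ∀ l → Decreasing l → ¬ Hook t l → T (isCore t l)
  ¬Hook⇒isCore l d nh = T-not (any test (hookLengths l))
    (λ a → nh (any⇒Hook l d _ (λ i x → refl) [] l (λ i → i) refl (λ i → refl) (Anyₚ.any⁻ test (hookLengths l) a)))
    where
    T-not : ∀ b → ¬ T b → T (not b)
    T-not true  f = contradiction _ f
    T-not false f = _

-- the first column hook lengths
beta : List ℕ → List ℕ
beta []       = []
beta (x ∷ xs) = x + length xs ∷ beta xs

-- gap xs 0 < gap xs 1 < … are the numbers missing from beta xs.
gap : List ℕ → ℕ → ℕ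
gap xs j = j + (length xs ∸ conjPart xs j)

gap-∷-< : ∀ {j} x xs → j < x → gap (x ∷ xs) j ≡ gap xs j
gap-∷-< {j} x xs j<x = cong (λ k → j + (suc (length xs) ∸ k)) (conj-∷-< x xs j<x)

gap-large : ∀ {j xs} → All (ℕ._≤ j) xs → gap xs j ≡ j + length xs
gap-large {j} {xs} h = cong (λ k → j + (length xs ∸ k)) (conj-zero h)

≥⇒All≤ : ∀ {x j : ℕ} {xs} → x ≤ j → All (x ℕ.≥_) xs → All (ℕ._≤ j) xs
≥⇒All≤ x≤j = All.map (λ y≤x → ℕₚ.≤-trans y≤x x≤j)

beta-< : ∀ {y} xs → All (y ℕ.≥_) xs → All (ℕ._< y + length xs) (beta xs)
beta-< []       []       = []
beta-< {y} (x ∷ xs) (h ∷ hs) = subst (x + length xs ℕ.<_) (sym (ℕₚ.+-suc y (length xs))) (ℕ.s≤s (ℕₚ.+-monoˡ-≤ (length xs) h))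
  ∷ All.map (λ b< → ℕₚ.<-trans b< (ℕₚ.+-monoʳ-< y ℕₚ.≤-refl)) (beta-< xs hs)

beta-desc : ∀ {xs} → Decreasing xs → AllPairs ℕ._>_ (beta xs)
beta-desc []            = []
beta-desc {x ∷ xs} (h ∷ d) = beta-< xs h ∷ beta-desc d

gap∉beta : ∀ {xs} → Decreasing xs → ∀ j → gap xs j ∉ beta xs
gap∉beta {x ∷ xs} (h ∷ d) j i with j ℕ.<? x
... | yes j<x = off (subst (_∈ beta (x ∷ xs)) (gap-∷-< x xs j<x) i)
  where
  off : gap xs j ∉ beta (x ∷ xs)
  off (here e)  = ℕₚ.<-irrefl e (ℕₚ.≤-<-trans (ℕₚ.+-monoʳ-≤ j (ℕₚ.m∸n≤m (length xs) (conjPart xs j))) (ℕₚ.+-monoˡ-< (length xs) j<x))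
  off (there k) = gap∉beta d j k
... | no j≮x = off (subst (_∈ beta (x ∷ xs)) (gap-large (ℕₚ.≮⇒≥ j≮x ∷ ≥⇒All≤ (ℕₚ.≮⇒≥ j≮x) h)) i)
  where
  big : x + length xs < j + suc (length xs)
  big = ℕₚ.+-mono-≤-< (ℕₚ.≮⇒≥ j≮x) ℕₚ.≤-refl
  off : j + suc (length xs) ∉ beta (x ∷ xs)
  off (here e)  = ℕₚ.<-irrefl (sym e) big
  off (there k) = ℕₚ.<-asym big (All.lookup (beta-< xs h) k)

∉beta⇒gap : ∀ {xs} → Decreasing xs → ∀ k → k ∉ beta xs → ∃ λ j → k ≡ gap xs j
∉beta⇒gap []      k k∉ = k , sym (ℕₚ.+-identityʳ k)
∉beta⇒gap {x ∷ xs} (h ∷ d) k k∉ with ∉beta⇒gap d k (k∉ ∘ there)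
... | j , e with j ℕ.<? x
...   | yes j<x = j , trans e (sym (gap-∷-< x xs j<x))
...   | no j≮x with trans e (gap-large (≥⇒All≤ (ℕₚ.≮⇒≥ j≮x) h))
...     | e′ with ℕₚ.m≤n⇒m<n∨m≡n (ℕₚ.≮⇒≥ j≮x)
...       | inj₂ refl = contradiction (here e′) k∉
...       | inj₁ x<j@(ℕ.s≤s {n = i} x≤i) = i , trans e′ (sym (trans (gap-large (x≤i ∷ ≥⇒All≤ x≤i h)) (ℕₚ.+-suc i (length xs))))

-- Flushness of the 7-abacus: with a bead b ≥ 7 there is a bead b - 7. In a descending list that
-- bead lies in the tail.
Closed : List ℕ → Set
Closed []       = ⊤
Closed (b ∷ bs) = (∀ k → b ≡ 7 + k → k ∈ bs) × Closed bs

private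
  -- The hook lengths of the first row are the differences between its bead and the gaps below it.
  -- Hence there is no hook of length 7 exactly when b - 7 is never a gap.
  hook-gap : ∀ {x j} xs → j < x →
    x + length xs ≡ ((x ∸ suc j) + conjPart xs j + 1) + gap xs j
  hook-gap {x} {j} xs j<x = trans (cong₂ ℕ._+_ (sym (ℕₚ.m+[n∸m]≡n j<x)) (sym (ℕₚ.m+[n∸m]≡n (conj≤length xs j))))
    (lem j (x ∸ suc j) (conjPart xs j) (length xs ∸ conjPart xs j))
    where
    lem : ∀ j a c b → suc j + a + (c + b) ≡ (a + c + 1) + (j + b)
    lem = solveℕ

¬Hook⇒Closed : ∀ {xs} → Decreasing xs → ¬ Hook 7 xs → Closed (beta xs)
¬Hook⇒Closed []                 nh = tt
¬Hook⇒Closed {x ∷ xs} (h ∷ d) nh = first , ¬Hook⇒Closed d (nh ∘ inj₂)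
  where
  first : ∀ k → x + length xs ≡ 7 + k → k ∈ beta xs
  first k e with k ∈? beta xs
  ... | yes k∈ = k∈
  ... | no k∉ with ∉beta⇒gap d k k∉
  ...   | j , refl with j ℕ.<? x
  ...     | yes j<x = contradiction (inj₁ (j , j<x , ℕₚ.+-cancelʳ-≡ (gap xs j) _ 7 (trans (sym (hook-gap xs j<x)) e))) nh
  -- Columns beyond the first row have gaps at or above the bead, whereas k is 7 below it.
  ...     | no j≮x = contradiction (ℕₚ.<-irrefl e (ℕ.s≤s (ℕₚ.≤-trans
              (ℕₚ.≤-trans (ℕₚ.+-monoˡ-≤ (length xs) (ℕₚ.≮⇒≥ j≮x)) (ℕₚ.≤-reflexive (sym (gap-large (≥⇒All≤ (ℕₚ.≮⇒≥ j≮x) h)))))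
              (ℕₚ.m≤n+m (gap xs j) 6)))) (λ ())

Closed⇒¬Hook : ∀ {xs} → Decreasing xs → Closed (beta xs) → ¬ Hook 7 xs
Closed⇒¬Hook (h ∷ d) (_ , c) (inj₂ hk) = Closed⇒¬Hook d c hk
Closed⇒¬Hook {x ∷ xs} (h ∷ d) (f , c) (inj₁ (j , j<x , e)) =
  gap∉beta d j (f (gap xs j) (trans (hook-gap xs j<x) (cong (ℕ._+ gap xs j) e)))

-- The 7-abacus: closed sets and the numbers of beads on the runners.

Descending : List ℕ → Set
Descending = AllPairs ℕ._>_

runner : ℕ → List ℕ → ℕ
runner j []       = 0
runner j (b ∷ bs) = ind (b % 7 ≡ᵇ j) + runner j bs

runner-hit : ∀ {b j} bs → b % 7 ≡ j → runner j (b ∷ bs) ≡ suc (runner j bs)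
runner-hit {b} bs refl = cong (ℕ._+ runner (b % 7) bs) (ind-refl (b % 7))
  where
  ind-refl : ∀ n → ind (n ≡ᵇ n) ≡ 1
  ind-refl zero    = refl
  ind-refl (suc n) = ind-refl n

runner-miss : ∀ {b j} bs → b % 7 ≢ j → runner j (b ∷ bs) ≡ runner j bs
runner-miss {b} {j} bs ne = cong (ℕ._+ runner j bs) (ind-false (b % 7 ≡ᵇ j) (ne ∘ ℕₚ.≡ᵇ⇒≡ _ j))

position : ∀ j i → j < 7 → (j + i * 7) % 7 ≡ j
position j i j<7 = trans ([m+kn]%n≡m%n j i 7) (m<n⇒m%n≡m j<7)

split7 : ∀ x → x ≡ x % 7 + (x / 7) * 7
split7 x = m≡m%n+[m/n]*n x 7

index : ∀ j i → j < 7 → (j + i * 7) / 7 ≡ i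
index j i j<7 = ℕₚ.*-cancelʳ-≡ _ i 7 (ℕₚ.+-cancelˡ-≡ j _ _ (trans
  (cong (ℕ._+ (j + i * 7) / 7 * 7) (sym (position j i j<7))) (sym (split7 (j + i * 7)))))

-- In a closed set the elements of each class occupy an initial segment.
mutual
  ∈⇒<runner : ∀ {bs} → Descending bs → Closed bs → ∀ j i → j < 7 → j + i * 7 ∈ bs → i < runner j bs
  ∈⇒<runner {b ∷ bs} (h ∷ d) (f , c) j i j<7 (here e) =
    subst (i ℕ.<_) (sym (runner-hit {b} bs class-b)) (ℕₚ.≤-reflexive (cong suc i≡))
    where
    class-b : b % 7 ≡ j
    class-b = trans (cong (_% 7) (sym e)) (position j i j<7)
    i≡ : i ≡ runner j bs
    i≡ = head-index (h ∷ d) (f , c) j i j<7 (sym e)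
  ∈⇒<runner {b ∷ bs} (h ∷ d) (f , c) j i j<7 (there k) =
    ℕₚ.<-≤-trans (∈⇒<runner d c j i j<7 k) (ℕₚ.m≤n+m (runner j bs) _)

  <runner⇒∈ : ∀ {bs} → Descending bs → Closed bs → ∀ j i → j < 7 → i < runner j bs → j + i * 7 ∈ bs
  <runner⇒∈ {b ∷ bs} (h ∷ d) (f , c) j i j<7 i< with b % 7 ℕ.≟ j
  ... | no ne = there (<runner⇒∈ d c j i j<7 (subst (i ℕ.<_) (runner-miss {b} bs ne) i<))
  ... | yes e with ℕₚ.m≤n⇒m<n∨m≡n (ℕ.s≤s⁻¹ (subst (i ℕ.<_) (runner-hit {b} bs e) i<))
  ...   | inj₁ i<r = there (<runner⇒∈ d c j i j<7 i<r)
  ...   | inj₂ refl = here (sym (trans b≡ (cong (λ q → j + q * 7) (head-index (h ∷ d) (f , c) j (b / 7) j<7 b≡))))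
    where
    b≡ : b ≡ j + (b / 7) * 7
    b≡ = trans (m≡m%n+[m/n]*n b 7) (cong (ℕ._+ (b / 7) * 7) e)

  head-index : ∀ {b bs} → Descending (b ∷ bs) → Closed (b ∷ bs) → ∀ j i → j < 7 → b ≡ j + i * 7 → i ≡ runner j bs
  head-index {b} {bs} (h ∷ d) (f , c) j i j<7 e = ℕₚ.≤-antisym (low i e) (ℕₚ.≮⇒≥ high)
    where
    low : ∀ i → b ≡ j + i * 7 → i ≤ runner j bs
    low zero    e = ℕ.z≤n
    low (suc i) e = ∈⇒<runner d c j i j<7 (f (j + i * 7) (trans e (lem j i)))
      where
      lem : ∀ j i → j + (7 + i * 7) ≡ 7 + (j + i * 7)
      lem = solveℕ
    high : ¬ i < runner j bs
    high i< = ℕₚ.<-irrefl refl (All.lookup h (subst (_∈ bs) (sym e) (<runner⇒∈ d c j i j<7 i<)))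

descending-ext : ∀ {as bs} → Descending as → Descending bs → (∀ {x} → x ∈ as → x ∈ bs) → (∀ {x} → x ∈ bs → x ∈ as) → as ≡ bs
descending-ext {[]}     {[]}     _ _ _ _ = refl
descending-ext {[]}     {b ∷ bs} _ _ _ g with () ← g (here refl)
descending-ext {a ∷ as} {[]}     _ _ f _ with () ← f (here refl)
descending-ext {a ∷ as} {b ∷ bs} (h ∷ d) (k ∷ e) f g with same
  where
  same : a ≡ b
  same with f (here refl) | g (here refl)
  ... | here p  | _       = p
  ... | there _ | here q  = sym q
  ... | there i | there j = contradiction (All.lookup h j) (ℕₚ.<-asym (All.lookup k i))
... | refl = cong (a ∷_) (descending-ext d e (rest h f) (rest k g))
  where
  rest : ∀ {a as bs} → All (a ℕ.>_) as → (∀ {x} → x ∈ a ∷ as → x ∈ a ∷ bs) → ∀ {x} → x ∈ as → x ∈ bs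
  rest h f i with f (there i)
  ... | here refl = contradiction (All.lookup h i) (ℕₚ.<-irrefl refl)
  ... | there j   = j

runner-ext : ∀ {as bs} → Descending as → Closed as → Descending bs → Closed bs →
  (∀ j → j < 7 → runner j as ≡ runner j bs) → as ≡ bs
runner-ext {as} {bs} da ca db cb e = descending-ext da db (go da ca db cb e) (go db cb da ca (λ j j<7 → sym (e j j<7)))
  where
  go : ∀ {as bs} → Descending as → Closed as → Descending bs → Closed bs →
    (∀ j → j < 7 → runner j as ≡ runner j bs) → ∀ {x} → x ∈ as → x ∈ bs
  go {as} {bs} da ca db cb e {x} x∈ = subst (_∈ bs) (sym (split7 x)) (<runner⇒∈ db cb (x % 7) (x / 7) (m%n<n x 7)
    (subst (x / 7 ℕ.<_) (e (x % 7) (m%n<n x 7)) (∈⇒<runner da ca (x % 7) (x / 7) (m%n<n x 7) (subst (_∈ as) (split7 x) x∈))))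

module _ (c : ℕ → ℕ) where

  private
    keep? : ∀ b → _
    keep? b = b / 7 ℕ.<? c (b % 7)

  -- The flush configuration with `c j` beads on runner j, cut off at n; it inverts `runner` when n
  -- exceeds all of these positions.
  fill : ℕ → List ℕ
  fill n = List.filter keep? (List.downFrom n)

  fill-descending : ∀ n → Descending (fill n)
  fill-descending n = AllPairsₚ.filter⁺ keep? (AllPairsₚ.applyDownFrom⁺₁ (λ i → i) n (λ j<i _ → j<i))

  ∈-fill : ∀ {n} j i → j < 7 → j + i * 7 < n → i < c j → j + i * 7 ∈ fill n
  ∈-fill {n} j i j<7 <n i<c = ∈-filter⁺ keep? (∈-downFrom⁺ <n)
    (subst₂ (λ q r → q < c r) (sym (index j i j<7)) (sym (position j i j<7)) i<c)

  fill-∈ : ∀ {n} x → x ∈ fill n → x < n × x / 7 < c (x % 7)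
  fill-∈ {n} x x∈ with ∈-filter⁻ keep? {xs = List.downFrom n} x∈
  ... | x∈′ , k = ∈-downFrom⁻ x∈′ , k

  fill-closed : ∀ n → Closed (fill n)
  fill-closed zero    = tt
  fill-closed (suc n) = step (keep? n)
    where
    lem : ∀ r q → 7 + (r + q * 7) ≡ r + suc q * 7
    lem = solveℕ
    below : ∀ m → (7 + m) / 7 < c ((7 + m) % 7) → m ∈ fill (7 + m)
    below m k = subst (_∈ fill (7 + m)) (sym (split7 m)) (∈-fill (m % 7) (m / 7) (m%n<n m 7)
      (subst (ℕ._< 7 + m) (split7 m) (ℕₚ.m<n+m m (ℕ.s≤s ℕ.z≤n)))
      (ℕₚ.<-trans ℕₚ.≤-refl (subst₂ (λ q r → q < c r) quot rem k)))
      where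
      7+m : 7 + m ≡ m % 7 + suc (m / 7) * 7
      7+m = trans (cong (7 ℕ.+_) (split7 m)) (lem (m % 7) (m / 7))
      rem : (7 + m) % 7 ≡ m % 7
      rem = trans (cong (_% 7) 7+m) (position (m % 7) (suc (m / 7)) (m%n<n m 7))
      quot : (7 + m) / 7 ≡ suc (m / 7)
      quot = trans (cong (_/ 7) 7+m) (index (m % 7) (suc (m / 7)) (m%n<n m 7))
    step : Dec (n / 7 < c (n % 7)) → Closed (fill (suc n))
    step (no  k) = subst Closed (sym (Listₚ.filter-reject keep? {x = n} {xs = List.downFrom n} k)) (fill-closed n)
    step (yes k) = subst Closed (sym (Listₚ.filter-accept keep? {x = n} {xs = List.downFrom n} k))
      ((λ { m refl → below m k }) , fill-closed n)

  runner-fill : ∀ n → (∀ j i → j < 7 → i < c j → j + i * 7 < n) → ∀ j → j < 7 → runner j (fill n) ≡ c j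
  runner-fill n big j j<7 = ℕₚ.≤-antisym (ℕₚ.≮⇒≥ no-more) (ℕₚ.≮⇒≥ no-less)
    where
    no-more : ¬ c j < runner j (fill n)
    no-more h = ℕₚ.<-irrefl refl (subst₂ (λ q r → q < c r) (index j (c j) j<7) (position j (c j) j<7)
      (proj₂ (fill-∈ {n} _ (<runner⇒∈ (fill-descending n) (fill-closed n) j (c j) j<7 h))))
    no-less : ¬ runner j (fill n) < c j
    no-less h = ℕₚ.<-irrefl refl (∈⇒<runner (fill-descending n) (fill-closed n) j (runner j (fill n)) j<7
      (∈-fill j (runner j (fill n)) j<7 (big j _ j<7 h) h))

-- The list of partitions, and recovering a partition from its beads.

Positive : List ℕ → Set
Positive = All (1 ℕ.≤_)

nonincreasing⇒Decreasing : ∀ l → T (nonincreasing l) → Decreasing l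
nonincreasing⇒Decreasing []           t = []
nonincreasing⇒Decreasing (x ∷ [])     t = [] ∷ []
nonincreasing⇒Decreasing (x ∷ y ∷ xs) t
  with nonincreasing⇒Decreasing (y ∷ xs) (proj₂ (Equivalence.to (T-∧ {y ≤ᵇ x}) t))
... | h ∷ d = (y≤x ∷ All.map (λ z≤y → ℕₚ.≤-trans z≤y y≤x) h) ∷ h ∷ d
  where
  y≤x : y ≤ x
  y≤x = ℕₚ.≤ᵇ⇒≤ y x (proj₁ (Equivalence.to (T-∧ {y ≤ᵇ x}) t))

Decreasing⇒nonincreasing : ∀ l → Decreasing l → T (nonincreasing l)
Decreasing⇒nonincreasing []           d = _
Decreasing⇒nonincreasing (x ∷ [])     d = _
Decreasing⇒nonincreasing (x ∷ y ∷ xs) ((h ∷ _) ∷ d) =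
  Equivalence.from (T-∧ {y ≤ᵇ x}) (ℕₚ.≤⇒≤ᵇ h , Decreasing⇒nonincreasing (y ∷ xs) d)

listsOf-product : ∀ k b → listsOf (suc k) b ≡ List.cartesianProductWith _∷_ (List.map suc (List.upTo b)) (listsOf k b)
listsOf-product k b = go (List.map suc (List.upTo b))
  where
  go : ∀ xs → List.concatMap (λ x → List.map (x ∷_) (listsOf k b)) xs ≡ List.cartesianProductWith _∷_ xs (listsOf k b)
  go []       = refl
  go (x ∷ xs) = cong (List.map (x ∷_) (listsOf k b) ++_) (go xs)

listsOf-unique : ∀ k b → Unique (listsOf k b)
listsOf-unique zero    b = [] ∷ []
listsOf-unique (suc k) b = subst Unique (sym (listsOf-product k b))
  (Uniqueₚ.cartesianProductWith⁺ _∷_ (λ { refl → refl , refl })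
    (Uniqueₚ.map⁺ ℕₚ.suc-injective (Uniqueₚ.upTo⁺ b)) (listsOf-unique k b))

∈-listsOf⁻ : ∀ k b {l} → l ∈ listsOf k b → length l ≡ k × Positive l
∈-listsOf⁻ zero    b (here refl) = refl , []
∈-listsOf⁻ (suc k) b l∈ with ∈-cartesianProductWith⁻ _∷_ (List.map suc (List.upTo b)) (listsOf k b)
  (subst (_ ∈_) (listsOf-product k b) l∈)
... | x , xs , x∈ , xs∈ , refl with ∈-map⁻ suc x∈ | ∈-listsOf⁻ k b xs∈
...   | i , _ , refl | len , pos = cong suc len , ℕ.s≤s ℕ.z≤n ∷ pos

∈-listsOf⁺ : ∀ b {l} → Positive l → All (ℕ._≤ b) l → l ∈ listsOf (length l) b
∈-listsOf⁺ b []                []        = here refl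
∈-listsOf⁺ b {suc x ∷ xs} (_ ∷ pos) (h ∷ hs) = subst (_ ∈_) (sym (listsOf-product (length xs) b))
  (∈-cartesianProductWith⁺ _∷_ (∈-map⁺ suc (∈-upTo⁺ h)) (∈-listsOf⁺ b pos hs))

candidates : ℕ → List (List ℕ)
candidates n = List.concatMap (λ k → listsOf k n) (List.upTo (suc n))

candidates-unique : ∀ n → Unique (candidates n)
candidates-unique n = Uniqueₚ.concat⁺ {xss = List.map (λ k → listsOf k n) ks}
    (Allₚ.map⁺ {P = Unique} {f = λ k → listsOf k n} (All.tabulate {xs = ks} (λ {k} _ → listsOf-unique k n)))
    (AllPairsₚ.map⁺ {f = λ k → listsOf k n} (AllPairs.map (λ {i} {j} i≢j {l} (l∈ , l∈′) →
      i≢j (trans (sym (proj₁ (∈-listsOf⁻ i n l∈))) (proj₁ (∈-listsOf⁻ j n l∈′)))) (Uniqueₚ.upTo⁺ (suc n))))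
  where
  ks : List ℕ
  ks = List.upTo (suc n)

partitions-unique : ∀ n → Unique (partitions n)
partitions-unique n = Uniqueₚ.filter⁺ (λ l → T? (isPartitionOf n l)) (candidates-unique n)

length≤sum : ∀ {l} → Positive l → length l ≤ sum l
length≤sum []        = ℕ.z≤n
length≤sum (h ∷ pos) = ℕₚ.+-mono-≤ h (length≤sum pos)

entries≤sum : ∀ l → All (ℕ._≤ sum l) l
entries≤sum []       = []
entries≤sum (x ∷ xs) = ℕₚ.m≤m+n x (sum xs) ∷ All.map (λ h → ℕₚ.≤-trans h (ℕₚ.m≤n+m (sum xs) x)) (entries≤sum xs)

record Partition (n : ℕ) (l : List ℕ) : Set where
  field
    decreasing : Decreasing l
    positive   : Positive l
    size       : sum l ≡ n

∈-partitions⁻ : ∀ {n l} → l ∈ partitions n → Partition n l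
∈-partitions⁻ {n} {l} l∈ with ∈-filter⁻ (λ l → T? (isPartitionOf n l)) {xs = candidates n} l∈
... | l∈′ , t with Equivalence.to (T-∧ {nonincreasing l}) t | ∈-concat⁻′ (List.map (λ k → listsOf k n) (List.upTo (suc n))) l∈′
...   | t₁ , t₂ | ls , l∈ls , ls∈ with ∈-map⁻ (λ k → listsOf k n) {xs = List.upTo (suc n)} ls∈
...     | k , _ , refl = record
  { decreasing = nonincreasing⇒Decreasing l t₁ ; positive = proj₂ (∈-listsOf⁻ k n l∈ls) ; size = ℕₚ.≡ᵇ⇒≡ _ n t₂ }

∈-partitions⁺ : ∀ {n l} → Partition n l → l ∈ partitions n
∈-partitions⁺ {n} {l} p = ∈-filter⁺ (λ l → T? (isPartitionOf n l))
    (∈-concat⁺′ {xss = List.map (λ k → listsOf k n) (List.upTo (suc n))} (∈-listsOf⁺ n positive (subst (λ m → All (ℕ._≤ m) l) size (entries≤sum l)))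
      (∈-map⁺ (λ k → listsOf k n) (∈-upTo⁺ (ℕ.s≤s (subst (length l ℕ.≤_) size (length≤sum positive))))))
    (Equivalence.from (T-∧ {nonincreasing l}) (Decreasing⇒nonincreasing l decreasing , ℕₚ.≡⇒≡ᵇ _ n size))
  where open Partition p

beta-length : ∀ xs → length (beta xs) ≡ length xs
beta-length []       = refl
beta-length (x ∷ xs) = cong suc (beta-length xs)

beta-injective : ∀ xs ys → beta xs ≡ beta ys → xs ≡ ys
beta-injective []       []       e = refl
beta-injective (x ∷ xs) (y ∷ ys) e with Listₚ.∷-injective e
... | e₁ , e₂ with beta-injective xs ys e₂
...   | refl = cong (_∷ xs) (ℕₚ.+-cancelʳ-≡ (length xs) x y e₁)

beta-positive : ∀ {xs} → Positive xs → Positive (beta xs)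
beta-positive []                      = []
beta-positive {x ∷ xs} (h ∷ pos) = ℕₚ.≤-trans h (ℕₚ.m≤m+n x (length xs)) ∷ beta-positive pos

unbeta : List ℕ → List ℕ
unbeta []       = []
unbeta (b ∷ bs) = b ∸ length bs ∷ unbeta bs

unbeta-length : ∀ bs → length (unbeta bs) ≡ length bs
unbeta-length []       = refl
unbeta-length (b ∷ bs) = cong suc (unbeta-length bs)

length<head : ∀ {b bs} → Descending (b ∷ bs) → Positive (b ∷ bs) → length bs < b
length<head {bs = []}     _             (p ∷ _)   = p
length<head {bs = _ ∷ _} ((h ∷ _) ∷ d) (_ ∷ pos) = ℕₚ.<-≤-trans (ℕ.s≤s (length<head d pos)) h

beta-unbeta : ∀ {bs} → Descending bs → Positive bs → beta (unbeta bs) ≡ bs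
beta-unbeta []            _          = refl
beta-unbeta {b ∷ bs} (h ∷ d) (p ∷ pos) = cong₂ _∷_
  (trans (cong (b ∸ length bs ℕ.+_) (unbeta-length bs)) (ℕₚ.m∸n+n≡m (ℕₚ.<⇒≤ (length<head (h ∷ d) (p ∷ pos)))))
  (beta-unbeta d pos)

unbeta-positive : ∀ {bs} → Descending bs → Positive bs → Positive (unbeta bs)
unbeta-positive []      _         = []
unbeta-positive (h ∷ d) (p ∷ pos) = ℕₚ.m<n⇒0<n∸m (length<head (h ∷ d) (p ∷ pos)) ∷ unbeta-positive d pos

unbeta-decreasing : ∀ {bs} → Descending bs → Positive bs → Decreasing (unbeta bs)
unbeta-decreasing {[]}         _              _          = []
unbeta-decreasing {b ∷ []}     _              _          = [] ∷ []
unbeta-decreasing {b ∷ c ∷ bs} ((h ∷ _) ∷ d) (p ∷ pos) with unbeta-decreasing d pos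
... | h′ ∷ d′ = (first ∷ All.map (λ z≤ → ℕₚ.≤-trans z≤ first) h′) ∷ h′ ∷ d′
  where
  first : c ∸ length bs ≤ b ∸ suc (length bs)
  first = ℕₚ.∸-monoˡ-≤ (suc (length bs)) h

-- From the abacus to vectors of slope 1.

relative : ∀ {k} → ℤ^ 6 → Mat k 6 → Mat k 6
relative x₀ = map (λ r → r ⊕ −1 ⊙ x₀)

relative-⊛ : ∀ {k} x₀ (R : Mat k 6) z → relative x₀ R ⊛ z ≡ map (ℤ._- dot x₀ z) (R ⊛ z)
relative-⊛ x₀ []      z = refl
relative-⊛ x₀ (r ∷ R) z = cong₂ _∷_
  (trans (dot-⊕ˡ r (-[1+ 0 ] ⊙ x₀) z) (cong (λ t → dot r z ℤ.+ t) (trans (dot-⊙ˡ -[1+ 0 ] x₀ z) (ℤₚ.-1*i≡-i _))))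
  (relative-⊛ x₀ R z)

-- Differences from the first coordinate. On the vector of a core they are the first free positions
-- of runners 1 to 6, relative to runner 0, which is empty.
𝐃 : Mat 6 6
𝐃 = relative (head X) (tail X)

-- Row k solves 𝐃 s = 7 eₖ, so the transpose is 7 times the inverse of `𝐃`.
steps : Mat 6 6
steps = (−2 ∷ + 1 ∷ + 1 ∷ + 1 ∷ + 2 ∷ + 0 ∷ [])
      ∷ (+ 0 ∷ −1 ∷ + 0 ∷ + 0 ∷ −1 ∷ + 0 ∷ [])
      ∷ (+ 1 ∷ −1 ∷ −2 ∷ + 1 ∷ −1 ∷ + 1 ∷ [])
      ∷ (+ 1 ∷ + 1 ∷ + 1 ∷ −1 ∷ + 1 ∷ −2 ∷ [])
      ∷ (−1 ∷ + 0 ∷ −1 ∷ + 0 ∷ + 0 ∷ + 1 ∷ [])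
      ∷ (+ 0 ∷ + 0 ∷ + 1 ∷ + 0 ∷ + 1 ∷ + 0 ∷ []) ∷ []

-- the vector of slope 1 for the empty partition
z₀ : ℤ^ 6
z₀ = + 0 ∷ + 0 ∷ + 0 ∷ + 0 ∷ + 1 ∷ + 0 ∷ []

step : ℕ → ℤ^ 6
step zero    = replicate 6 (+ 0)
step (suc k) = nth k steps
  where
  nth : ∀ {n} → ℕ → Mat n 6 → ℤ^ 6
  nth k       []      = replicate 6 (+ 0)
  nth zero    (r ∷ R) = r
  nth (suc k) (r ∷ R) = nth k R

-- Adding a bead to runner k of the abacus raises the difference k by 7 and leaves the others.
vector : List ℕ → ℤ^ 6
vector []       = z₀
vector (b ∷ bs) = vector bs ⊕ step (b % 7)

abacus : List ℕ → ℤ^ 6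
abacus bs = tabulate (λ i → + (suc (toℕ i) + runner (suc (toℕ i)) bs * 7))

𝐃-step : ∀ k → 𝐃 ⊛ step k ≡ tabulate (λ i → + (ind (k ≡ᵇ suc (toℕ i)) * 7))
𝐃-step 0 = refl
𝐃-step 1 = refl
𝐃-step 2 = refl
𝐃-step 3 = refl
𝐃-step 4 = refl
𝐃-step 5 = refl
𝐃-step 6 = refl
𝐃-step (suc (suc (suc (suc (suc (suc (suc _))))))) = refl

tabulate-⊕ : ∀ {n} (f g : Fin n → ℤ) → tabulate f ⊕ tabulate g ≡ tabulate (λ i → f i ℤ.+ g i)
tabulate-⊕ {zero}  f g = refl
tabulate-⊕ {suc n} f g = cong (f zero ℤ.+ g zero ∷_) (tabulate-⊕ (f ∘ suc) (g ∘ suc))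

𝐃-vector : ∀ bs → 𝐃 ⊛ vector bs ≡ abacus bs
𝐃-vector []       = refl
𝐃-vector (b ∷ bs) = begin
  𝐃 ⊛ (vector bs ⊕ step (b % 7)) ≡⟨ ⊛-⊕ 𝐃 (vector bs) (step (b % 7)) ⟩
  𝐃 ⊛ vector bs ⊕ 𝐃 ⊛ step (b % 7) ≡⟨ cong₂ _⊕_ (𝐃-vector bs) (𝐃-step (b % 7)) ⟩
  abacus bs ⊕ tabulate (λ i → + (ind (b % 7 ≡ᵇ suc (toℕ i)) * 7))
    ≡⟨ tabulate-⊕ (λ i → + (suc (toℕ i) + runner (suc (toℕ i)) bs * 7)) (λ i → + (ind (b % 7 ≡ᵇ suc (toℕ i)) * 7)) ⟩
  tabulate (λ i → + (suc (toℕ i) + runner (suc (toℕ i)) bs * 7 + ind (b % 7 ≡ᵇ suc (toℕ i)) * 7))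
    ≡⟨ Vecₚ.tabulate-cong (λ i → cong +_ (lem (suc (toℕ i)) (runner (suc (toℕ i)) bs) (ind (b % 7 ≡ᵇ suc (toℕ i))))) ⟩
  abacus (b ∷ bs) ∎
  where
  open ≡-Reasoning
  lem : ∀ j r i → j + r * 7 + i * 7 ≡ j + (i + r) * 7
  lem = solveℕ

𝐃-injective : ∀ y z → 𝐃 ⊛ y ≡ 𝐃 ⊛ z → y ≡ z
𝐃-injective y z e = ⊙-cancel (+ 7) y z (trans (sym (inv y)) (trans (cong ((steps ᵀ) ⊛_) e) (inv z)))
  where
  inv : ∀ y → (steps ᵀ) ⊛ 𝐃 ⊛ y ≡ + 7 ⊙ y
  inv = ⊠-scalar (steps ᵀ) 𝐃 (+ 7) refl

-- Size and BG-rank in terms of the vector.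

quad-⊕ : ∀ {n} (H : Mat n n) x y → quad H (x ⊕ y) ≡ quad H x ℤ.+ dot x (polar H ⊛ y) ℤ.+ quad H y
quad-⊕ H x y = begin
  dot (x ⊕ y) (H ⊛ (x ⊕ y)) ≡⟨ cong (dot (x ⊕ y)) (⊛-⊕ H x y) ⟩
  dot (x ⊕ y) (H ⊛ x ⊕ H ⊛ y) ≡⟨ dot-⊕ˡ x y _ ⟩
  dot x (H ⊛ x ⊕ H ⊛ y) ℤ.+ dot y (H ⊛ x ⊕ H ⊛ y) ≡⟨ cong₂ ℤ._+_ (dot-⊕ʳ x (H ⊛ x) (H ⊛ y)) (dot-⊕ʳ y (H ⊛ x) (H ⊛ y)) ⟩
  (quad H x ℤ.+ dot x (H ⊛ y)) ℤ.+ (dot y (H ⊛ x) ℤ.+ quad H y)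
    ≡⟨ cong (λ t → (quad H x ℤ.+ dot x (H ⊛ y)) ℤ.+ (t ℤ.+ quad H y)) (trans (dot-comm y (H ⊛ x)) (dot-ᵀ H x y)) ⟩
  (quad H x ℤ.+ dot x (H ⊛ y)) ℤ.+ (dot x ((H ᵀ) ⊛ y) ℤ.+ quad H y)
    ≡⟨ lem (quad H x) (dot x (H ⊛ y)) (dot x ((H ᵀ) ⊛ y)) (quad H y) ⟩
  quad H x ℤ.+ (dot x (H ⊛ y) ℤ.+ dot x ((H ᵀ) ⊛ y)) ℤ.+ quad H y
    ≡⟨ cong (λ t → quad H x ℤ.+ t ℤ.+ quad H y) (trans (cong (dot x) (⊞-⊛ H (H ᵀ) y)) (dot-⊕ʳ x (H ⊛ y) ((H ᵀ) ⊛ y))) ⟨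
  quad H x ℤ.+ dot x (polar H ⊛ y) ℤ.+ quad H y ∎
  where
  open ≡-Reasoning
  lem : ∀ a b c d → (a ℤ.+ b) ℤ.+ (c ℤ.+ d) ≡ a ℤ.+ (b ℤ.+ c) ℤ.+ d
  lem = solve-∀

ones : ∀ n → ℤ^ n
ones n = replicate n (+ 1)

unit : ∀ {n} → Fin n → ℤ^ n
unit {suc n} zero    = + 1 ∷ replicate n (+ 0)
unit {suc n} (suc i) = + 0 ∷ unit i

dot-unit : ∀ {n} (i : Fin n) v → dot (unit i) v ≡ lookup v i
dot-unit zero    (a ∷ v) = trans (cong₂ ℤ._+_ (ℤₚ.*-identityˡ a) (dot-zeroˡ v)) (ℤₚ.+-identityʳ a)
dot-unit (suc i) (a ∷ v) = trans (ℤₚ.+-identityˡ _) (dot-unit i v)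

dot-ones : ∀ {n} (f : Fin n → ℕ) → dot (ones n) (tabulate (λ i → + f i)) ≡ + sum (List.tabulate f)
dot-ones {zero}  f = refl
dot-ones {suc n} f = trans (cong₂ ℤ._+_ (ℤₚ.*-identityˡ (+ f zero)) (dot-ones (f ∘ suc))) (sym (ℤₚ.pos-+ (f zero) _))

classes : List ℕ
classes = 1 ∷ 2 ∷ 3 ∷ 4 ∷ 5 ∷ 6 ∷ []

class-index : ∀ k → k ≢ 0 → k < 7 → ∃ λ (i : Fin 6) → k ≡ suc (toℕ i)
class-index zero    k≢0 k<7 = contradiction refl k≢0
class-index (suc k) k≢0 k<7 = fromℕ< (ℕ.s≤s⁻¹ k<7) , cong suc (sym (Finₚ.toℕ-fromℕ< (ℕ.s≤s⁻¹ k<7)))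

-- In a closed set, a bead on runner 0 would force a bead at position 0, but the beads are positive.
runner₀ : ∀ {bs} → Descending bs → Closed bs → Positive bs → runner 0 bs ≡ 0
runner₀ {bs} d c p with runner 0 bs in e
... | zero  = refl
... | suc n with () ← All.lookup p (<runner⇒∈ d c 0 0 (ℕ.s≤s ℕ.z≤n) (subst (0 ℕ.<_) (sym e) (ℕ.s≤s ℕ.z≤n)))

head-class : ∀ {b bs} → Descending (b ∷ bs) → Closed (b ∷ bs) → Positive (b ∷ bs) →
  ∃ λ (i : Fin 6) → b % 7 ≡ suc (toℕ i) × b ≡ suc (toℕ i) + runner (suc (toℕ i)) bs * 7
head-class {b} {bs} d c p with class-index (b % 7) nonzero (m%n<n b 7)
  where
  nonzero : b % 7 ≢ 0
  nonzero e with () ← subst (b / 7 ℕ.<_) (runner₀ d c p) (∈⇒<runner d c 0 (b / 7) (ℕ.s≤s ℕ.z≤n)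
    (here (sym (trans (split7 b) (cong (ℕ._+ b / 7 * 7) e)))))
... | i , e = i , e , trans b≡ (cong (λ q → suc (toℕ i) + q * 7)
      (head-index d c (suc (toℕ i)) (b / 7) (subst (ℕ._< 7) e (m%n<n b 7)) b≡))
  where
  b≡ : b ≡ suc (toℕ i) + b / 7 * 7
  b≡ = trans (split7 b) (cong (ℕ._+ b / 7 * 7) e)

runners-length : ∀ {bs} → Descending bs → Closed bs → Positive bs → total (λ j → runner j bs) classes ≡ length bs
runners-length {[]}     _ _ _ = refl
runners-length {b ∷ bs} (h ∷ d) (f , c) (q ∷ p) = trans (total-+ (λ j → ind (b % 7 ≡ᵇ j)) (λ j → runner j bs) classes)
  (cong₂ ℕ._+_ once (runners-length d c p))
  where
  count-class : ∀ (i : Fin 6) → total (λ j → ind (suc (toℕ i) ≡ᵇ j)) classes ≡ 1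
  count-class 0F = refl
  count-class 1F = refl
  count-class 2F = refl
  count-class 3F = refl
  count-class 4F = refl
  count-class 5F = refl
  once : total (λ j → ind (b % 7 ≡ᵇ j)) classes ≡ 1
  once with head-class (h ∷ d) (f , c) (q ∷ p)
  ... | i , e , _ = trans (cong (λ k → total (λ j → ind (k ≡ᵇ j)) classes) e) (count-class i)

abacus-sum : ∀ {bs} → Descending bs → Closed bs → Positive bs → dot (ones 6) (abacus bs) ≡ + (21 + 7 * length bs)
abacus-sum {bs} d c p = trans (dot-ones {6} (λ i → suc (toℕ i) + runner (suc (toℕ i)) bs * 7)) (cong +_
  (trans (lem (runner 1 bs) (runner 2 bs) (runner 3 bs) (runner 4 bs) (runner 5 bs) (runner 6 bs))
    (cong (λ r → 21 + 7 * r) (runners-length d c p))))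
  where
  lem : ∀ a b c d e f → 1 + a * 7 + (2 + b * 7 + (3 + c * 7 + (4 + d * 7 + (5 + e * 7
    + (6 + f * 7 + 0))))) ≡ 21 + 7 * (a + (b + (c + (d + (e + (f + 0))))))
  lem = solveℕ

-- In the differences d the form is (Σ d² - (Σ d)²/7)/14. Its polar pairing with 𝐃⁻¹(7 eᵢ) is
-- therefore dᵢ - (Σ d)/7, stated here times 7; the norm of that step is (49 - 7)/14 = 3.
step-gradient : ∀ (i : Fin 6) → + 7 ⊙ polar klein ⊛ step (suc (toℕ i)) ≡ comb (+ 7 ⊙ unit i ⊕ −1 ⊙ ones 6) 𝐃
step-gradient 0F = refl
step-gradient 1F = refl
step-gradient 2F = refl
step-gradient 3F = refl
step-gradient 4F = refl
step-gradient 5F = refl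

step-norm : ∀ (i : Fin 6) → quad klein (step (suc (toℕ i))) ≡ + 3
step-norm 0F = refl
step-norm 1F = refl
step-norm 2F = refl
step-norm 3F = refl
step-norm 4F = refl
step-norm 5F = refl

7-linear : ∀ (i : Fin 6) z → + 7 ℤ.* dot z (polar klein ⊛ step (suc (toℕ i))) ≡
  + 7 ℤ.* lookup (𝐃 ⊛ z) i ℤ.- dot (ones 6) (𝐃 ⊛ z)
7-linear i z = begin
  + 7 ℤ.* dot z (polar klein ⊛ step (suc (toℕ i))) ≡⟨ dot-⊙ʳ (+ 7) z _ ⟨
  dot z (+ 7 ⊙ polar klein ⊛ step (suc (toℕ i))) ≡⟨ cong (dot z) (step-gradient i) ⟩
  dot z (comb w 𝐃) ≡⟨ dot-comm z (comb w 𝐃) ⟩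
  dot (comb w 𝐃) z ≡⟨ dot-comb w 𝐃 z ⟩
  dot w (𝐃 ⊛ z) ≡⟨ dot-⊕ˡ (+ 7 ⊙ unit i) (-[1+ 0 ] ⊙ ones 6) (𝐃 ⊛ z) ⟩
  dot (+ 7 ⊙ unit i) (𝐃 ⊛ z) ℤ.+ dot (-[1+ 0 ] ⊙ ones 6) (𝐃 ⊛ z)
    ≡⟨ cong₂ ℤ._+_ (trans (dot-⊙ˡ (+ 7) (unit i) (𝐃 ⊛ z)) (cong (λ t → + 7 ℤ.* t) (dot-unit i (𝐃 ⊛ z))))
         (trans (dot-⊙ˡ -[1+ 0 ] (ones 6) (𝐃 ⊛ z)) (ℤₚ.-1*i≡-i _)) ⟩
  + 7 ℤ.* lookup (𝐃 ⊛ z) i ℤ.- dot (ones 6) (𝐃 ⊛ z) ∎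
  where
  open ≡-Reasoning
  w : ℤ^ 6
  w = + 7 ⊙ unit i ⊕ −1 ⊙ ones 6

lookup-abacus : ∀ bs i → lookup (abacus bs) i ≡ + (suc (toℕ i) + runner (suc (toℕ i)) bs * 7)
lookup-abacus bs = Vecₚ.lookup∘tabulate (λ i → + (suc (toℕ i) + runner (suc (toℕ i)) bs * 7))

-- A new bead b raises the form by b - (Σ d)/7 + 3. Here (Σ d)/7 is 3 plus the number of beads below
-- b, so the increase is the new part. The empty partition has norm 2.
vector-quad : ∀ {l} → Decreasing l → Positive l → Closed (beta l) → quad klein (vector (beta l)) ≡ + (2 + sum l)
vector-quad {[]}     _       _         _       = refl
vector-quad {x ∷ xs} (h ∷ d) (q ∷ pos) (f , c) = trans (quad-⊕ klein z s)
    (trans (cong₂ (λ a b → a ℤ.+ dot z (polar klein ⊛ s) ℤ.+ b) (vector-quad d pos c) norm-s)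
      (trans (lem (+ (2 + sum xs)) (dot z (polar klein ⊛ s)) (+ x) increment) (cong +_ (swap (sum xs) x))))
  where
  bs = beta xs
  b = x + length xs
  z = vector bs
  s = step (b % 7)
  desc : Descending (b ∷ bs)
  desc = beta-desc (h ∷ d)
  hc = head-class desc (f , c) (beta-positive (q ∷ pos))
  i = proj₁ hc
  norm-s : quad klein s ≡ + 3
  norm-s = trans (cong (quad klein ∘ step) (proj₁ (proj₂ hc))) (step-norm i)
  swap : ∀ n x → 2 + n + x ≡ 2 + (x + n)
  swap = solveℕ
  lem : ∀ a p x → p ℤ.+ + 3 ≡ x → a ℤ.+ p ℤ.+ + 3 ≡ a ℤ.+ x
  lem a p x e = trans (ℤₚ.+-assoc a p (+ 3)) (cong (λ t → a ℤ.+ t) e)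
  difference : lookup (𝐃 ⊛ z) i ≡ + b
  difference = trans (cong (λ v → lookup v i) (𝐃-vector bs))
    (trans (lookup-abacus bs i) (cong +_ (sym (proj₂ (proj₂ hc)))))
  total-difference : dot (ones 6) (𝐃 ⊛ z) ≡ + (21 + 7 * length xs)
  total-difference = trans (cong (dot (ones 6)) (𝐃-vector bs))
    (trans (abacus-sum (AllPairs.tail desc) c (beta-positive pos)) (cong (λ n → + (21 + 7 * n)) (beta-length xs)))
  seven : + 7 ℤ.* dot z (polar klein ⊛ s) ≡ + 7 ℤ.* + b ℤ.- + (21 + 7 * length xs)
  seven = trans (cong (λ k → + 7 ℤ.* dot z (polar klein ⊛ step k)) (proj₁ (proj₂ hc)))
    (trans (7-linear i z) (cong₂ (λ a b → + 7 ℤ.* a ℤ.- b) difference total-difference))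
  increment : dot z (polar klein ⊛ s) ℤ.+ + 3 ≡ + x
  increment = solve-for (dot z (polar klein ⊛ s)) (+ x) (+ length xs)
    (trans seven (cong₂ (λ a b → + 7 ℤ.* a ℤ.- b) (ℤₚ.pos-+ x (length xs))
      (trans (ℤₚ.pos-+ 21 (7 * length xs)) (cong (λ t → + 21 ℤ.+ t) (ℤₚ.pos-* 7 (length xs))))))
    where
    solve-for : ∀ p x n → + 7 ℤ.* p ≡ + 7 ℤ.* (x ℤ.+ n) ℤ.- (+ 21 ℤ.+ + 7 ℤ.* n) → p ℤ.+ + 3 ≡ x
    solve-for p x n e = ℤₚ.*-cancelˡ-≡ (+ 7) (p ℤ.+ + 3) x (trans (ℤₚ.*-distribˡ-+ (+ 7) p (+ 3))
      (trans (cong (ℤ._+ + 21) e) (l x n)))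
      where
      l : ∀ x n → + 7 ℤ.* (x ℤ.+ n) ℤ.- (+ 21 ℤ.+ + 7 ℤ.* n) ℤ.+ + 21 ≡ + 7 ℤ.* x
      l = solve-∀

-- The rank is 2 minus half the number of odd coordinates. An odd number does not occur, since the
-- coordinates sum to 0; the default 0 is kept apart from 2 and -1, so that these ranks determine
-- the number.
rankOf : ℕ → ℤ
rankOf 0 = + 2
rankOf 2 = + 1
rankOf 4 = + 0
rankOf 6 = -[1+ 0 ]
rankOf _ = + 0

red-⊕ : ∀ p .{{_ : ℕ.NonZero p}} {n} (x y : ℤ^ n) → red p (x ⊕ y) ≡ red p (red p x ⊕ y)
red-⊕ p []      []      = refl
red-⊕ p (a ∷ x) (b ∷ y) = cong₂ _∷_ (cong +_ (%ℕ-cong p (a ℤ.+ b) (+ (a %ℕ p) ℤ.+ b) (a /ℕ p)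
    (trans (cong (ℤ._+ b) (a≡a%ℕn+[a/ℕn]*n a p)) (lem (+ (a %ℕ p)) (a /ℕ p) (+ p) b)))) (red-⊕ p x y)
  where
  lem : ∀ r q p b → r ℤ.+ q ℤ.* p ℤ.+ b ≡ r ℤ.+ b ℤ.+ p ℤ.* q
  lem = solve-∀

odd-⊕ : ∀ z s → odd (X ⊛ (red 2 z ⊕ s)) ≡ odd (X ⊛ (z ⊕ s))
odd-⊕ z s = trans (sym (odd-red X (red 2 z ⊕ s)))
  (trans (cong (λ v → odd (X ⊛ v)) (sym (red-⊕ 2 z s))) (odd-red X (z ⊕ s)))

-- A bead placed on runner i of z adds a part congruent to dot (partForm i) z + 1 modulo 2.
partForm : Fin 6 → ℤ^ 6
partForm i = comb (unit i ⊕ ones 6) 𝐃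

rankCheck : Fin 6 → ℤ^ 6 → Bool
rankCheck i z = isYes (rankOf (odd (X ⊛ (z ⊕ step (suc (toℕ i))))) ℤ.≟
  + ((dot (partForm i) z %ℕ 2 + 1) % 2) ℤ.- rankOf (odd (X ⊛ z)))

rankChecked : ∀ i → Verified 2 6 (rankCheck i)
rankChecked 0F = verified _
rankChecked 1F = verified _
rankChecked 2F = verified _
rankChecked 3F = verified _
rankChecked 4F = verified _
rankChecked 5F = verified _

-- The recursion bgRank (x ∷ xs) = par x - bgRank xs, with x the part that the bead adds.
rank-step : ∀ i z → rankOf (odd (X ⊛ (z ⊕ step (suc (toℕ i))))) ≡
  + ((dot (partForm i) z %ℕ 2 + 1) % 2) ℤ.- rankOf (odd (X ⊛ z))
rank-step i z = begin
  rankOf (odd (X ⊛ (z ⊕ s))) ≡⟨ cong rankOf (odd-⊕ z s) ⟨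
  rankOf (odd (X ⊛ (red 2 z ⊕ s))) ≡⟨ isYes⇒ (rankOf (odd (X ⊛ (red 2 z ⊕ s)))) _ (verify 2 {P = rankCheck i} (rankChecked i) z) ⟩
  + ((dot (partForm i) (red 2 z) %ℕ 2 + 1) % 2) ℤ.- rankOf (odd (X ⊛ red 2 z))
    ≡⟨ cong₂ (λ m n → + ((m + 1) % 2) ℤ.- rankOf n) (sym (dot-red 2 (partForm i) z)) (odd-red X z) ⟩
  + ((dot (partForm i) z %ℕ 2 + 1) % 2) ℤ.- rankOf (odd (X ⊛ z)) ∎
  where
  open ≡-Reasoning
  s = step (suc (toℕ i))
  isYes⇒ : ∀ (a b : ℤ) → T (isYes (a ℤ.≟ b)) → a ≡ b
  isYes⇒ a b t with a ℤ.≟ b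
  ... | yes e = e

par-% : ∀ x → par x ≡ + (x % 2)
par-% zero          = refl
par-% (suc zero)    = refl
par-% (suc (suc x)) = par-% x

vector-rank : ∀ {l} → Decreasing l → Positive l → Closed (beta l) → bgRank l ≡ rankOf (odd (X ⊛ vector (beta l)))
vector-rank {[]}     _       _         _       = refl
vector-rank {x ∷ xs} (h ∷ d) (q ∷ pos) (f , c) = sym (trans
    (cong (λ k → rankOf (odd (X ⊛ (z ⊕ step k)))) (proj₁ (proj₂ hc)))
    (trans (rank-step i z) (cong₂ ℤ._-_ (trans (cong +_ parity-x) (sym (par-% x))) (sym (vector-rank d pos c)))))
  where
  bs = beta xs
  b = x + length xs
  z = vector bs
  desc : Descending (b ∷ bs)
  desc = beta-desc (h ∷ d)
  hc = head-class desc (f , c) (beta-positive (q ∷ pos))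
  i = proj₁ hc
  form-value : dot (partForm i) z ≡ + (b + (21 + 7 * length xs))
  form-value = begin
    dot (comb (unit i ⊕ ones 6) 𝐃) z ≡⟨ dot-comb (unit i ⊕ ones 6) 𝐃 z ⟩
    dot (unit i ⊕ ones 6) (𝐃 ⊛ z) ≡⟨ cong (dot (unit i ⊕ ones 6)) (𝐃-vector bs) ⟩
    dot (unit i ⊕ ones 6) (abacus bs) ≡⟨ dot-⊕ˡ (unit i) (ones 6) (abacus bs) ⟩
    dot (unit i) (abacus bs) ℤ.+ dot (ones 6) (abacus bs)
      ≡⟨ cong₂ ℤ._+_ (trans (dot-unit i (abacus bs)) (trans (lookup-abacus bs i) (cong +_ (sym (proj₂ (proj₂ hc))))))
           (trans (abacus-sum (AllPairs.tail desc) c (beta-positive pos)) (cong (λ n → + (21 + 7 * n)) (beta-length xs))) ⟩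
    + (b + (21 + 7 * length xs)) ∎
    where open ≡-Reasoning
  parity-x : (dot (partForm i) z %ℕ 2 + 1) % 2 ≡ x % 2
  parity-x = begin
    (dot (partForm i) z %ℕ 2 + 1) % 2 ≡⟨ cong (λ t → (t %ℕ 2 + 1) % 2) form-value ⟩
    ((b + (21 + 7 * length xs)) % 2 + 1) % 2 ≡⟨ %-+-% (b + (21 + 7 * length xs)) ⟩
    (b + (21 + 7 * length xs) + 1) % 2 ≡⟨ cong (_% 2) (lem x (length xs)) ⟩
    (x + (4 * length xs + 11) * 2) % 2 ≡⟨ [m+kn]%n≡m%n x (4 * length xs + 11) 2 ⟩
    x % 2 ∎
    where
    open ≡-Reasoning
    lem : ∀ x n → x + n + (21 + 7 * n) + 1 ≡ x + (4 * n + 11) * 2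
    lem = solveℕ
    %-+-% : ∀ m → (m % 2 + 1) % 2 ≡ (m + 1) % 2
    %-+-% m = trans (%-distribˡ-+ (m % 2) 1 2) (trans (cong (λ t → (t + 1) % 2) (m%n%n≡m%n m 2)) (sym (%-distribˡ-+ m 1 2)))

rank-parity : ∀ l → ∃ λ k → bgRank l ≡ + sum l ℤ.+ + 2 ℤ.* k
rank-parity []       = + 0 , refl
rank-parity (x ∷ xs) with rank-parity xs
... | k , e = ℤ.- + (x / 2) ℤ.- + sum xs ℤ.- k , (begin
  par x ℤ.- bgRank xs ≡⟨ cong₂ ℤ._-_ (par-% x) e ⟩
  + (x % 2) ℤ.- (+ sum xs ℤ.+ + 2 ℤ.* k) ≡⟨ lem (+ (x % 2)) (+ (x / 2)) (+ sum xs) k ⟩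
  (+ (x % 2) ℤ.+ + (x / 2) ℤ.* + 2) ℤ.+ + sum xs ℤ.+ + 2 ℤ.* (ℤ.- + (x / 2) ℤ.- + sum xs ℤ.- k)
    ≡⟨ cong (λ t → t ℤ.+ + sum xs ℤ.+ + 2 ℤ.* (ℤ.- + (x / 2) ℤ.- + sum xs ℤ.- k)) halves ⟩
  + x ℤ.+ + sum xs ℤ.+ + 2 ℤ.* (ℤ.- + (x / 2) ℤ.- + sum xs ℤ.- k) ∎)
  where
  open ≡-Reasoning
  halves : + (x % 2) ℤ.+ + (x / 2) ℤ.* + 2 ≡ + x
  halves = trans (cong (λ t → + (x % 2) ℤ.+ t) (sym (ℤₚ.pos-* (x / 2) 2)))
    (trans (sym (ℤₚ.pos-+ (x % 2) (x / 2 * 2))) (cong +_ (sym (m≡m%n+[m/n]*n x 2))))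
  lem : ∀ r q s k → r ℤ.- (s ℤ.+ + 2 ℤ.* k) ≡ (r ℤ.+ q ℤ.* + 2) ℤ.+ s ℤ.+ + 2 ℤ.* (ℤ.- q ℤ.- s ℤ.- k)
  lem = solve-∀

-- The bijection between 7-cores and vectors of slope 1 with minimal first entry.

record Core (n : ℕ) (l : List ℕ) : Set where
  field
    partition : Partition n l
    closed    : Closed (beta l)
  open Partition partition public
  descending : Descending (beta l)
  descending = beta-desc decreasing
  positive-beta : Positive (beta l)
  positive-beta = beta-positive positive

core⁺ : ∀ {n l} → l ∈ partitions n → T (isCore 7 l) → Core n l
core⁺ {l = l} l∈ t = record
  { partition = p ; closed = ¬Hook⇒Closed (Partition.decreasing p) (isCore⇒¬Hook 7 l (Partition.decreasing p) t) }
  where p = ∈-partitions⁻ l∈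

core-∈ : ∀ {n l} → Core n l → l ∈ partitions n
core-∈ c = ∈-partitions⁺ (Core.partition c)

core-isCore : ∀ {n l} → Core n l → T (isCore 7 l)
core-isCore {l = l} c = ¬Hook⇒isCore 7 l (Core.decreasing c) (Closed⇒¬Hook (Core.decreasing c) (Core.closed c))

core-quad : ∀ {n l} → Core n l → quad klein (vector (beta l)) ≡ + (2 + n)
core-quad {l = l} c = trans (vector-quad decreasing positive closed) (cong (λ k → + (2 + k)) size)
  where open Core c

-- The vector gives the abacus, hence the beads on runners 1 to 6, and runner 0 is empty for both.
core-injective : ∀ {m n k l} → Core m k → Core n l → vector (beta k) ≡ vector (beta l) → k ≡ l
core-injective {k = k} {l} c d e = beta-injective k l (runner-ext C.descending C.closed D.descending D.closed runners)
  where
  module C = Core c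
  module D = Core d
  abaci : abacus (beta k) ≡ abacus (beta l)
  abaci = trans (sym (𝐃-vector (beta k))) (trans (cong (𝐃 ⊛_) e) (𝐃-vector (beta l)))
  runners : ∀ j → j < 7 → runner j (beta k) ≡ runner j (beta l)
  runners zero    _   = trans (runner₀ C.descending C.closed C.positive-beta)
    (sym (runner₀ D.descending D.closed D.positive-beta))
  runners (suc j) j<7 = subst (λ j → runner j (beta k) ≡ runner j (beta l)) (sym (proj₂ ci))
    (ℕₚ.*-cancelʳ-≡ _ _ 7 (ℕₚ.+-cancelˡ-≡ (suc (toℕ i)) _ _ (ℤₚ.+-injective
      (trans (sym (lookup-abacus (beta k) i)) (trans (cong (λ v → lookup v i) abaci) (lookup-abacus (beta l) i))))))
    where
    ci = class-index (suc j) (λ ()) j<7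
    i  = proj₁ ci

first-difference : ∀ z → dot ℓ ((ρ ⊠ ι) ⊛ z) %ℕ 7 ≡ dot (head 𝐃) z %ℕ 7
first-difference z = trans (cong (_%ℕ 7) (sym (dot-comb ℓ (ρ ⊠ ι) z)))
  (ℤₚ.+-injective (cong head (⊛-≡ₚ 7 ℓᴸ (head 𝐃 ∷ []) refl z)))

vector-slope : ∀ bs → slope₁ (vector bs) ≡ 1
vector-slope bs = cong (λ r → ind (r ≡ᵇ 1)) (trans (first-difference (vector bs))
  (trans (cong (λ v → head v %ℕ 7) (𝐃-vector bs)) ([m+kn]%n≡m%n 1 (runner 1 bs) 7)))

differences : Vec ℤ 6
differences = + 1 ∷ + 2 ∷ + 3 ∷ + 4 ∷ + 5 ∷ + 6 ∷ []

slope-differences : ∀ z → dot ℓ ((ρ ⊠ ι) ⊛ z) %ℕ 7 ≡ 1 → red 7 (𝐃 ⊛ z) ≡ differences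
slope-differences z s = begin
  red 7 (𝐃 ⊛ z) ≡⟨ ⊛-≡ₚ 7 𝐃 (column ⊠ ℓᴸ) refl z ⟩
  red 7 ((column ⊠ ℓᴸ) ⊛ z) ≡⟨ cong (red 7) (⊠-⊛ column ℓᴸ z) ⟩
  red 7 (column ⊛ ℓᴸ ⊛ z) ≡⟨ ⊛-red 7 column (ℓᴸ ⊛ z) ⟩
  red 7 (column ⊛ red 7 (ℓᴸ ⊛ z))
    ≡⟨ cong (λ k → red 7 (column ⊛ (+ k ∷ []))) (trans (cong (_%ℕ 7) (dot-comb ℓ (ρ ⊠ ι) z)) s) ⟩
  differences ∎
  where
  open ≡-Reasoning
  column : Mat 6 1
  column = map (_∷ []) differences

Nonneg : ∀ {n} → ℤ^ n → Set
Nonneg v = ∀ i → + 0 ℤ.≤ lookup v i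

nonneg⇒min : ∀ {n} a (v : ℤ^ n) → Nonneg (map (ℤ._- a) v) → ∀ {y} → y ∈ toList v → a ℤ.≤ y
nonneg⇒min a (b ∷ v) h (here refl) = ℤₚ.0≤i-j⇒j≤i (h zero)
nonneg⇒min a (b ∷ v) h (there i)   = nonneg⇒min a v (h ∘ suc) i

min⇒nonneg : ∀ {n} a (v : ℤ^ n) → (∀ {y} → y ∈ toList v → a ℤ.≤ y) → Nonneg (map (ℤ._- a) v)
min⇒nonneg a (b ∷ v) h zero    = ℤₚ.i≤j⇒0≤j-i (h (here refl))
min⇒nonneg a (b ∷ v) h (suc i) = min⇒nonneg a v (h ∘ there) i

𝐃-relative : ∀ z → 𝐃 ⊛ z ≡ map (ℤ._- dot (head X) z) (tail X ⊛ z)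
𝐃-relative z = relative-⊛ (head X) (tail X) z

headMin⁺ : ∀ z → Nonneg (𝐃 ⊛ z) → headMin (X ⊛ z) ≡ 1
headMin⁺ z h = go (dot (head X) z) (tail X ⊛ z) (subst Nonneg (𝐃-relative z) h)
  where
  go : ∀ a v → Nonneg (map (ℤ._- a) v) → headMin (a ∷ v) ≡ 1
  go a v h = cong ind (isMin⁺ a (a ∷ toList v) (λ { (here refl) → ℤₚ.≤-refl ; (there i) → nonneg⇒min a v h i }))

headMin⁻ : ∀ z → headMin (X ⊛ z) ≢ 0 → Nonneg (𝐃 ⊛ z)
headMin⁻ z ne = subst Nonneg (sym (𝐃-relative z)) (go (dot (head X) z) (tail X ⊛ z) ne)
  where
  go : ∀ a v → headMin (a ∷ v) ≢ 0 → Nonneg (map (ℤ._- a) v)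
  go a v ne = min⇒nonneg a v (λ i → isMin⁻ a (a ∷ toList v) (ind≢0⇒T (isMin a (a ∷ toList v)) ne) (there i))

vector-headMin : ∀ bs → headMin (X ⊛ vector bs) ≡ 1
vector-headMin bs = headMin⁺ (vector bs) (λ i → subst (+ 0 ℤ.≤_)
  (sym (trans (cong (λ v → lookup v i) (𝐃-vector bs)) (lookup-abacus bs i))) (ℤ.+≤+ ℕ.z≤n))

entry : ∀ {n} → ℕ → ℤ^ n → ℕ
entry k       []      = 0
entry zero    (a ∷ v) = ℤ.∣ a ∣
entry (suc k) (a ∷ v) = entry k v

entry-lookup : ∀ {n} (v : ℤ^ n) i → entry (toℕ i) v ≡ ℤ.∣ lookup v i ∣
entry-lookup (a ∷ v) zero    = refl
entry-lookup (a ∷ v) (suc i) = entry-lookup v i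

≤total : ∀ (w : ℕ → ℕ) {x xs} → x ∈ xs → w x ≤ total w xs
≤total w (here refl)           = ℕₚ.m≤m+n (w _) _
≤total w {xs = y ∷ _} (there i) = ℕₚ.≤-trans (≤total w i) (ℕₚ.m≤n+m _ (w y))

module _ (z : ℤ^ 6) (slope-z : dot ℓ ((ρ ⊠ ι) ⊛ z) %ℕ 7 ≡ 1) (nonneg-z : Nonneg (𝐃 ⊛ z)) where

  private
    -- The k-th difference is nonnegative and congruent to k modulo 7, so its quotient by 7 is the
    -- number of beads on runner k. Leaving runner 0 empty makes all beads positive.
    lengths : ℕ → ℕ
    lengths zero    = 0
    lengths (suc k) = entry k (𝐃 ⊛ z) / 7

    bound : ℕ
    bound = total lengths (List.upTo 7) * 7

    big : ∀ j i → j < 7 → i < lengths j → j + i * 7 < bound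
    big j i j<7 i< = ℕₚ.<-≤-trans (ℕₚ.+-monoˡ-< (i * 7) j<7)
      (ℕₚ.*-monoˡ-≤ 7 (ℕₚ.≤-trans i< (≤total lengths (∈-upTo⁺ j<7))))

    bs : List ℕ
    bs = fill lengths bound

    bs-positive : Positive bs
    bs-positive = All.tabulate (λ {x} x∈ → ℕₚ.n≢0⇒n>0 (λ { refl → ℕₚ.<-irrefl refl (proj₂ (fill-∈ lengths {bound} 0 x∈)) }))

    residue-i : ∀ i → lookup (𝐃 ⊛ z) i %ℕ 7 ≡ suc (toℕ i)
    residue-i i = ℤₚ.+-injective (trans (sym (Vecₚ.lookup-map i (λ t → + (t %ℕ 7)) (𝐃 ⊛ z)))
      (trans (cong (λ v → lookup v i) (slope-differences z slope-z)) (lookup-differences i)))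
      where
      lookup-differences : ∀ i → lookup differences i ≡ + suc (toℕ i)
      lookup-differences 0F = refl
      lookup-differences 1F = refl
      lookup-differences 2F = refl
      lookup-differences 3F = refl
      lookup-differences 4F = refl
      lookup-differences 5F = refl

    decompose : ∀ a j → + 0 ℤ.≤ a → a %ℕ 7 ≡ j → + (j + ℤ.∣ a ∣ / 7 * 7) ≡ a
    decompose (+ n) j _ refl = cong +_ (sym (split7 n))

    abacus-bs : abacus bs ≡ 𝐃 ⊛ z
    abacus-bs = trans (Vecₚ.tabulate-cong (λ i → trans
        (cong (λ r → + (suc (toℕ i) + r * 7)) (trans
          (runner-fill lengths bound big (suc (toℕ i)) (ℕ.s≤s (Finₚ.toℕ<n i))) (cong (_/ 7) (entry-lookup (𝐃 ⊛ z) i))))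
        (decompose (lookup (𝐃 ⊛ z) i) (suc (toℕ i)) (nonneg-z i) (residue-i i))))
      (Vecₚ.tabulate∘lookup (𝐃 ⊛ z))

  vector-onto : ∀ {n} → quad klein z ≡ + (2 + n) → ∃ λ l → Core n l × z ≡ vector (beta l)
  vector-onto {n} q = l , record
      { partition = record { decreasing = decreasing ; positive = positive
        ; size = ℕₚ.+-cancelˡ-≡ 2 (sum l) n (ℤₚ.+-injective (trans (sym (vector-quad decreasing positive closed))
            (trans (cong (quad klein) (sym z≡)) q))) }
      ; closed = closed } , z≡
    where
    desc : Descending bs
    desc = fill-descending lengths bound
    l : List ℕ
    l = unbeta bs
    decreasing : Decreasing l
    decreasing = unbeta-decreasing desc bs-positive
    positive : Positive l
    positive = unbeta-positive desc bs-positive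
    beta-l : beta l ≡ bs
    beta-l = beta-unbeta desc bs-positive
    closed : Closed (beta l)
    closed = subst Closed (sym beta-l) (fill-closed lengths bound)
    z≡ : z ≡ vector (beta l)
    z≡ = trans (𝐃-injective z (vector bs) (trans (sym abacus-bs) (sym (𝐃-vector bs)))) (cong vector (sym beta-l))

-- Serves both for all cores and for a given rank: `q` is what `P` asks beyond being a core, and `w`
-- expresses it by the coordinates.
Σ-cores : ∀ n (P q : List ℕ → Bool) (w : ℤ^ 7 → ℕ) →
  (∀ l → T (P l) → T (isCore 7 l) × T (q l)) → (∀ l → T (isCore 7 l) → T (q l) → T (P l)) →
  (∀ l → Core n l → ind (q l) ≡ w (X ⊛ vector (beta l))) →
  length (List.filter (λ l → T? (P l)) (partitions n)) ≡
  Σ[ ℒ ⊢ 2 + n ] (λ z → slope₁ z * (w (X ⊛ z) * headMin (X ⊛ z)))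
Σ-cores n P q w P⇒ P⇐ weight = sym (trans
    (total-bij (vector ∘ beta) {xs = cores} {ys = shell ℒ (2 + n)} {v = λ _ → 1} {w = W}
      (Uniqueₚ.filter⁺ (λ l → T? (P l)) (partitions-unique n)) (Lattice.shell-unique ℒ (2 + n))
      (λ k∈ l∈ → core-injective (core k∈) (core l∈))
      (λ l∈ → Lattice.∈-shell⁺ ℒ (core-quad (core l∈)))
      (λ {l} l∈ → W-vector l (core l∈) (proj₂ (P⇒ l (isP l∈))))
      (λ {z} z∈ ne → onto z z∈ ne))
    (total-const cores (λ _ _ → refl)))
  where
  cores : List (List ℕ)
  cores = List.filter (λ l → T? (P l)) (partitions n)
  W : ℤ^ 6 → ℕ
  W z = slope₁ z * (w (X ⊛ z) * headMin (X ⊛ z))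
  isP : ∀ {l} → l ∈ cores → T (P l)
  isP l∈ = proj₂ (∈-filter⁻ (λ l → T? (P l)) {xs = partitions n} l∈)
  core : ∀ {l} → l ∈ cores → Core n l
  core {l} l∈ = core⁺ (proj₁ (∈-filter⁻ (λ l → T? (P l)) {xs = partitions n} l∈)) (proj₁ (P⇒ l (isP l∈)))
  W-vector : ∀ l → Core n l → T (q l) → W (vector (beta l)) ≡ 1
  W-vector l c t = cong₂ ℕ._*_ (vector-slope (beta l))
    (cong₂ ℕ._*_ (trans (sym (weight l c)) (ind-true (q l) t)) (vector-headMin (beta l)))
  factors : ∀ b x y → ind b * (x * y) ≢ 0 → T b × x ≢ 0 × y ≢ 0
  factors false x y ne = contradiction refl ne
  factors true  x y ne = _ , (λ { refl → ne refl }) , (λ { refl → ne (trans (ℕₚ.+-identityʳ (x * 0)) (ℕₚ.*-zeroʳ x)) })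
  onto : ∀ z → z ∈ shell ℒ (2 + n) → W z ≢ 0 → ∃ λ l → l ∈ cores × z ≡ vector (beta l)
  onto z z∈ ne = finish (factors (dot ℓ ((ρ ⊠ ι) ⊛ z) %ℕ 7 ≡ᵇ 1) (w (X ⊛ z)) (headMin (X ⊛ z)) ne)
    where
    finish : T (dot ℓ ((ρ ⊠ ι) ⊛ z) %ℕ 7 ≡ᵇ 1) × w (X ⊛ z) ≢ 0 × headMin (X ⊛ z) ≢ 0 →
      ∃ λ l → l ∈ cores × z ≡ vector (beta l)
    finish (s , w≢0 , m≢0) = found
      (vector-onto z (ℕₚ.≡ᵇ⇒≡ _ 1 s) (headMin⁻ z m≢0) (Lattice.∈-shell⁻ ℒ z∈))
      where
      found : (∃ λ l → Core n l × z ≡ vector (beta l)) → ∃ λ l → l ∈ cores × z ≡ vector (beta l)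
      found (l , c , e) = l , ∈-filter⁺ (λ l → T? (P l)) (core-∈ c) (P⇐ l (core-isCore c)
        (ind≢0⇒T (q l) (λ i → w≢0 (trans (cong (λ y → w (X ⊛ y)) e) (trans (sym (weight l c)) i))))) , e

a7≡𝐀 : ∀ n → a7 n ≡ 𝐀 (2 + n)
a7≡𝐀 n = Σ-cores n (isCore 7) (λ _ → true) (λ _ → 1) (λ _ t → t , _) (λ _ t _ → t) (λ _ _ → refl)

rankIs : ℤ → ℕ → Bool
rankIs j k = ⌊ rankOf k ℤ.≟ j ⌋

a7bg≡Σ : ∀ j n → a7bg j n ≡ Σ[ ℒ ⊢ 2 + n ] (λ z → slope₁ z * (ind (rankIs j (odd (X ⊛ z))) * headMin (X ⊛ z)))
a7bg≡Σ j n = Σ-cores n (λ l → isCore 7 l ∧ ⌊ bgRank l ℤ.≟ j ⌋) (λ l → ⌊ bgRank l ℤ.≟ j ⌋) (λ v → ind (rankIs j (odd v)))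
  (λ l → Equivalence.to (T-∧ {isCore 7 l})) (λ l s t → Equivalence.from (T-∧ {isCore 7 l}) (s , t))
  (λ l c → cong (λ r → ind ⌊ r ℤ.≟ j ⌋) (vector-rank (Core.decreasing c) (Core.positive c) (Core.closed c)))

a7bg≡𝐀ᵒ : ∀ j k → (∀ i → rankIs j i ≡ (i ≡ᵇ k)) → ∀ n → a7bg j n ≡ 𝐀ᵒ k (2 + n)
a7bg≡𝐀ᵒ j k e n = trans (a7bg≡Σ j n) (total-cong (shell ℒ (2 + n))
  (λ z _ → cong (λ b → slope₁ z * (ind b * headMin (X ⊛ z))) (e (odd (X ⊛ z)))))

rank-2 : ∀ i → rankIs (+ 2) i ≡ (i ≡ᵇ 0)
rank-2 0 = refl
rank-2 1 = refl
rank-2 2 = refl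
rank-2 3 = refl
rank-2 4 = refl
rank-2 5 = refl
rank-2 6 = refl
rank-2 (suc (suc (suc (suc (suc (suc (suc _))))))) = refl

rank--1 : ∀ i → rankIs -[1+ 0 ] i ≡ (i ≡ᵇ 6)
rank--1 0 = refl
rank--1 1 = refl
rank--1 2 = refl
rank--1 3 = refl
rank--1 4 = refl
rank--1 5 = refl
rank--1 6 = refl
rank--1 (suc (suc (suc (suc (suc (suc (suc _))))))) = refl

length-filter-total : ∀ {A : Set} (P : A → Bool) xs → length (List.filter (λ x → T? (P x)) xs) ≡ total (λ x → ind (P x)) xs
length-filter-total P []       = refl
length-filter-total P (x ∷ xs) with P x
... | true  = cong suc (length-filter-total P xs)
... | false = length-filter-total P xs

rank-%2 : ∀ {n l} → Core n l → bgRank l %ℕ 2 ≡ n % 2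
rank-%2 {n} {l} c = trans (%ℕ-cong 2 (bgRank l) (+ sum l) (proj₁ (rank-parity l)) (proj₂ (rank-parity l)))
  (cong (_% 2) (Core.size c))

-- The BG-rank has the parity of the size and takes at most four values.
a7≤a7bg : ∀ n i j → (∀ k → rankOf k %ℕ 2 ≡ n % 2 → rankOf k ≡ i ⊎ rankOf k ≡ j) → a7 n ≤ a7bg i n + a7bg j n
a7≤a7bg n i j h = begin
  a7 n ≡⟨ length-filter-total (isCore 7) (partitions n) ⟩
  total (λ l → ind (isCore 7 l)) (partitions n) ≤⟨ total-mono (partitions n) split ⟩
  total (λ l → ind (P i l) + ind (P j l)) (partitions n) ≡⟨ total-+ (λ l → ind (P i l)) (λ l → ind (P j l)) (partitions n) ⟩
  total (λ l → ind (P i l)) (partitions n) + total (λ l → ind (P j l)) (partitions n)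
    ≡⟨ cong₂ _+_ (length-filter-total (P i) (partitions n)) (length-filter-total (P j) (partitions n)) ⟨
  a7bg i n + a7bg j n ∎
  where
  open ℕₚ.≤-Reasoning
  P : ℤ → List ℕ → Bool
  P j l = isCore 7 l ∧ ⌊ bgRank l ℤ.≟ j ⌋
  hit-rank : ∀ (r s : ℤ) → r ≡ s → ind ⌊ r ℤ.≟ s ⌋ ≡ 1
  hit-rank r s e with r ℤ.≟ s
  ... | yes _ = refl
  ... | no ne = contradiction e ne
  cases : ∀ b (r : ℤ) → (T b → r ≡ i ⊎ r ≡ j) → ind b ≤ ind (b ∧ ⌊ r ℤ.≟ i ⌋) + ind (b ∧ ⌊ r ℤ.≟ j ⌋)
  cases false r f = ℕ.z≤n
  cases true  r f with f _
  ... | inj₁ e = subst (λ t → 1 ≤ t + ind ⌊ r ℤ.≟ j ⌋) (sym (hit-rank r i e)) (ℕ.s≤s ℕ.z≤n)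
  ... | inj₂ e = subst (λ t → 1 ≤ ind ⌊ r ℤ.≟ i ⌋ + t) (sym (hit-rank r j e)) (ℕₚ.m≤n+m 1 _)
  split : ∀ l → l ∈ partitions n → ind (isCore 7 l) ≤ ind (P i l) + ind (P j l)
  split l l∈ = cases (isCore 7 l) (bgRank l) rank
    where
    rank : T (isCore 7 l) → bgRank l ≡ i ⊎ bgRank l ≡ j
    rank t = subst (λ r → r ≡ i ⊎ r ≡ j) (sym e) (h (odd (X ⊛ vector (beta l)))
        (trans (cong (_%ℕ 2) (sym e)) (rank-%2 c)))
      where
      c = core⁺ {n} {l} l∈ t
      e = vector-rank (Core.decreasing c) (Core.positive c) (Core.closed c)

even-ranks : ∀ k → rankOf k %ℕ 2 ≡ 0 → rankOf k ≡ + 0 ⊎ rankOf k ≡ + 2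
even-ranks 0 _ = inj₂ refl
even-ranks 1 _ = inj₁ refl
even-ranks 2 ()
even-ranks 3 _ = inj₁ refl
even-ranks 4 _ = inj₁ refl
even-ranks 5 _ = inj₁ refl
even-ranks 6 ()
even-ranks (suc (suc (suc (suc (suc (suc (suc _))))))) _ = inj₁ refl

odd-ranks : ∀ k → rankOf k %ℕ 2 ≡ 1 → rankOf k ≡ + 1 ⊎ rankOf k ≡ -[1+ 0 ]
odd-ranks 2 _ = inj₁ refl
odd-ranks 6 _ = inj₂ refl
odd-ranks 0 ()
odd-ranks 1 ()
odd-ranks 3 ()
odd-ranks 4 ()
odd-ranks 5 ()
odd-ranks (suc (suc (suc (suc (suc (suc (suc _))))))) ()

-- From the lattice counts to the six statements.

open Growth 𝐍 𝐫 (halved ℒ) (halved 𝒪³) hecke-ℒ hecke-𝒪³ two-multiples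
  (halved-even ℒ) (halved-odd ℒ) (halved-even 𝒪³) (halved-odd 𝒪³) using (N-double; N-quadruple)

-- 2 is a square modulo 7, so doubling preserves residues and non-residues.
κ-double : ∀ a → κ ((2 * a) % 7) ≡ κ (a % 7)
κ-double a = trans (cong κ (%-distribˡ-* 2 a 7)) (ℕₚ.≡ᵇ⇒≡ _ _
    (allBelow-sound {7} {λ r → κ ((2 * r) % 7) ≡ᵇ κ r} _ (a % 7) (m%n<n a 7)))

336𝐀-double : ∀ m → 336 * 𝐀 (2 * m) ≡ κ ((2 * (2 * m)) % 7) * 𝐍 (2 * m)
336𝐀-double m = trans (336𝐀 (2 * m)) (cong (_* 𝐍 (2 * m)) (κ-double (2 * (2 * m))))

transfer : ∀ c k a b {x y} → 336 * a ≡ k * x → 336 * b ≡ k * y → c * x ≤ y → c * a ≤ b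
transfer c k a b {x} {y} ea eb h = ℕₚ.*-cancelˡ-≤ 336 (begin
  336 * (c * a) ≡⟨ swap 336 c a ⟩
  c * (336 * a) ≡⟨ cong (c *_) ea ⟩
  c * (k * x) ≡⟨ swap c k x ⟩
  k * (c * x) ≤⟨ ℕₚ.*-monoʳ-≤ k h ⟩
  k * y ≡⟨ eb ⟨
  336 * b ∎)
  where
  open ℕₚ.≤-Reasoning
  swap : ∀ i j l → i * (j * l) ≡ j * (i * l)
  swap = solveℕ

𝐀-double : ∀ m → 0 < m → 2 * 𝐀 m ≤ 𝐀 (2 * m)
𝐀-double m m>0 = transfer 2 (κ ((2 * (2 * m)) % 7)) (𝐀 m) (𝐀 (2 * m)) (336𝐀 m) (336𝐀-double m) (N-double m m>0)

𝐀-quadruple : ∀ m → 0 < m → 10 * 𝐀 m ≤ 𝐀 (2 * (2 * m))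
𝐀-quadruple m m>0 = transfer 10 (κ ((2 * (2 * m)) % 7)) (𝐀 m) (𝐀 (2 * (2 * m))) (336𝐀 m)
  (trans (336𝐀-double (2 * m)) (cong (_* 𝐍 (2 * (2 * m))) (κ-double (2 * (2 * m))))) (N-quadruple m m>0)

-- For non-residues modulo 7 the cusp form vanishes and the Hecke relation closes up.
module _ (m : ℕ) (nonres : κ ((2 * m) % 7) ≡ 6) where

  private
    nonres₂ : κ ((2 * (2 * m)) % 7) ≡ 6
    nonres₂ = trans (κ-double (2 * m)) nonres

  nonresidue-hecke : ∀ {h} → halved ℒ m ≡ h → 𝐍 (2 * m) + 4 * h ≡ 5 * 𝐍 m
  nonresidue-hecke {h} refl = ℕₚ.+-cancelʳ-≡ (2 * 𝐍 m) _ _ (begin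
    𝐍 (2 * m) + 4 * halved ℒ m + 2 * 𝐍 m ≡⟨ rearrange (𝐍 (2 * m)) (halved ℒ m) (𝐍 m) ⟩
    𝐍 (2 * m) + 2 * 𝐍 m + 4 * halved ℒ m ≡⟨ hecke-ℒ m ⟨
    7 * 𝐫 m ≡⟨ cong (7 *_) (𝐫≡𝐍 m nonres nonres₂) ⟩
    7 * 𝐍 m ≡⟨ seven (𝐍 m) ⟩
    5 * 𝐍 m + 2 * 𝐍 m ∎)
    where
    open ≡-Reasoning
    rearrange : ∀ a b c → a + 4 * b + 2 * c ≡ a + 2 * c + 4 * b
    rearrange = solveℕ
    seven : ∀ a → 7 * a ≡ 5 * a + 2 * a
    seven = solveℕ

56𝐀 : ∀ m → κ ((2 * (2 * m)) % 7) ≡ 6 → 56 * 𝐀 m ≡ 𝐍 m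
56𝐀 m e = ℕₚ.*-cancelˡ-≡ (56 * 𝐀 m) (𝐍 m) 6 (trans (sym (ℕₚ.*-assoc 6 56 (𝐀 m))) (trans (336𝐀 m) (cong (_* 𝐍 m) e)))

𝐀-odd : ∀ j → κ ((2 * (1 + 2 * j)) % 7) ≡ 6 → 𝐀 (2 * (1 + 2 * j)) ≡ 5 * 𝐀 (1 + 2 * j)
𝐀-odd j e = ℕₚ.*-cancelˡ-≡ (𝐀 (2 * m)) (5 * 𝐀 m) 56 (begin
  56 * 𝐀 (2 * m) ≡⟨ 56𝐀 (2 * m) (trans (κ-double (2 * (2 * m))) (trans (κ-double (2 * m)) e)) ⟩
  𝐍 (2 * m) ≡⟨ ℕₚ.+-identityʳ (𝐍 (2 * m)) ⟨
  𝐍 (2 * m) + 4 * 0 ≡⟨ nonresidue-hecke m e (halved-odd ℒ j) ⟩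
  5 * 𝐍 m ≡⟨ cong (5 *_) (56𝐀 m (trans (κ-double (2 * m)) e)) ⟨
  5 * (56 * 𝐀 m) ≡⟨ swap (𝐀 m) ⟩
  56 * (5 * 𝐀 m) ∎)
  where
  open ≡-Reasoning
  m = 1 + 2 * j
  swap : ∀ a → 5 * (56 * a) ≡ 56 * (5 * a)
  swap = solveℕ

𝐀-even : ∀ k → κ ((2 * (2 * k)) % 7) ≡ 6 → 𝐀 (2 * (2 * k)) + 4 * 𝐀 k ≡ 5 * 𝐀 (2 * k)
𝐀-even k e = ℕₚ.*-cancelˡ-≡ (𝐀 (2 * (2 * k)) + 4 * 𝐀 k) (5 * 𝐀 (2 * k)) 56 (begin
  56 * (𝐀 (2 * (2 * k)) + 4 * 𝐀 k) ≡⟨ spread (𝐀 (2 * (2 * k))) (𝐀 k) ⟩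
  56 * 𝐀 (2 * (2 * k)) + 4 * (56 * 𝐀 k)
    ≡⟨ cong₂ (λ a b → a + 4 * b) (56𝐀 (2 * (2 * k)) (trans (κ-double (2 * (2 * (2 * k)))) e₂)) (56𝐀 k e) ⟩
  𝐍 (2 * (2 * k)) + 4 * 𝐍 k ≡⟨ nonresidue-hecke (2 * k) e (halved-even ℒ k) ⟩
  5 * 𝐍 (2 * k) ≡⟨ cong (5 *_) (56𝐀 (2 * k) e₂) ⟨
  5 * (56 * 𝐀 (2 * k)) ≡⟨ swap (𝐀 (2 * k)) ⟩
  56 * (5 * 𝐀 (2 * k)) ∎)
  where
  open ≡-Reasoning
  e₂ : κ ((2 * (2 * (2 * k))) % 7) ≡ 6
  e₂ = trans (κ-double (2 * (2 * k))) e
  spread : ∀ a b → 56 * (a + 4 * b) ≡ 56 * a + 4 * (56 * b)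
  spread = solveℕ
  swap : ∀ a → 5 * (56 * a) ≡ 56 * (5 * a)
  swap = solveℕ

a7-at : ∀ {n m} → 2 + n ≡ m → a7 n ≡ 𝐀 m
a7-at {n} e = trans (a7≡𝐀 n) (cong 𝐀 e)

nonresidue-mod : ∀ {a} b r → a ≡ r + b * 7 → κ (r % 7) ≡ 6 → κ (a % 7) ≡ 6
nonresidue-mod b r refl e = trans (cong κ ([m+kn]%n≡m%n r b 7)) e

-- If n + 2 = 4k, there are `𝐀 k` cores of rank 2, while `a7 n` is at least 10 `𝐀 k`; by parity the
-- others have rank 0. If 4 does not divide n + 2, rank 2 does not occur.
item₃ : ∀ n → a7bg (+ 0) n ≥ 9 * a7bg (+ 2) n
item₃ n = cases (4 ℕ∣.∣? (2 + n))
  where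
  cases : Dec (4 ℕ∣.∣ (2 + n)) → a7bg (+ 0) n ≥ 9 * a7bg (+ 2) n
  cases (no ∤) = subst (λ t → 9 * t ≤ a7bg (+ 0) n) (sym (trans (a7bg≡𝐀ᵒ (+ 2) 0 rank-2 n)
    (𝐀ᵒ0-nonmultiple (2 + n) (λ k e → ∤ (ℕ∣.divides k (trans e (ℕₚ.*-comm 4 k))))))) ℕ.z≤n
  cases (yes (ℕ∣.divides k e)) = ℕₚ.+-cancelʳ-≤ (𝐀 k) (9 * a7bg (+ 2) n) (a7bg (+ 0) n) (begin
    9 * a7bg (+ 2) n + 𝐀 k ≡⟨ cong (λ t → 9 * t + 𝐀 k) a7bg-2 ⟩
    9 * 𝐀 k + 𝐀 k ≡⟨ ten (𝐀 k) ⟩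
    10 * 𝐀 k ≤⟨ 𝐀-quadruple k k>0 ⟩
    𝐀 (2 * (2 * k)) ≡⟨ a7-at (trans 4k (ℕₚ.*-assoc 2 2 k)) ⟨
    a7 n ≤⟨ a7≤a7bg n (+ 0) (+ 2) (λ i r → even-ranks i (trans r n-even)) ⟩
    a7bg (+ 0) n + a7bg (+ 2) n ≡⟨ cong (λ t → a7bg (+ 0) n + t) a7bg-2 ⟩
    a7bg (+ 0) n + 𝐀 k ∎)
    where
    open ℕₚ.≤-Reasoning
    4k : 2 + n ≡ 4 * k
    4k = trans e (ℕₚ.*-comm k 4)
    k>0 : 0 < k
    k>0 = ℕₚ.n≢0⇒n>0 (λ { refl → contradiction e (λ ()) })
    a7bg-2 : a7bg (+ 2) n ≡ 𝐀 k
    a7bg-2 = trans (a7bg≡𝐀ᵒ (+ 2) 0 rank-2 n) (trans (cong (𝐀ᵒ 0) 4k) (𝐀ᵒ0-multiple k))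
    ten : ∀ a → 9 * a + a ≡ 10 * a
    ten = solveℕ
    n-even : n % 2 ≡ 0
    n-even = trans (cong (_% 2) (trans e (lem k))) ([m+kn]%n≡m%n 0 (2 * k) 2)
      where
      lem : ∀ k → k * 4 ≡ 0 + 2 * k * 2
      lem = solveℕ

a7bg-empty : ∀ n j → (∀ l → Core n l → bgRank l ≢ j) → a7bg j n ≡ 0
a7bg-empty n j h = trans (length-filter-total P (partitions n)) (total-zero (partitions n) (λ l l∈ → vanish l l∈ (P l) refl))
  where
  P : List ℕ → Bool
  P l = isCore 7 l ∧ ⌊ bgRank l ℤ.≟ j ⌋
  rank-of : ∀ (r : ℤ) → T ⌊ r ℤ.≟ j ⌋ → r ≡ j
  rank-of r t with r ℤ.≟ j
  ... | yes e = e
  absurd : ∀ l → l ∈ partitions n → ¬ T (P l)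
  absurd l l∈ t = h l (core⁺ {n} {l} l∈ (proj₁ (Equivalence.to (T-∧ {isCore 7 l}) t)))
    (rank-of (bgRank l) (proj₂ (Equivalence.to (T-∧ {isCore 7 l}) t)))
  vanish : ∀ l → l ∈ partitions n → ∀ b → P l ≡ b → ind (P l) ≡ 0
  vanish l l∈ false e = cong ind e
  vanish l l∈ true  e = contradiction (subst T (sym e) _) (absurd l l∈)

-- For even n the rank -1 is excluded by parity. For odd n the ranks are 1 and -1, and -1 accounts
-- for at most a third of the cores.
item₄ : ∀ n → a7bg (+ 1) n ≥ 2 * a7bg -[1+ 0 ] n
item₄ n = cases (parity n)
  where
  cases : (∃ λ k → n ≡ 2 * k) ⊎ (∃ λ k → n ≡ 1 + 2 * k) → a7bg (+ 1) n ≥ 2 * a7bg -[1+ 0 ] n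
  cases (inj₁ (k , e)) = subst (λ t → 2 * t ≤ a7bg (+ 1) n) (sym (a7bg-empty n -[1+ 0 ] (λ l c r →
      contradiction (trans (sym (trans (rank-%2 c) n-even)) (cong (_%ℕ 2) r)) (λ ())))) ℕ.z≤n
    where
    n-even : n % 2 ≡ 0
    n-even = trans (cong (_% 2) (trans e (ℕₚ.*-comm 2 k))) ([m+kn]%n≡m%n 0 k 2)
  cases (inj₂ (k , e)) = ℕₚ.+-cancelʳ-≤ a₋₁ (2 * a₋₁) (a7bg (+ 1) n) (begin
    2 * a₋₁ + a₋₁ ≡⟨ three a₋₁ ⟩
    3 * a₋₁ ≡⟨ cong (3 *_) (a7bg≡𝐀ᵒ -[1+ 0 ] 6 rank--1 n) ⟩
    3 * 𝐀ᵒ 6 (2 + n) ≤⟨ 3𝐀ᵒ6≤𝐀 (2 + n) ⟩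
    𝐀 (2 + n) ≡⟨ a7≡𝐀 n ⟨
    a7 n ≤⟨ a7≤a7bg n (+ 1) -[1+ 0 ] (λ i r → odd-ranks i (trans r n-odd)) ⟩
    a7bg (+ 1) n + a₋₁ ∎)
    where
    open ℕₚ.≤-Reasoning
    a₋₁ : ℕ
    a₋₁ = a7bg -[1+ 0 ] n
    three : ∀ a → 2 * a + a ≡ 3 * a
    three = solveℕ
    n-odd : n % 2 ≡ 1
    n-odd = trans (cong (_% 2) (trans e (cong (λ t → 1 + t) (ℕₚ.*-comm 2 k)))) ([m+kn]%n≡m%n 1 k 2)

-- Here r = k + 1, which resolves the truncated subtraction. The two sizes have norms 2m and m with
-- m = 14n + 2r + 1 odd, and 2m ≡ 6 + 4k modulo 7; the values k = 0, 1, 5 give the non-residues 6,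
-- 3, 5.
item₅ : ∀ n k → κ ((6 + 4 * k) % 7) ≡ 6 → a7 (28 * n + 4 * suc k) ≡ 5 * a7 (14 * n + 2 * suc k ∸ 1)
item₅ n k nonres = trans (a7-at (l₁ n k)) (trans (𝐀-odd (7 * n + suc k) (nonresidue-mod (4 * n) (6 + 4 * k) (l₃ n k) nonres))
  (cong (5 *_) (sym (a7-at (trans (cong (λ t → 2 + (t ∸ 1)) (l₀ n k)) (l₂ n k))))))
  where
  l₀ : ∀ n k → 14 * n + 2 * suc k ≡ suc (14 * n + (1 + 2 * k))
  l₀ = solveℕ
  l₁ : ∀ n k → 2 + (28 * n + 4 * suc k) ≡ 2 * (1 + 2 * (7 * n + suc k))
  l₁ = solveℕ
  l₂ : ∀ n k → 2 + (14 * n + (1 + 2 * k)) ≡ 1 + 2 * (7 * n + suc k)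
  l₂ = solveℕ
  l₃ : ∀ n k → 2 * (1 + 2 * (7 * n + suc k)) ≡ 6 + 4 * k + 4 * n * 7
  l₃ = solveℕ

-- The three sizes have norms 4j, j and 2j with j = 7n + r + 1 and r = k + 1. Now 4j ≡ 8 + 4k modulo
-- 7, and k = 1, 3, 4 give the non-residues 5, 6, 3.
item₆ : ∀ n k → κ ((8 + 4 * k) % 7) ≡ 6 →
  a7 (28 * n + 4 * suc k + 2) + 4 * a7 (7 * n + suc k ∸ 1) ≡ 5 * a7 (14 * n + 2 * suc k)
item₆ n k nonres = trans (cong₂ (λ a b → a + 4 * b) (a7-at (l₁ n k))
    (a7-at (trans (cong (λ t → 2 + (t ∸ 1)) (ℕₚ.+-suc (7 * n) k)) (ℕₚ.+-comm 2 (7 * n + k)))))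
  (trans (𝐀-even (7 * n + k + 2) (nonresidue-mod (4 * n) (8 + 4 * k) (l₃ n k) nonres)) (cong (5 *_) (sym (a7-at (l₂ n k)))))
  where
  l₁ : ∀ n k → 2 + (28 * n + 4 * suc k + 2) ≡ 2 * (2 * (7 * n + k + 2))
  l₁ = solveℕ
  l₂ : ∀ n k → 2 + (14 * n + 2 * suc k) ≡ 2 * (7 * n + k + 2)
  l₂ = solveℕ
  l₃ : ∀ n k → 2 * (2 * (7 * n + k + 2)) ≡ 8 + 4 * k + 4 * n * 7
  l₃ = solveℕ

theorem1p1 : (n : ℕ) →
    (a7 (2 * n + 2) ≥ 2 * a7 n)
    × (a7 (4 * n + 6) ≥ 10 * a7 n)
    × (a7bg (+ 0) n ≥ 9 * a7bg (+ 2) n)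
    × (a7bg (+ 1) n ≥ 2 * a7bg -[1+ 0 ] n)
    × ((r : ℕ) → (r ≡ 1 ⊎ r ≡ 2 ⊎ r ≡ 6) →
    a7 (28 * n + 4 * r) ≡ 5 * a7 (14 * n + 2 * r ∸ 1))
    × ((r : ℕ) → (r ≡ 2 ⊎ r ≡ 4 ⊎ r ≡ 5) →
    a7 (28 * n + 4 * r + 2) + 4 * a7 (7 * n + r ∸ 1) ≡ 5 * a7 (14 * n + 2 * r))
theorem1p1 n = first , second , item₃ n , item₄ n , fifth , sixth
  where
  first : a7 (2 * n + 2) ≥ 2 * a7 n
  first = subst₂ (λ a b → 2 * b ≤ a) (sym (a7-at (lem n))) (sym (a7≡𝐀 n)) (𝐀-double (2 + n) (ℕ.s≤s ℕ.z≤n))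
    where
    lem : ∀ n → 2 + (2 * n + 2) ≡ 2 * (2 + n)
    lem = solveℕ
  second : a7 (4 * n + 6) ≥ 10 * a7 n
  second = subst₂ (λ a b → 10 * b ≤ a) (sym (a7-at (lem n))) (sym (a7≡𝐀 n)) (𝐀-quadruple (2 + n) (ℕ.s≤s ℕ.z≤n))
    where
    lem : ∀ n → 2 + (4 * n + 6) ≡ 2 * (2 * (2 + n))
    lem = solveℕ
  fifth : ∀ r → r ≡ 1 ⊎ r ≡ 2 ⊎ r ≡ 6 → a7 (28 * n + 4 * r) ≡ 5 * a7 (14 * n + 2 * r ∸ 1)
  fifth _ (inj₁ refl)        = item₅ n 0 refl
  fifth _ (inj₂ (inj₁ refl)) = item₅ n 1 refl
  fifth _ (inj₂ (inj₂ refl)) = item₅ n 5 refl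
  sixth : ∀ r → r ≡ 2 ⊎ r ≡ 4 ⊎ r ≡ 5 → a7 (28 * n + 4 * r + 2) + 4 * a7 (7 * n + r ∸ 1) ≡ 5 * a7 (14 * n + 2 * r)
  sixth _ (inj₁ refl)        = item₆ n 1 refl
  sixth _ (inj₂ (inj₁ refl)) = item₆ n 3 refl
  sixth _ (inj₂ (inj₂ refl)) = item₆ n 4 refl
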